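{- Let $a,b,e,w$ be positive integers with $w$ odd, and let $p$ be an odd prime with $\gcd(p,w)=1$. Suppose that $\gcd(p-1,w)=1$ or that $\mathrm{ord}_s(p)$ is even for every prime divisor $s$ of $\gcd(p-1,w)$. If a proper $ICW_a(p^bw,p^{2e})$ exists, then $p\le 4a$ and an $ICW_{2a}(w,p^{2e})$ exists.
   Context: $C_v$ is the cyclic group of order $v$. An $ICW_a(v,n)$ is an element $D=\sum_g a_g g\in\mathbb{Z}[C_v]$ with all $a_g\in\{0,\pm1,\dots,\pm a\}$ and $DD^{(-1)}=n$, where $D^{(-1)}=\sum_g a_gg^{ -1}$. Such $D$ is proper if $Dg\notin\mathbb{Z}[H]$ for every $g\in C_v$ and every proper subgroup $H$ of $C_v$. $\mathrm{ord}_s(p)$ is the multiplicative order of $p$ modulo $s$. -}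

module Defs where

open import Data.Nat as ℕ using (ℕ; zero; suc; _∸_; _^_; _<_; _≤_)
open import Data.Nat.DivMod using (_%_; m%n<n)
open import Data.Nat.Divisibility using (_∣_)
open import Data.Nat.Primality using (Prime)
open import Data.Nat.GCD using (gcd)
open import Data.Nat.Coprimality using (Coprime)
open import Data.Fin using (Fin; toℕ; fromℕ<)
open import Data.Integer as ℤ using (ℤ; ∣_∣)
open import Data.List using (List; map; foldr; allFin)
open import Relation.Nullary using (¬_)
open import Data.Product using (Σ; _×_; ∃)
open import Relation.Binary.PropositionalEquality using (_≡_; _≢_)

-- Elements of C_v are identified with Fin v (written additively: i ↦ g^i).
-- Group operation of C_v (addition mod v).
_⊕_ : ∀ {v} → Fin v → Fin v → Fin v
_⊕_ {suc v} i k = fromℕ< (m%n<n (toℕ i ℕ.+ toℕ k) (suc v))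

GroupRingElt : ℕ → Set
GroupRingElt v = Fin v → ℤ

sumℤ : List ℤ → ℤ
sumℤ = foldr ℤ._+_ (ℤ.+ 0)

-- Coefficient of g^k in D D^{(-1)}:  Σ_h a_{h+k} a_h.
corr : ∀ {v} → GroupRingElt v → Fin v → ℤ
corr {v} D k = sumℤ (map (λ h → D (h ⊕ k) ℤ.* D h) (allFin v))

IsICW : (a v n : ℕ) → GroupRingElt v → Set
IsICW a v n D =
  (∀ g → ∣ D g ∣ ≤ a) ×
  (∀ k → (toℕ k ≡ 0 → corr D k ≡ ℤ.+ n) × (toℕ k ≢ 0 → corr D k ≡ ℤ.+ 0))

-- Proper: for every proper subgroup H and every g, Dg ∉ ℤ[H].
-- Subgroups of C_v are H_m = {multiples of m} for m ∣ v; H_m is proper iff m ≠ 1.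
-- Dg^t ∈ ℤ[H_m] iff every element i of the support of D has m ∣ i + t.
IsProper : (v : ℕ) → GroupRingElt v → Set
IsProper v D = ∀ m → m ∣ v → m ≢ 1 → ∀ (t : Fin v) →
  Σ (Fin v) λ i → (D i ≢ ℤ.+ 0) × ¬ (m ∣ (toℕ i ℕ.+ toℕ t))

IsMultOrder : (s p k : ℕ) → Set
IsMultOrder s p k =
  0 < k × s ∣ (p ^ k ∸ 1) × (∀ j → 0 < j → s ∣ (p ^ j ∸ 1) → k ≤ j)

OrdEven : (s p : ℕ) → Set
OrdEven s p = ∀ k → IsMultOrder s p k → 2 ∣ k

ICWExists : (a v n : ℕ) → Set
ICWExists a v n = Σ (GroupRingElt v) (IsICW a v n)

ProperICWExists : (a v n : ℕ) → Set
ProperICWExists a v n = Σ (GroupRingElt v) λ D → IsICW a v n D × IsProper v D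

{-# OPTIONS --safe #-}
-- Write G = C_{p^b} × C_w, let y generate G, put ζ = y^w, and let S be ℤ[C_w][ζ] with ζ a root of unity of order p^b; it is
-- the quotient of ℤ[G] by the sum of the subgroup of order p.  The hypothesis on orders amounts to gcd(p - 1 , w) = 1.
--
-- Let X be the ICW and σ_u : y ↦ y^u with u ≡ 1 mod w, u prime to p.  As X X̄ = p^{2e}, the element ε = σ_u(X) X̄ / p^{2e}
-- has σ_u-norm 1.  Since p is totally ramified, σ_u is trivial modulo 1 - ζ, and S/(1 - ζ) = 𝔽_p[C_w] is reduced, ε is
-- integral.  As ε ε̄ = 1, comparing sums of squares of coefficients gives ε = ± y^k.  The order of u is prime to w, so y^k is
-- a power of ζ; it disappears after translating X, because some u ≢ 1 mod p is available.  The sign is + by applying the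
-- trivial character of C_w: there X is p^e times a unit, which σ_u fixes modulo 1 - ζ.
--
-- So, once translated, X is invariant in S under all σ_u, which forces X = A + B with A supported on C_w and B invariant under the subgroup of
-- order p.  Then A Ā = p^{2e} and |A| ≤ 2a.  Comparing the coefficients of 1 in X X̄ and A Ā gives, with B' the restriction of
-- B to C_w, p Σ B'² ≤ Σ B² = -2 Σ A B' ≤ 4a Σ B'², and B ≠ 0 by properness.
module Submission where

-- Integrality of ε is usually read off from the prime ideals over p. Norms replace them here. Put π
-- = 1 - ζ, Z = σ_u(X) X̄, and let π^φ = p c₀ with φ the totient of the order of ζ. If Z = π^j M
-- with j < φ, then π^(φ-j) Z = p c₀ M; taking norms and cancelling the norm of p shows that the
-- norm of c₀ M vanishes modulo π. Modulo π a norm is a power and c₀ is -1, so reducedness makes M a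
-- multiple of π. After φ rounds p divides Z, and the argument repeats for each further factor p.
-- This is the reason for leaving ℤ[G]: there ζ ↦ 1 kills π but not p, so π cannot divide p. The
-- price is that S forgets every part invariant under the subgroup of order p, which returns as B at
-- the end. All rings in play share one set of elements, the Laurent polynomials in y; only the
-- functions on which equality is tested change. Maps between the rings are therefore the identity
-- on elements, and what has to be proved is that they respect equality. That p is odd separates 1
-- from -1 modulo p, and keeps twice a generator of the subgroup of order p away from 0.

module Cyclotomy where
  open import Data.Nat as ℕ using (ℕ; zero; suc; z≤n; s≤s; _∸_; _!)
  import Data.Nat.Properties as ℕₚ
  import Data.Nat.Divisibility as ℕ∣
  open import Data.Nat.DivMod using (m/n*n≡m)
  open import Data.Nat.GCD using (module Bézout)
  open import Data.Nat.Coprimality as Coprimality using (Coprime; coprime-divisor)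
  open import Data.Nat.Primality using (Prime; euclidsLemma; prime⇒nonTrivial; prime⇒nonZero)
  open import Data.Nat.Combinatorics using (_C_; nCk≡n!/k![n-k]!; k![n∸k]!∣n!; nCk+nC[k+1]≡[n+1]C[k+1]; nCn≡1)
  open import Data.Integer as ℤ using (ℤ; +_; -_; _+_; _*_; _-_; _^_; 0ℤ; 1ℤ; -1ℤ; _≤_; _<_)
  import Data.Integer.Properties as ℤₚ
  open import Data.Integer.DivMod using (_%ℕ_; _/ℕ_; n%ℕd<d; a≡a%ℕn+[a/ℕn]*n)
  open import Data.Integer.Divisibility.Signed using (_∣_; divides; _∣?_; ∣-refl; ∣-trans; ∣⇒∣ᵤ; ∣ᵤ⇒∣; *-monoʳ-∣; *-cancelˡ-∣;
    ∣m∣n⇒∣m+n; ∣m∣n⇒∣m-n; ∣m+n∣m⇒∣n; ∣m+n∣n⇒∣m; ∣m⇒∣-m; ∣n⇒∣m*n; ∣m⇒∣m*n)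
  open import Data.Integer.Tactic.RingSolver using (solve-∀)
  open import Data.Fin as Fin using (Fin; toℕ; fromℕ; inject₁)
  import Data.Fin.Properties as Finₚ
  open import Data.List using (List; []; _∷_; _++_)
  import Data.List.Properties as Listₚ
  open import Data.Maybe using (Maybe; just; nothing)
  open import Data.Product using (∃; ∃₂; _×_; _,_; proj₁; proj₂)
  open import Data.Sum using (_⊎_; inj₁; inj₂)
  open import Data.Unit using (⊤; tt)
  open import Function using (_∘_)
  open import Level using (0ℓ)
  open import Relation.Nullary using (¬_; Dec; yes; no; contradiction)
  open import Relation.Binary.Definitions using (tri<; tri≈; tri>)
  open import Relation.Binary.PropositionalEquality
    using (_≡_; _≢_; refl; sym; trans; cong; cong₂; subst; subst₂; module ≡-Reasoning)
  open import Algebra.Bundles using (AbelianGroup; CommutativeRing; CommutativeSemiring)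
  open import Algebra.Properties.Group (AbelianGroup.group ℤₚ.+-0-abelianGroup) using () renaming (∙-cancelˡ to +-cancelˡ)
  open import Algebra.Solver.Ring.AlmostCommutativeRing using (AlmostCommutativeRing; fromCommutativeRing; _-Raw-AlmostCommutative⟶_)
  import Algebra.Properties.CommutativeSemiring.Binomial
  import Algebra.Properties.Semiring.Exp
  import Algebra.Properties.Semiring.Mult
  import Algebra.Properties.CommutativeMonoid.Mult
  import Algebra.Properties.Semiring.Sum
  import Algebra.Solver.Ring

  -- Finite sums and periodic functions

  ℤ-+-congˡ : ∀ a {b c : ℤ} → b ≡ c → a + b ≡ a + c
  ℤ-+-congˡ a = cong (λ x → a + x)

  ∑ : ℕ → (ℕ → ℤ) → ℤ
  ∑ zero    f = 0ℤ
  ∑ (suc n) f = f n + ∑ n f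

  ∑-cong< : ∀ n {f g : ℕ → ℤ} → (∀ i → i ℕ.< n → f i ≡ g i) → ∑ n f ≡ ∑ n g
  ∑-cong< zero    h = refl
  ∑-cong< (suc n) h = cong₂ _+_ (h n ℕₚ.≤-refl) (∑-cong< n λ i i<n → h i (ℕₚ.m≤n⇒m≤1+n i<n))

  ∑-cong : ∀ n {f g : ℕ → ℤ} → (∀ i → f i ≡ g i) → ∑ n f ≡ ∑ n g
  ∑-cong n h = ∑-cong< n λ i _ → h i

  ∑-0 : ∀ n → ∑ n (λ _ → 0ℤ) ≡ 0ℤ
  ∑-0 zero    = refl
  ∑-0 (suc n) = trans (ℤₚ.+-identityˡ _) (∑-0 n)

  ∑-+ : ∀ n (f g : ℕ → ℤ) → ∑ n (λ i → f i + g i) ≡ ∑ n f + ∑ n g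
  ∑-+ zero    f g = refl
  ∑-+ (suc n) f g = trans (ℤ-+-congˡ (f n + g n) (∑-+ n f g)) (rearr (f n) (g n) _ _)
    where
    rearr : ∀ a b c d → a + b + (c + d) ≡ a + c + (b + d)
    rearr = solve-∀

  ∑-- : ∀ n (f g : ℕ → ℤ) → ∑ n (λ i → f i - g i) ≡ ∑ n f - ∑ n g
  ∑-- zero    f g = refl
  ∑-- (suc n) f g = trans (ℤ-+-congˡ (f n - g n) (∑-- n f g)) (eq (f n) (∑ n f) (g n) (∑ n g))
    where
    eq : ∀ a b c d → a - c + (b - d) ≡ a + b - (c + d)
    eq = solve-∀

  ∑-* : ∀ n c (f : ℕ → ℤ) → ∑ n (λ i → c * f i) ≡ c * ∑ n f
  ∑-* zero    c f = sym (ℤₚ.*-zeroʳ c)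
  ∑-* (suc n) c f = trans (ℤ-+-congˡ (c * f n) (∑-* n c f)) (sym (ℤₚ.*-distribˡ-+ c (f n) (∑ n f)))

  ∑-const : ∀ n c → ∑ n (λ _ → c) ≡ + n * c
  ∑-const zero    c = sym (ℤₚ.*-zeroˡ c)
  ∑-const (suc n) c = trans (ℤ-+-congˡ c (∑-const n c)) (sym (ℤₚ.suc-* (+ n) c))

  ∑-mono : ∀ n {f g : ℕ → ℤ} → (∀ i → f i ≤ g i) → ∑ n f ≤ ∑ n g
  ∑-mono zero    h = ℤₚ.≤-refl
  ∑-mono (suc n) h = ℤₚ.+-mono-≤ (h n) (∑-mono n h)

  ∑-swap : ∀ m n (f : ℕ → ℕ → ℤ) → ∑ m (λ i → ∑ n (f i)) ≡ ∑ n (λ j → ∑ m (λ i → f i j))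
  ∑-swap zero    n f = sym (∑-0 n)
  ∑-swap (suc m) n f = trans (ℤ-+-congˡ (∑ n (f m)) (∑-swap m n f)) (sym (∑-+ n (f m) λ j → ∑ m (λ i → f i j)))

  ∑-shift : ∀ n (f : ℕ → ℤ) → ∑ (suc n) f ≡ f 0 + ∑ n (λ i → f (suc i))
  ∑-shift zero    f = refl
  ∑-shift (suc n) f = trans (ℤ-+-congˡ (f (suc n)) (∑-shift n f)) (rearr (f (suc n)) (f 0) (∑ n λ i → f (suc i)))
    where
    rearr : ∀ a b c → a + (b + c) ≡ b + (a + c)
    rearr = solve-∀

  ∑-++ : ∀ m n (f : ℕ → ℤ) → ∑ (m ℕ.+ n) f ≡ ∑ n f + ∑ m (λ i → f (i ℕ.+ n))
  ∑-++ zero    n f = sym (ℤₚ.+-identityʳ _)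
  ∑-++ (suc m) n f = trans (ℤ-+-congˡ (f (m ℕ.+ n)) (∑-++ m n f)) (rearr (f (m ℕ.+ n)) (∑ n f) (∑ m λ i → f (i ℕ.+ n)))
    where
    rearr : ∀ a b c → a + (b + c) ≡ b + (a + c)
    rearr = solve-∀

  ∑-blocks : ∀ m n (f : ℕ → ℤ) → ∑ (m ℕ.* n) f ≡ ∑ m (λ j → ∑ n (λ i → f (i ℕ.+ j ℕ.* n)))
  ∑-blocks zero    n f = refl
  ∑-blocks (suc m) n f = begin
    ∑ (n ℕ.+ m ℕ.* n) f                                   ≡⟨ ∑-++ n (m ℕ.* n) f ⟩
    ∑ (m ℕ.* n) f + ∑ n (λ i → f (i ℕ.+ m ℕ.* n))        ≡⟨ ℤₚ.+-comm _ (∑ n _) ⟩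
    ∑ n (λ i → f (i ℕ.+ m ℕ.* n)) + ∑ (m ℕ.* n) f        ≡⟨ ℤ-+-congˡ (∑ n (λ i → f (i ℕ.+ m ℕ.* n))) (∑-blocks m n f) ⟩
    _                                                     ∎
    where open ≡-Reasoning

  ∑-neg⇒∃neg : ∀ n (f : ℕ → ℤ) → ∑ n f < 0ℤ → ∃ λ i → f i < 0ℤ
  ∑-neg⇒∃neg zero    f (ℤ.+<+ ())
  ∑-neg⇒∃neg (suc n) f neg with f n ℤ.<? 0ℤ
  ... | yes fn<0 = n , fn<0
  ... | no fn≮0  = ∑-neg⇒∃neg n f (ℤₚ.≤-<-trans (ℤₚ.≤-trans (ℤₚ.≤-reflexive (sym (ℤₚ.+-identityˡ _)))
                      (ℤₚ.+-monoˡ-≤ _ (ℤₚ.≮⇒≥ fn≮0))) neg)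

  ∑-nonneg : ∀ n {f : ℕ → ℤ} → (∀ i → 0ℤ ≤ f i) → 0ℤ ≤ ∑ n f
  ∑-nonneg n h = ℤₚ.≤-trans (ℤₚ.≤-reflexive (sym (∑-0 n))) (∑-mono n h)

  ∑-nonneg-≤0 : ∀ n {f : ℕ → ℤ} → (∀ i → 0ℤ ≤ f i) → ∑ n f ≤ 0ℤ → ∀ i → i ℕ.< n → f i ≡ 0ℤ
  ∑-nonneg-≤0 (suc n) {f} pos le i i<sn with ℕₚ.m≤n⇒m<n∨m≡n (ℕ.s≤s⁻¹ i<sn)
  ... | inj₁ i<n  = ∑-nonneg-≤0 n pos (ℤₚ.≤-trans (ℤₚ.≤-trans (ℤₚ.≤-reflexive (sym (ℤₚ.+-identityˡ _)))
                       (ℤₚ.+-monoˡ-≤ _ (pos n))) le) i i<n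
  ... | inj₂ refl = ℤₚ.≤-antisym (ℤₚ.≤-trans (ℤₚ.≤-trans (ℤₚ.≤-reflexive (sym (ℤₚ.+-identityʳ _)))
                       (ℤₚ.+-monoʳ-≤ (f n) (∑-nonneg n pos))) le) (pos i)

  square≥0 : ∀ x → 0ℤ ≤ x * x
  square≥0 (+ n)      = subst (0ℤ ≤_) (ℤₚ.pos-* n n) (ℤ.+≤+ z≤n)
  square≥0 ℤ.-[1+ n ] = ℤ.+≤+ z≤n

  square≡0 : ∀ x → x * x ≡ 0ℤ → x ≡ 0ℤ
  square≡0 x eq with ℤₚ.i*j≡0⇒i≡0∨j≡0 x eq
  ... | inj₁ e = e
  ... | inj₂ e = e

  -- The coefficient function of 1 in ℤ[C_v], as a periodic function on ℤ.
  δ : ℤ → ℤ → ℤ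
  δ v n with v ∣? n
  ... | yes _ = 1ℤ
  ... | no  _ = 0ℤ

  δ-yes : ∀ {v n} → v ∣ n → δ v n ≡ 1ℤ
  δ-yes {v} {n} d with v ∣? n
  ... | yes _ = refl
  ... | no ¬d = contradiction d ¬d

  δ-no : ∀ {v n} → ¬ v ∣ n → δ v n ≡ 0ℤ
  δ-no {v} {n} ¬d with v ∣? n
  ... | yes d = contradiction d ¬d
  ... | no _  = refl

  δ-iff : ∀ {v n v′ n′} → (v ∣ n → v′ ∣ n′) → (v′ ∣ n′ → v ∣ n) → δ v n ≡ δ v′ n′
  δ-iff {v} {n} to from with v ∣? n
  ... | yes d = sym (δ-yes (to d))
  ... | no ¬d = sym (δ-no λ d → ¬d (from d))

  ∣-resp : ∀ {v} m n → v ∣ m - n → v ∣ n → v ∣ m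
  ∣-resp {v} m n d e = subst (v ∣_) (eq m n) (∣m∣n⇒∣m+n d e)
    where
    eq : ∀ m n → m - n + n ≡ m
    eq = solve-∀

  ∣-flip : ∀ {v} m n → v ∣ m - n → v ∣ n - m
  ∣-flip {v} m n d = subst (v ∣_) (eq m n) (∣m⇒∣-m d)
    where
    eq : ∀ m n → - (m - n) ≡ n - m
    eq = solve-∀

  δ-cong : ∀ {v} m n → v ∣ m - n → δ v m ≡ δ v n
  δ-cong m n d = δ-iff (∣-resp n m (∣-flip m n d)) (∣-resp m n d)

  Periodic : ℤ → (ℤ → ℤ) → Set
  Periodic v f = ∀ g → f (g + v) ≡ f g

  private
    iter : ∀ {f v} → Periodic v f → ∀ n g → f (g + + n * v) ≡ f g
    iter {f} {v} per zero    g = cong f (eq g v)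
      where
      eq : ∀ g v → g + 0ℤ * v ≡ g
      eq = solve-∀
    iter {f} {v} per (suc n) g = trans (cong f (eq g (+ n) v)) (trans (per _) (iter per n g))
      where
      eq : ∀ g n v → g + (1ℤ + n) * v ≡ g + n * v + v
      eq = solve-∀

  periodic-* : ∀ {f v} → Periodic v f → ∀ q g → f (g + q * v) ≡ f g
  periodic-* {f} {v} per (+ n) g = iter per n g
  periodic-* {f} {v} per ℤ.-[1+ n ] g = trans (sym (iter per (suc n) _)) (cong f (eq g (+ suc n) v))
    where
    eq : ∀ g n v → g + - n * v + n * v ≡ g
    eq = solve-∀

  periodic-∣ : ∀ {f v} → Periodic v f → ∀ m n → v ∣ m - n → f m ≡ f n
  periodic-∣ {f} {v} per m n (divides q eq) =
    trans (cong f (trans (eq′ m n) (ℤ-+-congˡ n eq))) (periodic-* per q n)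
    where
    eq′ : ∀ m n → m ≡ n + (m - n)
    eq′ = solve-∀

  δ-self-periodic : ∀ v → Periodic v (δ v)
  δ-self-periodic v g = δ-cong (g + v) g (subst (v ∣_) (sym (eq g v)) ∣-refl)
    where
    eq : ∀ g v → g + v - g ≡ v
    eq = solve-∀

  ∣-%ℕ : ∀ v .{{_ : ℕ.NonZero v}} n → + v ∣ n - + (n %ℕ v)
  ∣-%ℕ v n = divides (n /ℕ v) (trans (cong (λ x → x - + (n %ℕ v)) (a≡a%ℕn+[a/ℕn]*n n v)) (eq (+ (n %ℕ v)) ((n /ℕ v) * + v)))
    where
    eq : ∀ r x → r + x - r ≡ x
    eq = solve-∀

  periodic-∀ : ∀ v .{{_ : ℕ.NonZero v}} {f : ℤ → ℤ} → Periodic (+ v) f → (∀ i → i ℕ.< v → f (+ i) ≡ 0ℤ) → ∀ n → f n ≡ 0ℤ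
  periodic-∀ v per h n = trans (periodic-∣ per n (+ (n %ℕ v)) (∣-%ℕ v n)) (h (n %ℕ v) (n%ℕd<d n v))

  δ-periodic : ∀ v k → Periodic v (λ n → δ v (n - k))
  δ-periodic v k g = δ-cong (g + v - k) (g - k) (subst (v ∣_) (sym (eq g k v)) ∣-refl)
    where
    eq : ∀ g k v → g + v - k - (g - k) ≡ v
    eq = solve-∀

  ∑-shift₁ : ∀ v {f} → Periodic (+ v) f → ∑ v (λ n → f (+ n + 1ℤ)) ≡ ∑ v (λ n → f (+ n))
  ∑-shift₁ v {f} per = +-cancelˡ (f 0ℤ) _ _ (begin
    f 0ℤ + ∑ v (λ n → f (+ n + 1ℤ))    ≡⟨ ℤ-+-congˡ (f 0ℤ) (∑-cong v λ n → cong f (ℤₚ.+-comm (+ n) 1ℤ)) ⟩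
    f 0ℤ + ∑ v (λ n → f (+ suc n))     ≡⟨ ∑-shift v (λ n → f (+ n)) ⟨
    f (+ v) + ∑ v (λ n → f (+ n))      ≡⟨ cong (λ x → x + ∑ v (λ n → f (+ n))) (trans (cong f (sym (ℤₚ.+-identityˡ (+ v)))) (per 0ℤ)) ⟩
    f 0ℤ + ∑ v (λ n → f (+ n))         ∎)
    where open ≡-Reasoning

  ∑-shiftₙ : ∀ v {f} → Periodic (+ v) f → ∀ k → ∑ v (λ n → f (+ n + + k)) ≡ ∑ v (λ n → f (+ n))
  ∑-shiftₙ v {f} per zero    = ∑-cong v λ n → cong f (ℤₚ.+-identityʳ _)
  ∑-shiftₙ v {f} per (suc k) = begin
    ∑ v (λ n → f (+ n + + suc k))        ≡⟨ ∑-cong v (λ n → cong f (eq (+ n) (+ k))) ⟩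
    ∑ v (λ n → f (+ n + 1ℤ + + k))       ≡⟨ ∑-shift₁ v {λ m → f (m + + k)} (λ g → trans (cong f (eq′ g (+ v) (+ k))) (per _)) ⟩
    ∑ v (λ n → f (+ n + + k))            ≡⟨ ∑-shiftₙ v per k ⟩
    ∑ v (λ n → f (+ n))                  ∎
    where
    open ≡-Reasoning
    eq : ∀ n k → n + (1ℤ + k) ≡ n + 1ℤ + k
    eq = solve-∀
    eq′ : ∀ g v k → g + v + k ≡ g + k + v
    eq′ = solve-∀

  ∑-translate : ∀ v {f} → Periodic (+ v) f → ∀ k → ∑ v (λ n → f (+ n + k)) ≡ ∑ v (λ n → f (+ n))
  ∑-translate v {f} per (+ k)      = ∑-shiftₙ v per k
  ∑-translate v {f} per ℤ.-[1+ k ] = trans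
    (sym (∑-shiftₙ v {λ m → f (m + ℤ.-[1+ k ])} (λ g → trans (cong f (eq′ g (+ v) ℤ.-[1+ k ])) (per _)) (suc k)))
    (∑-cong v λ n → cong f (eq (+ n) (+ suc k)))
    where
    eq : ∀ n k → n + k + - k ≡ n
    eq = solve-∀
    eq′ : ∀ g v k → g + v + k ≡ g + k + v
    eq′ = solve-∀

  ∑-first : ∀ n (f : ℕ → ℤ) → (∀ i → suc i ℕ.< suc n → f (suc i) ≡ 0ℤ) → ∑ (suc n) f ≡ f 0
  ∑-first n f h = trans (∑-shift n f) (trans (ℤ-+-congˡ (f 0) (trans (∑-cong< n λ i i<n → h i (s≤s i<n)) (∑-0 n)))
    (ℤₚ.+-identityʳ _))

  ∤-small : ∀ {v i} → suc i ℕ.< v → ¬ (+ v ∣ + suc i)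
  ∤-small i<v d = ℕ∣.>⇒∤ i<v (∣⇒∣ᵤ d)

  -- Translation by k moves the only nonzero term to n = 0.
  ∑-δ : ∀ v .{{_ : ℕ.NonZero v}} {f} → Periodic (+ v) f → ∀ k →
        ∑ v (λ n → f (+ n) * δ (+ v) (+ n - k)) ≡ f k
  ∑-δ (suc v) {f} per k = begin
    ∑ (suc v) (λ n → f (+ n) * δ (+ suc v) (+ n - k))
      ≡⟨ ∑-translate (suc v) {λ m → f m * δ (+ suc v) (m - k)}
           (λ g → cong₂ _*_ (per g) (δ-periodic (+ suc v) k g)) k ⟨
    ∑ (suc v) (λ n → f (+ n + k) * δ (+ suc v) (+ n + k - k))
      ≡⟨ ∑-first v (λ n → f (+ n + k) * δ (+ suc v) (+ n + k - k)) (λ i i<v → trans (cong (f (+ suc i + k) *_)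
           (trans (cong (δ (+ suc v)) (eq (+ suc i) k)) (δ-no (∤-small i<v)))) (ℤₚ.*-zeroʳ (f (+ suc i + k)))) ⟩
    f (0ℤ + k) * δ (+ suc v) (0ℤ + k - k)
      ≡⟨ cong₂ _*_ (cong f (ℤₚ.+-identityˡ k)) (δ-yes (subst (+ suc v ∣_) (sym (eq 0ℤ k)) (divides 0ℤ refl))) ⟩
    f k * 1ℤ
      ≡⟨ ℤₚ.*-identityʳ _ ⟩
    f k ∎
    where
    open ≡-Reasoning
    eq : ∀ n k → n + k - k ≡ n
    eq = solve-∀

  -- A multiple of m lies in exactly one class j m + q m ℤ with j < q. Consequently the coefficients
  -- in a quotient of a cyclic group are sums over fibres, as in `act-δ-fold`.
  ∑-fold-δ : ∀ q m .{{_ : ℕ.NonZero q}} .{{_ : ℕ.NonZero m}} n →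
    δ (+ m) n ≡ ∑ q (λ j → δ (+ (q ℕ.* m)) (n - + j * + m))
  ∑-fold-δ q m n with + m ∣? n
  ... | no ¬d = sym (trans (∑-cong q λ j → δ-no λ d → ¬d (∣-resp′ j d)) (∑-0 q))
    where
    eq : ∀ n j m → n - j * m + j * m ≡ n
    eq = solve-∀
    ∣-resp′ : ∀ j → + (q ℕ.* m) ∣ n - + j * + m → + m ∣ n
    ∣-resp′ j d = subst (+ m ∣_) (eq n (+ j) (+ m))
      (∣m∣n⇒∣m+n (∣-trans (divides (+ q) (ℤₚ.pos-* q m)) d) (divides (+ j) refl))
  ... | yes (divides k eq) = sym (trans (∑-cong q step) (∑-δ q {λ _ → 1ℤ} (λ _ → refl) k))
    where
    eq₁ : ∀ k j m → k * m - j * m ≡ m * (k - j)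
    eq₁ = solve-∀
    qm : + (q ℕ.* m) ≡ + m * + q
    qm = trans (ℤₚ.pos-* q m) (ℤₚ.*-comm (+ q) (+ m))
    to : ∀ j → + (q ℕ.* m) ∣ n - + j * + m → + q ∣ + j - k
    to j d = ∣-flip k (+ j) (*-cancelˡ-∣ (+ m) (subst₂ _∣_ qm (trans (cong (λ x → x - + j * + m) eq) (eq₁ k (+ j) (+ m))) d))
    from : ∀ j → + q ∣ + j - k → + (q ℕ.* m) ∣ n - + j * + m
    from j d = subst₂ _∣_ (sym qm) (sym (trans (cong (λ x → x - + j * + m) eq) (eq₁ k (+ j) (+ m)))) (*-monoʳ-∣ (+ m) (∣-flip (+ j) k d))
    step : ∀ j → δ (+ (q ℕ.* m)) (n - + j * + m) ≡ 1ℤ * δ (+ q) (+ j - k)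
    step j = trans (δ-iff (to j) (from j)) (sym (ℤₚ.*-identityˡ _))

  -- Laurent polynomials

  -- A Laurent polynomial Σ c y^k is a list of pairs (c , k); y acts on functions ℤ → ℤ by translation.

  Laurent : Set
  Laurent = List (ℤ × ℤ)

  infixl 7 _⊛_
  infixl 6 _⊞_

  opaque

    act : Laurent → (ℤ → ℤ) → ℤ → ℤ
    act []            D g = 0ℤ
    act ((c , k) ∷ L) D g = c * D (g - k) + act L D g

    scale : ℤ → ℤ → Laurent → Laurent
    scale c k []             = []
    scale c k ((d , l) ∷ M) = (c * d , k + l) ∷ scale c k M

    _⊞_ : Laurent → Laurent → Laurent
    _⊞_ = _++_

    _⊛_ : Laurent → Laurent → Laurent
    []            ⊛ M = []
    ((c , k) ∷ L) ⊛ M = scale c k M ⊞ L ⊛ M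

    mono : ℤ → ℤ → Laurent
    mono c k = (c , k) ∷ []

    neg : Laurent → Laurent
    neg []            = []
    neg ((c , k) ∷ L) = (- c , k) ∷ neg L

    act-cong : ∀ L {D E : ℤ → ℤ} → (∀ g → D g ≡ E g) → ∀ g → act L D g ≡ act L E g
    act-cong []            h g = refl
    act-cong ((c , k) ∷ L) h g = cong₂ (λ x y → c * x + y) (h (g - k)) (act-cong L h g)

    act-⊞ : ∀ L M D g → act (L ⊞ M) D g ≡ act L D g + act M D g
    act-⊞ []            M D g = sym (ℤₚ.+-identityˡ _)
    act-⊞ ((c , k) ∷ L) M D g = trans (ℤ-+-congˡ (c * D (g - k)) (act-⊞ L M D g)) (sym (ℤₚ.+-assoc (c * D (g - k)) (act L D g) (act M D g)))

    act-scale : ∀ c k M D g → act (scale c k M) D g ≡ c * act M D (g - k)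
    act-scale c k []            D g = sym (ℤₚ.*-zeroʳ c)
    act-scale c k ((d , l) ∷ M) D g = trans
      (cong₂ (λ x y → c * d * D x + y) (eq₁ g k l) (act-scale c k M D g)) (eq₂ c d (D (g - k - l)) (act M D (g - k)))
      where
      eq₁ : ∀ g k l → g - (k + l) ≡ g - k - l
      eq₁ = solve-∀
      eq₂ : ∀ c d x y → c * d * x + c * y ≡ c * (d * x + y)
      eq₂ = solve-∀

    ⊞-assoc : ∀ L M N → (L ⊞ M) ⊞ N ≡ L ⊞ (M ⊞ N)
    ⊞-assoc = Listₚ.++-assoc

    ⊞-identityˡ : ∀ L → [] ⊞ L ≡ L
    ⊞-identityˡ L = refl

    ⊞-identityʳ : ∀ L → L ⊞ [] ≡ L
    ⊞-identityʳ = Listₚ.++-identityʳ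

    act-⊛ : ∀ L M D g → act (L ⊛ M) D g ≡ act L (act M D) g
    act-⊛ []            M D g = refl
    act-⊛ ((c , k) ∷ L) M D g = trans (act-⊞ (scale c k M) (L ⊛ M) D g) (cong₂ _+_ (act-scale c k M D g) (act-⊛ L M D g))

    act-[] : ∀ D g → act [] D g ≡ 0ℤ
    act-[] D g = refl

    act-mono : ∀ c k D g → act (mono c k) D g ≡ c * D (g - k)
    act-mono c k D g = ℤₚ.+-identityʳ _

    ∷≡⊞ : ∀ c k L → (c , k) ∷ L ≡ mono c k ⊞ L
    ∷≡⊞ c k L = refl

    mono-⊛ : ∀ c k d l → mono c k ⊛ mono d l ≡ mono (c * d) (k + l)
    mono-⊛ c k d l = refl

    act-neg : ∀ L D g → act (neg L) D g ≡ - act L D g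
    act-neg []            D g = refl
    act-neg ((c , k) ∷ L) D g = trans (ℤ-+-congˡ (- c * D (g - k)) (act-neg L D g)) (eq c (D (g - k)) (act L D g))
      where
      eq : ∀ c d x → - c * d + - x ≡ - (c * d + x)
      eq = solve-∀

    act-0 : ∀ L {D : ℤ → ℤ} → (∀ g → D g ≡ 0ℤ) → ∀ g → act L D g ≡ 0ℤ
    act-0 []            h g = refl
    act-0 ((c , k) ∷ L) h g = trans (cong₂ (λ x y → c * x + y) (h (g - k)) (act-0 L h g)) (eq c)
      where
      eq : ∀ c → c * 0ℤ + 0ℤ ≡ 0ℤ
      eq = solve-∀

    -- The shape c D(n - k) + E(n) is what `act` produces on a list with head (c , k), so this is
    -- the induction step of `act-comm`.
    act-linear : ∀ L c k (D E : ℤ → ℤ) g → act L (λ n → c * D (n - k) + E n) g ≡ c * act L D (g - k) + act L E g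
    act-linear []            c k D E g = eq c
      where
      eq : ∀ c → 0ℤ ≡ c * 0ℤ + 0ℤ
      eq = solve-∀
    act-linear ((d , l) ∷ L) c k D E g = trans
      (cong₂ (λ x y → d * (c * D x + E (g - l)) + y) (eq₁ g k l) (act-linear L c k D E g))
      (eq₂ d c (D (g - k - l)) (E (g - l)) (act L D (g - k)) (act L E g))
      where
      eq₁ : ∀ g k l → g - l - k ≡ g - k - l
      eq₁ = solve-∀
      eq₂ : ∀ d c x y z w → d * (c * x + y) + (c * z + w) ≡ c * (d * x + z) + (d * y + w)
      eq₂ = solve-∀

    act-comm : ∀ L M D g → act L (act M D) g ≡ act M (act L D) g
    act-comm []            M D g = sym (act-0 M (λ _ → refl) g)
    act-comm ((c , k) ∷ L) M D g = trans (ℤ-+-congˡ (c * act M D (g - k)) (act-comm L M D g)) (sym (act-linear M c k D (act L D) g))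

    act-translate : ∀ L D t g → act L (λ n → D (n + t)) g ≡ act L D (g + t)
    act-translate []            D t g = refl
    act-translate ((c , k) ∷ L) D t g = cong₂ (λ x y → c * D x + y) (eq g k t) (act-translate L D t g)
      where
      eq : ∀ g k t → g - k + t ≡ g + t - k
      eq = solve-∀

    act-periodic : ∀ L {D v} → Periodic v D → Periodic v (act L D)
    act-periodic L {D} {v} per g = trans (sym (act-translate L D v g)) (act-cong L per g)

    act-∑ : ∀ L n (D : ℕ → ℤ → ℤ) g → act L (λ m → ∑ n (λ j → D j m)) g ≡ ∑ n (λ j → act L (D j) g)
    act-∑ []            n D g = sym (∑-0 n)
    act-∑ ((c , k) ∷ L) n D g = trans (cong₂ _+_ (sym (∑-* n c (λ j → D j (g - k)))) (act-∑ L n D g))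
      (sym (∑-+ n (λ j → c * D j (g - k)) (λ j → act L (D j) g)))

    σ : ℤ → Laurent → Laurent
    σ u []            = []
    σ u ((c , k) ∷ L) = (c , u * k) ∷ σ u L

    σ-⊞ : ∀ u L M → σ u (L ⊞ M) ≡ σ u L ⊞ σ u M
    σ-⊞ u []            M = refl
    σ-⊞ u ((c , k) ∷ L) M = cong ((c , u * k) ∷_) (σ-⊞ u L M)

    σ-scale : ∀ u c k M → σ u (scale c k M) ≡ scale c (u * k) (σ u M)
    σ-scale u c k []            = refl
    σ-scale u c k ((d , l) ∷ M) = cong₂ (λ x y → (c * d , x) ∷ y) (ℤₚ.*-distribˡ-+ u k l) (σ-scale u c k M)

    σ-⊛ : ∀ u L M → σ u (L ⊛ M) ≡ σ u L ⊛ σ u M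
    σ-⊛ u []            M = refl
    σ-⊛ u ((c , k) ∷ L) M = trans (σ-⊞ u (scale c k M) (L ⊛ M)) (cong₂ _⊞_ (σ-scale u c k M) (σ-⊛ u L M))

    σ-mono : ∀ u c k → σ u (mono c k) ≡ mono c (u * k)
    σ-mono u c k = refl

    σ-[] : ∀ u → σ u [] ≡ []
    σ-[] u = refl

    σ-neg : ∀ u L → σ u (neg L) ≡ neg (σ u L)
    σ-neg u []            = refl
    σ-neg u ((c , k) ∷ L) = cong ((- c , u * k) ∷_) (σ-neg u L)

    -- A change of variables has to be checked on monomials only. Every formula for the coefficients
    -- of `σ u L` is an instance.
    act-σ : ∀ {u D E g h} → (∀ k → D (g - u * k) ≡ E (h - k)) → ∀ L → act (σ u L) D g ≡ act L E h
    act-σ eq []            = refl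
    act-σ eq ((c , k) ∷ L) = cong₂ (λ x y → c * x + y) (eq k) (act-σ eq L)

    σ-∘ : ∀ u t L → σ u (σ t L) ≡ σ (u * t) L
    σ-∘ u t []            = refl
    σ-∘ u t ((c , k) ∷ L) = cong₂ (λ x y → (c , x) ∷ y) (sym (ℤₚ.*-assoc u t k)) (σ-∘ u t L)

    σ-1 : ∀ L → σ 1ℤ L ≡ L
    σ-1 []            = refl
    σ-1 ((c , k) ∷ L) = cong₂ (λ x y → (c , x) ∷ y) (ℤₚ.*-identityˡ k) (σ-1 L)

  const : ℤ → Laurent
  const c = mono c 0ℤ

  y^ : ℤ → Laurent
  y^ k = mono 1ℤ k

  act-const : ∀ c D g → act (const c) D g ≡ c * D g
  act-const c D g = trans (act-mono c 0ℤ D g) (cong (λ x → c * D x) (ℤₚ.+-identityʳ g))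

  act-y^ : ∀ k D g → act (y^ k) D g ≡ D (g - k)
  act-y^ k D g = trans (act-mono 1ℤ k D g) (ℤₚ.*-identityˡ _)

  σ-const : ∀ u c → σ u (const c) ≡ const c
  σ-const u c = trans (σ-mono u c 0ℤ) (cong (mono c) (ℤₚ.*-zeroʳ u))

  -- Laurent polynomials acting equally on every 𝒟 i are identified: all functions give ℤ[y, y⁻¹], and δ v gives ℤ[C_v].
  module LaurentRing {Ix : Set} (𝒟 : Ix → ℤ → ℤ) where

    infix 4 _≈_

    record _≈_ (L M : Laurent) : Set where
      constructor mk
      field at : ∀ i g → act L (𝒟 i) g ≡ act M (𝒟 i) g
    open _≈_ public

    ≈-refl : ∀ {L} → L ≈ L
    ≈-refl = mk λ _ _ → refl

    ≈-sym : ∀ {L M} → L ≈ M → M ≈ L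
    ≈-sym e = mk λ i g → sym (at e i g)

    ≈-trans : ∀ {L M N} → L ≈ M → M ≈ N → L ≈ N
    ≈-trans e f = mk λ i g → trans (at e i g) (at f i g)

    ≡⇒≈ : ∀ {L M} → L ≡ M → L ≈ M
    ≡⇒≈ refl = ≈-refl

    private
      act-⊛′ : ∀ L M D g → act (L ⊛ M) D g ≡ act M (act L D) g
      act-⊛′ L M D g = trans (act-⊛ L M D g) (act-comm L M D g)

    ⊞-cong : ∀ {L L′ M M′} → L ≈ L′ → M ≈ M′ → L ⊞ M ≈ L′ ⊞ M′
    ⊞-cong {L} {L′} {M} {M′} e f = mk λ i g → trans (act-⊞ L M (𝒟 i) g)
      (trans (cong₂ _+_ (at e i g) (at f i g)) (sym (act-⊞ L′ M′ (𝒟 i) g)))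

    -- Equality is tested on `𝒟 i` alone, so a factor can be replaced only while it is the one that
    -- acts first; commuting the two actions brings each factor into that place.
    ⊛-cong : ∀ {L L′ M M′} → L ≈ L′ → M ≈ M′ → L ⊛ M ≈ L′ ⊛ M′
    ⊛-cong {L} {L′} {M} {M′} e f = mk λ i g → begin
      act (L ⊛ M) (𝒟 i) g       ≡⟨ act-⊛ L M (𝒟 i) g ⟩
      act L (act M (𝒟 i)) g     ≡⟨ act-cong L (at f i) g ⟩
      act L (act M′ (𝒟 i)) g    ≡⟨ act-comm L M′ (𝒟 i) g ⟩
      act M′ (act L (𝒟 i)) g    ≡⟨ act-cong M′ (at e i) g ⟩
      act M′ (act L′ (𝒟 i)) g   ≡⟨ act-⊛′ L′ M′ (𝒟 i) g ⟨
      act (L′ ⊛ M′) (𝒟 i) g     ∎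
      where open ≡-Reasoning

    neg-cong : ∀ {L M} → L ≈ M → neg L ≈ neg M
    neg-cong {L} {M} e = mk λ i g → trans (act-neg L (𝒟 i) g) (trans (cong -_ (at e i g)) (sym (act-neg M (𝒟 i) g)))

    ⊞-comm : ∀ L M → L ⊞ M ≈ M ⊞ L
    ⊞-comm L M = mk λ i g → trans (act-⊞ L M (𝒟 i) g) (trans (ℤₚ.+-comm (act L (𝒟 i) g) _) (sym (act-⊞ M L (𝒟 i) g)))

    ⊛-comm : ∀ L M → L ⊛ M ≈ M ⊛ L
    ⊛-comm L M = mk λ i g → trans (act-⊛ L M (𝒟 i) g) (sym (act-⊛′ M L (𝒟 i) g))

    ⊛-assoc : ∀ L M N → (L ⊛ M) ⊛ N ≈ L ⊛ (M ⊛ N)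
    ⊛-assoc L M N = mk λ i g → begin
      act (L ⊛ M ⊛ N) (𝒟 i) g            ≡⟨ act-⊛ (L ⊛ M) N (𝒟 i) g ⟩
      act (L ⊛ M) (act N (𝒟 i)) g        ≡⟨ act-⊛ L M (act N (𝒟 i)) g ⟩
      act L (act M (act N (𝒟 i))) g      ≡⟨ act-cong L (act-⊛ M N (𝒟 i)) g ⟨
      act L (act (M ⊛ N) (𝒟 i)) g        ≡⟨ act-⊛ L (M ⊛ N) (𝒟 i) g ⟨
      act (L ⊛ (M ⊛ N)) (𝒟 i) g          ∎
      where open ≡-Reasoning

    ⊛-identityˡ : ∀ L → const 1ℤ ⊛ L ≈ L
    ⊛-identityˡ L = mk λ i g → trans (act-⊛ (const 1ℤ) L (𝒟 i) g)
      (trans (act-const 1ℤ (act L (𝒟 i)) g) (ℤₚ.*-identityˡ _))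

    ⊛-distribˡ : ∀ L M N → L ⊛ (M ⊞ N) ≈ L ⊛ M ⊞ L ⊛ N
    ⊛-distribˡ L M N = mk λ i g → begin
      act (L ⊛ (M ⊞ N)) (𝒟 i) g                         ≡⟨ act-⊛′ L (M ⊞ N) (𝒟 i) g ⟩
      act (M ⊞ N) (act L (𝒟 i)) g                       ≡⟨ act-⊞ M N (act L (𝒟 i)) g ⟩
      act M (act L (𝒟 i)) g + act N (act L (𝒟 i)) g     ≡⟨ cong₂ _+_ (act-⊛′ L M (𝒟 i) g) (act-⊛′ L N (𝒟 i) g) ⟨
      act (L ⊛ M) (𝒟 i) g + act (L ⊛ N) (𝒟 i) g         ≡⟨ act-⊞ (L ⊛ M) (L ⊛ N) (𝒟 i) g ⟨
      act (L ⊛ M ⊞ L ⊛ N) (𝒟 i) g                       ∎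
      where open ≡-Reasoning

    neg-inverseˡ : ∀ L → neg L ⊞ L ≈ []
    neg-inverseˡ L = mk λ i g → trans (act-⊞ (neg L) L (𝒟 i) g)
      (trans (cong (λ x → x + act L (𝒟 i) g) (act-neg L (𝒟 i) g)) (trans (ℤₚ.+-inverseˡ (act L (𝒟 i) g)) (sym (act-[] (𝒟 i) g))))

    commutativeRing : CommutativeRing 0ℓ 0ℓ
    commutativeRing = record
      { Carrier = Laurent ; _≈_ = _≈_ ; _+_ = _⊞_ ; _*_ = _⊛_ ; -_ = neg ; 0# = [] ; 1# = const 1ℤ
      ; isCommutativeRing = record
        { isRing = record
          { +-isAbelianGroup = record
            { isGroup = record
              { isMonoid = record
                { isSemigroup = record
                  { isMagma = record
                    { isEquivalence = record { refl = ≈-refl ; sym = ≈-sym ; trans = ≈-trans }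
                    ; ∙-cong = ⊞-cong }
                  ; assoc = λ L M N → ≡⇒≈ (⊞-assoc L M N) }
                ; identity = (λ L → ≡⇒≈ (⊞-identityˡ L)) , (λ L → ≡⇒≈ (⊞-identityʳ L)) }
              ; inverse = neg-inverseˡ , (λ L → ≈-trans (⊞-comm L (neg L)) (neg-inverseˡ L))
              ; ⁻¹-cong = neg-cong }
            ; comm = ⊞-comm }
          ; *-cong = ⊛-cong
          ; *-assoc = ⊛-assoc
          ; *-identity = ⊛-identityˡ , (λ L → ≈-trans (⊛-comm L (const 1ℤ)) (⊛-identityˡ L))
          ; distrib = ⊛-distribˡ , (λ L M N → ≈-trans (⊛-comm (M ⊞ N) L)
              (≈-trans (⊛-distribˡ L M N) (⊞-cong (⊛-comm L M) (⊛-comm L N)))) }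
        ; *-comm = ⊛-comm } }

    const-+ : ∀ a b → const (a + b) ≈ const a ⊞ const b
    const-+ a b = mk λ i g → trans (act-const (a + b) (𝒟 i) g) (trans (ℤₚ.*-distribʳ-+ (𝒟 i g) a b)
      (sym (trans (act-⊞ (const a) (const b) (𝒟 i) g) (cong₂ _+_ (act-const a (𝒟 i) g) (act-const b (𝒟 i) g)))))

    const-* : ∀ a b → const (a * b) ≈ const a ⊛ const b
    const-* a b = ≡⇒≈ (sym (mono-⊛ a 0ℤ b 0ℤ))

    const-neg : ∀ a → const (- a) ≈ neg (const a)
    const-neg a = mk λ i g → trans (act-const (- a) (𝒟 i) g) (trans (sym (ℤₚ.neg-distribˡ-* a (𝒟 i g)))
      (sym (trans (act-neg (const a) (𝒟 i) g) (cong -_ (act-const a (𝒟 i) g)))))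

    const-0 : const 0ℤ ≈ []
    const-0 = mk λ i g → trans (act-const 0ℤ (𝒟 i) g) (trans (ℤₚ.*-zeroˡ (𝒟 i g)) (sym (act-[] (𝒟 i) g)))

    -- The test functions have integer values, so each of these rings is torsion-free. This permits
    -- division by powers of p without fractions.
    const-cancel : ∀ c .{{_ : ℤ.NonZero c}} {L M} → const c ⊛ L ≈ const c ⊛ M → L ≈ M
    const-cancel c {L} {M} e = mk λ i g → ℤₚ.*-cancelˡ-≡ c (act L (𝒟 i) g) (act M (𝒟 i) g)
      (trans (sym (eq L i g)) (trans (at e i g) (eq M i g)))
      where
      eq : ∀ N i g → act (const c ⊛ N) (𝒟 i) g ≡ c * act N (𝒟 i) g
      eq N i g = trans (act-⊛ (const c) N (𝒟 i) g) (act-const c (act N (𝒟 i)) g)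

    acr : AlmostCommutativeRing 0ℓ 0ℓ
    acr = fromCommutativeRing commutativeRing

    homomorphism : CommutativeRing.rawRing ℤₚ.+-*-commutativeRing -Raw-AlmostCommutative⟶ acr
    homomorphism = record
      { ⟦_⟧ = const ; +-homo = const-+ ; *-homo = const-* ; -‿homo = const-neg ; 0-homo = const-0 ; 1-homo = ≈-refl }

    const-≟ : ∀ a b → Maybe (const a ≈ const b)
    const-≟ a b with a ℤ.≟ b
    ... | yes refl = just ≈-refl
    ... | no _     = nothing

    module Solver = Algebra.Solver.Ring (CommutativeRing.rawRing ℤₚ.+-*-commutativeRing) acr homomorphism const-≟
    open CommutativeRing commutativeRing public using (setoid)

  -- Frobenius and Fermat

  prime∤! : ∀ {p} → Prime p → ∀ k → k ℕ.< p → ¬ p ℕ∣.∣ k !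
  prime∤! pr zero    k<p d = ℕ∣.>⇒∤ (ℕ.nonTrivial⇒n>1 _ {{prime⇒nonTrivial pr}}) d
  prime∤! pr (suc k) k<p d with euclidsLemma (suc k) (k !) pr d
  ... | inj₁ e = ℕ∣.>⇒∤ k<p e
  ... | inj₂ e = prime∤! pr k (ℕₚ.<-trans (ℕₚ.n<1+n k) k<p) e

  prime∣C : ∀ {p} → Prime p → ∀ k → 0 ℕ.< k → k ℕ.< p → p ℕ∣.∣ p C k
  prime∣C {p} pr k 0<k k<p with euclidsLemma (p C k) (k ! ℕ.* (p ∸ k) !) pr p∣prod
    where
    instance _ = ℕₚ._!*_!≢0 k (p ∸ k)
    instance _ = prime⇒nonZero pr
    p∣p! : ∀ q → 0 ℕ.< q → q ℕ∣.∣ q !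
    p∣p! (suc q) _ = ℕ∣.divides (q !) (ℕₚ.*-comm (suc q) (q !))
    p∣prod : p ℕ∣.∣ (p C k) ℕ.* (k ! ℕ.* (p ∸ k) !)
    p∣prod = subst (p ℕ∣.∣_) (sym (trans (cong (ℕ._* (k ! ℕ.* (p ∸ k) !)) (nCk≡n!/k![n-k]! (ℕₚ.<⇒≤ k<p)))
      (m/n*n≡m (k![n∸k]!∣n! (ℕₚ.<⇒≤ k<p))))) (p∣p! p (ℕₚ.<-trans 0<k k<p))
  ... | inj₁ d = d
  ... | inj₂ d with euclidsLemma (k !) ((p ∸ k) !) pr d
  ...   | inj₁ e = contradiction e (prime∤! pr k k<p)
  ...   | inj₂ e = contradiction e (prime∤! pr (p ∸ k) (ℕₚ.∸-monoʳ-< 0<k (ℕₚ.<⇒≤ k<p)))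

  module Frobenius {a ℓ} (R : CommutativeSemiring a ℓ) {p : ℕ} (pr : Prime p) where
    open CommutativeSemiring R renaming (_+_ to _⊹_; refl to ≈-refl; sym to ≈-sym; trans to ≈-trans)
    open Algebra.Properties.CommutativeSemiring.Binomial R
    open Algebra.Properties.Semiring.Exp semiring renaming (_^_ to _^ᴿ_)
    open Algebra.Properties.Semiring.Mult semiring renaming (_×_ to _×ᴿ_)
    open Algebra.Properties.CommutativeMonoid.Mult +-commutativeMonoid using (×-distrib-+)
    open Algebra.Properties.Semiring.Sum semiring using (sum; sum-init-last)
    open import Relation.Binary.Reasoning.Setoid setoid

    sum-× : ∀ n (m : ℕ) (f : Fin n → Carrier) → (∀ i → ∃ λ c → f i ≈ m ×ᴿ c) → ∃ λ c → sum f ≈ m ×ᴿ c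
    sum-× zero    m f h = 0# , ≈-sym (0-× m)
      where
      0-× : ∀ m → m ×ᴿ 0# ≈ 0#
      0-× zero    = ≈-refl
      0-× (suc m) = ≈-trans (+-identityˡ _) (0-× m)
    sum-× (suc n) m f h with h Fin.zero | sum-× n m (f ∘ Fin.suc) (h ∘ Fin.suc)
    ... | c , e | d , e′ = c ⊹ d , ≈-trans (+-cong e e′) (≈-sym (×-distrib-+ c d m))

    frobenius : ∀ x y → ∃ λ c → (x ⊹ y) ^ᴿ p ≈ y ^ᴿ p ⊹ x ^ᴿ p ⊹ p ×ᴿ c
    frobenius x y = go p refl
      where
      go : ∀ q → q ≡ p → ∃ λ c → (x ⊹ y) ^ᴿ p ≈ y ^ᴿ p ⊹ x ^ᴿ p ⊹ p ×ᴿ c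
      go zero    eq = contradiction (subst Prime (sym eq) pr) λ ()
      go (suc q) refl = proj₁ mids , (begin
        (x ⊹ y) ^ᴿ p                                    ≈⟨ theorem p x y ⟩
        t Fin.zero ⊹ sum (t ∘ Fin.suc)                  ≈⟨ +-cong first (sum-init-last (t ∘ Fin.suc)) ⟩
        y ^ᴿ p ⊹ (sum (λ i → t (Fin.suc (inject₁ i))) ⊹ t (Fin.suc (fromℕ q)))
                                                        ≈⟨ +-congˡ (+-cong (proj₂ mids) last) ⟩
        y ^ᴿ p ⊹ (p ×ᴿ proj₁ mids ⊹ x ^ᴿ p)             ≈⟨ +-congˡ (+-comm _ _) ⟩
        y ^ᴿ p ⊹ (x ^ᴿ p ⊹ p ×ᴿ proj₁ mids)             ≈⟨ +-assoc _ _ _ ⟨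
        y ^ᴿ p ⊹ x ^ᴿ p ⊹ p ×ᴿ proj₁ mids               ∎)
        where
        t : Fin (suc p) → Carrier
        t = binomialTerm x y p
        first : t Fin.zero ≈ y ^ᴿ p
        first = ≈-trans (+-identityʳ _) (*-identityˡ _)
        last : t (Fin.suc (fromℕ q)) ≈ x ^ᴿ p
        last rewrite Finₚ.toℕ-fromℕ q | nCn≡1 (suc q) | ℕₚ.n∸n≡0 q = ≈-trans (+-identityʳ _) (*-identityʳ _)
        mid : ∀ i → ∃ λ c → t (Fin.suc (inject₁ i)) ≈ p ×ᴿ c
        mid i with prime∣C pr (suc (toℕ (inject₁ i))) (s≤s z≤n) (s≤s (subst (ℕ._< q) (sym (Finₚ.toℕ-inject₁ i)) (Finₚ.toℕ<n i)))
        ... | ℕ∣.divides k eq = k ×ᴿ binomial x y p (Fin.suc (inject₁ i)) ,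
          ≈-trans (×-congˡ {binomial x y p (Fin.suc (inject₁ i))} (trans eq (ℕₚ.*-comm k p))) (≈-sym (×-assocˡ _ p k))
        mids = sum-× q p (λ i → t (Fin.suc (inject₁ i))) mid

  -- Pascal's rule gives C(q,k) + C(q,k+1) = C(q+1,k+1), which the prime q + 1 divides, so the signs
  -- alternate. This is what turns (1 - x)^(p-1) into 1 + x + ... + x^(p-1) modulo p.
  prime∣C-±1 : ∀ {q} → Prime (suc q) → ∀ k → k ℕ.≤ q → + suc q ∣ + (q C k) - -1ℤ ^ k
  prime∣C-±1 {q} pr zero    _   = divides 0ℤ refl
  prime∣C-±1 {q} pr (suc k) k<q = subst (+ suc q ∣_) (trans (cong (λ x → + x - (+ (q C k) - -1ℤ ^ k)) (sym (nCk+nC[k+1]≡[n+1]C[k+1] q k)))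
      (eq (+ (q C k)) (+ (q C suc k)) (-1ℤ ^ k)))
    (∣m∣n⇒∣m-n {m = + (suc q C suc k)} {n = + (q C k) - -1ℤ ^ k} (∣ᵤ⇒∣ (prime∣C pr (suc k) (s≤s z≤n) (s≤s k<q)))
      (prime∣C-±1 pr k (ℕₚ.<⇒≤ k<q)))
    where
    eq : ∀ a b c → a + b - (a - c) ≡ b - -1ℤ * c
    eq = solve-∀

  module _ {p : ℕ} (pr : Prime p) where
    open Frobenius ℤₚ.+-*-commutativeSemiring pr
    open Algebra.Properties.Semiring.Exp (CommutativeSemiring.semiring ℤₚ.+-*-commutativeSemiring) using () renaming (_^_ to _^ᴿ_)
    open Algebra.Properties.Semiring.Mult (CommutativeSemiring.semiring ℤₚ.+-*-commutativeSemiring) using () renaming (_×_ to _×ᴿ_)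

    private
      ^-≡ : ∀ x n → x ^ᴿ n ≡ x ^ n
      ^-≡ x zero    = refl
      ^-≡ x (suc n) = cong (x *_) (^-≡ x n)

      ×-≡ : ∀ n x → n ×ᴿ x ≡ + n * x
      ×-≡ zero    x = sym (ℤₚ.*-zeroˡ x)
      ×-≡ (suc n) x = trans (ℤ-+-congˡ x (×-≡ n x)) (sym (ℤₚ.suc-* (+ n) x))

      frob : ∀ x y → + p ∣ (x + y) ^ p - (x ^ p + y ^ p)
      frob x y with frobenius x y
      ... | c , e = divides c (trans (cong (λ z → z - (x ^ p + y ^ p)) (trans (sym (^-≡ (x + y) p)) (trans e
          (cong₂ _+_ (cong₂ _+_ (^-≡ y p) (^-≡ x p)) (×-≡ p c))))) (eq (x ^ p) (y ^ p) (+ p) c))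
        where
        eq : ∀ a b p c → b + a + p * c - (a + b) ≡ c * p
        eq = solve-∀

      0^p : ∀ n → .{{ℕ.NonZero n}} → 0ℤ ^ n ≡ 0ℤ
      0^p (suc n) = ℤₚ.*-zeroˡ (0ℤ ^ n)

      fermatℕ : ∀ n → + p ∣ (+ n) ^ p - + n
      fermatℕ zero  = subst (+ p ∣_) (cong (λ z → z - 0ℤ) (sym (0^p p {{prime⇒nonZero pr}}))) (divides 0ℤ refl)
      fermatℕ (suc n) = subst (+ p ∣_) (trans (cong (λ z → (1ℤ + + n) ^ p - (z + (+ n) ^ p) + ((+ n) ^ p - + n)) (ℤₚ.^-zeroˡ p))
          (eq ((1ℤ + + n) ^ p) ((+ n) ^ p) (+ n)))
        (∣m∣n⇒∣m+n (frob 1ℤ (+ n)) (fermatℕ n))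
        where
        eq : ∀ a b n → a - (1ℤ + b) + (b - n) ≡ a - (1ℤ + n)
        eq = solve-∀

    fermat : ∀ x → + p ∣ x ^ p - x
    fermat (+ n)      = fermatℕ n
    -- Additivity of the p-th power is applied to a + (-a) = 0.
    fermat ℤ.-[1+ n ] = subst (+ p ∣_) (trans (cong (λ z → 0ℤ - (z - (a ^ p + b ^ p)) - (a ^ p - a))
        (trans (cong (_^ p) (ℤₚ.+-inverseʳ a)) (0^p p {{prime⇒nonZero pr}}))) (eq (a ^ p) (b ^ p) a))
      (∣m∣n⇒∣m-n (∣m∣n⇒∣m-n (divides 0ℤ refl) (frob a b)) (fermatℕ (suc n)))
      where
      a = + suc n
      b = ℤ.-[1+ n ]
      eq : ∀ x y a → 0ℤ - (0ℤ - (x + y)) - (x - a) ≡ y - - a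
      eq = solve-∀

  -- Lifting from p^(b+1) to p^(b+2): if x = 1 + d, then x^p = 1 + p d + d² r, and p^(b+2) divides
  -- both p d and d² as soon as p^(b+1) divides d. The start is Fermat's theorem with one factor u
  -- cancelled.
  ∤⇒euler : ∀ {p} → Prime p → ∀ b {u} → ¬ + p ∣ u → + (p ℕ.^ suc b) ∣ u ^ (p ℕ.^ b ℕ.* (p ∸ 1)) - 1ℤ
  ∤⇒euler {p} pr zero {u} p∤u = subst₂ (λ x y → + x ∣ u ^ y - 1ℤ) (sym (ℕₚ.^-identityʳ p)) (sym (ℕₚ.*-identityˡ (p ∸ 1)))
      (cancel p refl (fermat pr u))
    where
    eq : ∀ u x → u * x - u ≡ u * (x - 1ℤ)
    eq = solve-∀
    cancel : ∀ q → q ≡ p → + p ∣ u ^ p - u → + p ∣ u ^ (p ∸ 1) - 1ℤ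
    cancel zero refl _ = contradiction pr λ ()
    cancel (suc q) refl d with euclidsLemma ℤ.∣ u ∣ ℤ.∣ u ^ q - 1ℤ ∣ pr
        (subst (p ℕ∣.∣_) (ℤₚ.abs-* u (u ^ q - 1ℤ)) (∣⇒∣ᵤ (subst (+ p ∣_) (eq u (u ^ q)) d)))
    ... | inj₁ e = contradiction (∣ᵤ⇒∣ e) p∤u
    ... | inj₂ e = ∣ᵤ⇒∣ e
  ∤⇒euler {p} pr (suc b) {u} p∤u with ∤⇒euler pr b p∤u
  ... | divides e eq = subst (λ x → + (p ℕ.^ suc (suc b)) ∣ x - 1ℤ) (trans (ℤₚ.^-*-assoc u (p ℕ.^ b ℕ.* (p ∸ 1)) p) (cong (u ^_) exps)) x^p
    where
    x = u ^ (p ℕ.^ b ℕ.* (p ∸ 1))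
    d = e * + (p ℕ.^ suc b)
    exps : p ℕ.^ b ℕ.* (p ∸ 1) ℕ.* p ≡ p ℕ.^ suc b ℕ.* (p ∸ 1)
    exps = trans (ℕₚ.*-comm (p ℕ.^ b ℕ.* (p ∸ 1)) p) (sym (ℕₚ.*-assoc p (p ℕ.^ b) (p ∸ 1)))
    x≡ : x ≡ 1ℤ + d
    x≡ = trans (sym (eq′ x)) (ℤ-+-congˡ 1ℤ eq)
      where
      eq′ : ∀ x → 1ℤ + (x - 1ℤ) ≡ x
      eq′ = solve-∀
    expand : ∀ n → ∃ λ r → (1ℤ + d) ^ n ≡ 1ℤ + + n * d + d * d * r
    expand zero    = 0ℤ , eq₀ d
      where
      eq₀ : ∀ d → 1ℤ ≡ 1ℤ + 0ℤ * d + d * d * 0ℤ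
      eq₀ = solve-∀
    expand (suc n) with expand n
    ... | r , h = + n + r + d * r , trans (cong ((1ℤ + d) *_) h) (eq₁ d (+ n) r)
      where
      eq₁ : ∀ d n r → (1ℤ + d) * (1ℤ + n * d + d * d * r) ≡ 1ℤ + (1ℤ + n) * d + d * d * (n + r + d * r)
      eq₁ = solve-∀
    pP : + (p ℕ.^ suc (suc b)) ≡ + p * (+ p * + (p ℕ.^ b))
    pP = trans (ℤₚ.pos-* p (p ℕ.^ suc b)) (cong (+ p *_) (ℤₚ.pos-* p (p ℕ.^ b)))
    x^p : + (p ℕ.^ suc (suc b)) ∣ x ^ p - 1ℤ
    x^p with expand p
    ... | r , h = divides (e + e * e * r * + (p ℕ.^ b)) (trans (cong (λ z → z ^ p - 1ℤ) x≡) (trans (cong (λ z → z - 1ℤ) h)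
        (trans (cong (λ z → 1ℤ + + p * (e * z) + e * z * (e * z) * r - 1ℤ) (ℤₚ.pos-* p (p ℕ.^ b)))
          (trans (eq₂ e (+ p) (+ (p ℕ.^ b)) r) (cong ((e + e * e * r * + (p ℕ.^ b)) *_) (sym pP))))))
      where
      eq₂ : ∀ e p q r → 1ℤ + p * (e * (p * q)) + e * (p * q) * (e * (p * q)) * r - 1ℤ ≡ (e + e * e * r * q) * (p * (p * q))
      eq₂ = solve-∀

  -- Powers of Laurent polynomials and the binomial congruences modulo p

  infixr 8 _^^_
  _^^_ : Laurent → ℕ → Laurent
  L ^^ zero  = const 1ℤ
  L ^^ suc n = L ⊛ L ^^ n

  lsum : ℕ → (ℕ → Laurent) → Laurent
  lsum zero    f = []
  lsum (suc n) f = f 0 ⊞ lsum n (f ∘ suc)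

  one-y^ : ℤ → Laurent
  one-y^ k = const 1ℤ ⊞ mono -1ℤ k

  mono-^^ : ∀ c k n → mono c k ^^ n ≡ mono (c ^ n) (+ n * k)
  mono-^^ c k zero    = cong (mono 1ℤ) (sym (ℤₚ.*-zeroˡ k))
  mono-^^ c k (suc n) = trans (cong (mono c k ⊛_) (mono-^^ c k n))
    (trans (mono-⊛ c k (c ^ n) (+ n * k)) (cong (mono (c * c ^ n)) (sym (ℤₚ.suc-* (+ n) k))))

  σ-one-y^ : ∀ u k → σ u (one-y^ k) ≡ one-y^ (u * k)
  σ-one-y^ u k = trans (σ-⊞ u (const 1ℤ) (mono -1ℤ k)) (cong₂ _⊞_ (σ-const u 1ℤ) (σ-mono u -1ℤ k))

  σ-^^ : ∀ u L n → σ u (L ^^ n) ≡ σ u L ^^ n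
  σ-^^ u L zero    = σ-const u 1ℤ
  σ-^^ u L (suc n) = trans (σ-⊛ u L (L ^^ n)) (cong (σ u L ⊛_) (σ-^^ u L n))

  const-^^ : ∀ c n → const c ^^ n ≡ const (c ^ n)
  const-^^ c zero    = refl
  const-^^ c (suc n) = trans (cong (const c ⊛_) (const-^^ c n)) (mono-⊛ c 0ℤ (c ^ n) 0ℤ)

  act-lsum : ∀ n f D g → act (lsum n f) D g ≡ ∑ n (λ i → act (f i) D g)
  act-lsum zero    f D g = act-[] D g
  act-lsum (suc n) f D g = trans (act-⊞ (f 0) (lsum n (f ∘ suc)) D g)
    (trans (ℤ-+-congˡ (act (f 0) D g) (act-lsum n (f ∘ suc) D g)) (sym (∑-shift n (λ i → act (f i) D g))))

  module LaurentPowers {Ix : Set} (𝒟 : Ix → ℤ → ℤ) where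
    open LaurentRing 𝒟 public
    open CommutativeRing commutativeRing public using (commutativeSemiring; semiring)
    open Algebra.Properties.Semiring.Exp semiring using () renaming (_^_ to _^ᴿ_)
    open Algebra.Properties.Semiring.Mult semiring using () renaming (_×_ to _×ᴿ_)
    open Algebra.Properties.Semiring.Sum semiring using (sum; sum-cong-≋)
    open import Relation.Binary.Reasoning.Setoid setoid
    open Solver

    ^^-cong : ∀ n {L M} → L ≈ M → L ^^ n ≈ M ^^ n
    ^^-cong zero    e = ≈-refl
    ^^-cong (suc n) e = ⊛-cong e (^^-cong n e)

    ^^-+ : ∀ L m n → L ^^ (m ℕ.+ n) ≈ L ^^ m ⊛ L ^^ n
    ^^-+ L zero    n = ≈-sym (⊛-identityˡ (L ^^ n))
    ^^-+ L (suc m) n = ≈-trans (⊛-cong ≈-refl (^^-+ L m n)) (≈-sym (⊛-assoc L (L ^^ m) (L ^^ n)))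

    ^^-* : ∀ L m n → L ^^ (m ℕ.* n) ≈ (L ^^ n) ^^ m
    ^^-* L zero    n = ≈-refl
    ^^-* L (suc m) n = ≈-trans (^^-+ L n (m ℕ.* n)) (⊛-cong ≈-refl (^^-* L m n))

    ⊛-interchange : ∀ K L M N → (K ⊛ L) ⊛ (M ⊛ N) ≈ (K ⊛ M) ⊛ (L ⊛ N)
    ⊛-interchange = solve 4 (λ a b c d → (a :* b) :* (c :* d) := (a :* c) :* (b :* d)) ≈-refl

    ⊛-swap : ∀ L M N → L ⊛ (M ⊛ N) ≈ M ⊛ (L ⊛ N)
    ⊛-swap = solve 3 (λ a b c → a :* (b :* c) := b :* (a :* c)) ≈-refl

    -- A divisor of a nonzero integer is not a zero divisor in a torsion-free ring. The main
    -- instance is X, whose cofactor is `bar X`.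
    divisor-cancel : ∀ m .{{_ : ℤ.NonZero m}} {K L M N} → K ⊛ L ≈ const m → K ⊛ M ≈ K ⊛ N → M ≈ N
    divisor-cancel m {K} {L} {M} {N} d e = const-cancel m (≈-trans (≈-sym (expand M)) (≈-trans (⊛-cong (≈-refl {L}) e) (expand N)))
      where
      expand : ∀ A → L ⊛ (K ⊛ A) ≈ const m ⊛ A
      expand A = ≈-trans (≈-sym (⊛-assoc L K A)) (⊛-cong (≈-trans (⊛-comm L K) d) (≈-refl {A}))

    ^^-distrib : ∀ L M n → (L ⊛ M) ^^ n ≈ L ^^ n ⊛ M ^^ n
    ^^-distrib L M zero    = ≈-sym (⊛-identityˡ (const 1ℤ))
    ^^-distrib L M (suc n) = ≈-trans (⊛-cong ≈-refl (^^-distrib L M n))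
      (⊛-interchange L M (L ^^ n) (M ^^ n))

    ⊞-0 : ∀ m L → L ⊞ m ⊛ [] ≈ L
    ⊞-0 m L = ≈-trans (⊞-cong (≈-refl {L}) (≈-trans (⊛-cong (≈-refl {m}) (≈-sym const-0))
      (≈-trans (zeroʳ m) const-0))) (≡⇒≈ (⊞-identityʳ L))
      where
      zeroʳ : ∀ m → m ⊛ const 0ℤ ≈ const 0ℤ
      zeroʳ = solve 1 (λ m → m :* con 0ℤ := con 0ℤ) ≈-refl

    lsum-cong : ∀ n {f g} → (∀ i → i ℕ.< n → f i ≈ g i) → lsum n f ≈ lsum n g
    lsum-cong zero    h = ≈-refl
    lsum-cong (suc n) h = ⊞-cong (h 0 (ℕ.s≤s ℕ.z≤n)) (lsum-cong n λ i i<n → h (suc i) (ℕ.s≤s i<n))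

    ^^-mod : ∀ m L M n → ∃ λ N → (L ⊞ const m ⊛ M) ^^ n ≈ L ^^ n ⊞ const m ⊛ N
    ^^-mod m L M zero    = [] , ≈-sym (⊞-0 (const m) (const 1ℤ))
    ^^-mod m L M (suc n) with ^^-mod m L M n
    ... | N , e = L ⊛ N ⊞ M ⊛ L ^^ n ⊞ const m ⊛ M ⊛ N ,
      ≈-trans (⊛-cong (≈-refl {L ⊞ const m ⊛ M}) e)
        (rearr (const m) L M (L ^^ n) N)
      where
      rearr : ∀ m l x y n → (l ⊞ m ⊛ x) ⊛ (y ⊞ m ⊛ n) ≈ l ⊛ y ⊞ m ⊛ (l ⊛ n ⊞ x ⊛ y ⊞ m ⊛ x ⊛ n)
      rearr = solve 5 (λ m l x y n → (l :+ m :* x) :* (y :+ m :* n) := l :* y :+ m :* (l :* n :+ x :* y :+ m :* x :* n)) ≈-refl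

    private
      ^-≡ : ∀ L n → L ^ᴿ n ≡ L ^^ n
      ^-≡ L zero    = refl
      ^-≡ L (suc n) = cong (L ⊛_) (^-≡ L n)

      ×-≈ : ∀ n L → n ×ᴿ L ≈ const (+ n) ⊛ L
      ×-≈ zero    L = ≈-trans (≈-sym const-0) (zeroˡ L)
        where
        zeroˡ : ∀ x → const 0ℤ ≈ const 0ℤ ⊛ x
        zeroˡ = solve 1 (λ x → con 0ℤ := con 0ℤ :* x) ≈-refl
      ×-≈ (suc n) L = ≈-trans (⊞-cong (≈-refl {L}) (×-≈ n L))
        (≈-trans (rearr L (const (+ n))) (⊛-cong (≈-sym (const-+ 1ℤ (+ n))) (≈-refl {L})))
        where
        rearr : ∀ x n → x ⊞ n ⊛ x ≈ (const 1ℤ ⊞ n) ⊛ x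
        rearr = solve 2 (λ x n → x :+ n :* x := (con 1ℤ :+ n) :* x) ≈-refl

      sum≈lsum : ∀ n (f : ℕ → Laurent) → sum {n} (f ∘ toℕ) ≈ lsum n f
      sum≈lsum zero    f = ≈-refl
      sum≈lsum (suc n) f = ⊞-cong (≈-refl {f 0}) (sum≈lsum n (f ∘ suc))

    mono-⊞ : ∀ a b k → mono (a + b) k ≈ mono a k ⊞ mono b k
    mono-⊞ a b k = mk λ i g → trans (act-mono (a + b) k (𝒟 i) g) (trans (ℤₚ.*-distribʳ-+ (𝒟 i (g - k)) a b)
      (sym (trans (act-⊞ (mono a k) (mono b k) (𝒟 i) g) (cong₂ _+_ (act-mono a k (𝒟 i) g) (act-mono b k (𝒟 i) g)))))

    const-⊛-mono : ∀ a b k → const a ⊛ mono b k ≈ mono (a * b) k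
    const-⊛-mono a b k = ≡⇒≈ (trans (mono-⊛ a 0ℤ b k) (cong (mono (a * b)) (ℤₚ.+-identityˡ k)))

    mono-split : ∀ a m b k → mono (a + m * b) k ≈ mono a k ⊞ const m ⊛ mono b k
    mono-split a m b k = ≈-trans (mono-⊞ a (m * b) k) (⊞-cong (≈-refl {mono a k}) (≈-sym (const-⊛-mono m b k)))

    module _ {p : ℕ} (pr : Prime p) where
      open Frobenius commutativeSemiring pr

      ^^p-⊞ : ∀ L M → ∃ λ N → (L ⊞ M) ^^ p ≈ L ^^ p ⊞ M ^^ p ⊞ const (+ p) ⊛ N
      ^^p-⊞ L M with frobenius L M
      ... | N , e = N , (begin
        (L ⊞ M) ^^ p                                ≡⟨ ^-≡ (L ⊞ M) p ⟨
        (L ⊞ M) ^ᴿ p                                ≈⟨ e ⟩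
        M ^ᴿ p ⊞ L ^ᴿ p ⊞ p ×ᴿ N                    ≈⟨ ⊞-cong (⊞-comm (M ^ᴿ p) (L ^ᴿ p)) (×-≈ p N) ⟩
        L ^ᴿ p ⊞ M ^ᴿ p ⊞ const (+ p) ⊛ N           ≡⟨ cong₂ (λ x y → x ⊞ y ⊞ const (+ p) ⊛ N) (^-≡ L p) (^-≡ M p) ⟩
        L ^^ p ⊞ M ^^ p ⊞ const (+ p) ⊛ N           ∎)

      -- Modulo p the p-th power is additive and fixes the integer coefficients by Fermat's theorem,
      -- so only the exponents of y are multiplied by p. Reducedness of 𝔽_p[C_w] rests on this.
      ^^p-σ : ∀ L → ∃ λ N → L ^^ p ≈ σ (+ p) L ⊞ const (+ p) ⊛ N
      ^^p-σ [] = [] , ≈-trans (zero^ p {{prime⇒nonZero pr}}) (≈-sym (≈-trans (⊞-0 (const (+ p)) (σ (+ p) [])) (≡⇒≈ (σ-[] (+ p)))))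
        where
        zero^ : ∀ n → .{{ℕ.NonZero n}} → [] ^^ n ≈ []
        zero^ (suc n) = ≈-trans (⊛-comm [] ([] ^^ n)) (≈-trans (≈-sym (≡⇒≈ (⊞-identityˡ _))) (⊞-0 ([] ^^ n) []))
      ^^p-σ ((c , k) ∷ L) with ^^p-⊞ (mono c k) L | ^^p-σ L | fermat pr c
      ... | N , e | M , e′ | divides q eq = N ⊞ M ⊞ mono q (+ p * k) , (begin
        ((c , k) ∷ L) ^^ p
          ≡⟨ cong (_^^ p) (∷≡⊞ c k L) ⟩
        (mono c k ⊞ L) ^^ p
          ≈⟨ e ⟩
        mono c k ^^ p ⊞ L ^^ p ⊞ P ⊛ N
          ≈⟨ ⊞-cong (⊞-cong mono^ e′) (≈-refl {P ⊛ N}) ⟩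
        mono c (+ p * k) ⊞ P ⊛ mono q (+ p * k) ⊞ (σ (+ p) L ⊞ P ⊛ M) ⊞ P ⊛ N
          ≈⟨ rearr (mono c (+ p * k)) P (mono q (+ p * k)) (σ (+ p) L) M N ⟩
        mono c (+ p * k) ⊞ σ (+ p) L ⊞ P ⊛ (N ⊞ M ⊞ mono q (+ p * k))
          ≡⟨ cong (_⊞ P ⊛ (N ⊞ M ⊞ mono q (+ p * k))) (trans (cong (_⊞ σ (+ p) L) (sym (σ-mono (+ p) c k)))
               (trans (sym (σ-⊞ (+ p) (mono c k) L)) (cong (σ (+ p)) (sym (∷≡⊞ c k L))))) ⟩
        σ (+ p) ((c , k) ∷ L) ⊞ P ⊛ (N ⊞ M ⊞ mono q (+ p * k))
          ∎)
        where
        P = const (+ p)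
        rearr : ∀ a p q s m n → a ⊞ p ⊛ q ⊞ (s ⊞ p ⊛ m) ⊞ p ⊛ n ≈ a ⊞ s ⊞ p ⊛ (n ⊞ m ⊞ q)
        rearr = solve 6 (λ a p q s m n → a :+ p :* q :+ (s :+ p :* m) :+ p :* n := a :+ s :+ p :* (n :+ m :+ q)) ≈-refl
        c^p : c ^ p ≡ c + + p * q
        c^p = trans (sym (eq′ (c ^ p) c)) (ℤ-+-congˡ c (trans eq (ℤₚ.*-comm q (+ p))))
          where
          eq′ : ∀ x c → c + (x - c) ≡ x
          eq′ = solve-∀
        mono^ : mono c k ^^ p ≈ mono c (+ p * k) ⊞ P ⊛ mono q (+ p * k)
        mono^ = ≈-trans (≡⇒≈ (trans (mono-^^ c k p) (cong (λ x → mono x (+ p * k)) c^p)))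
          (mono-split c (+ p) q (+ p * k))

      one-y^-^^pⁿ : ∀ k n → ∃ λ N → one-y^ k ^^ (p ℕ.^ n) ≈ one-y^ (+ (p ℕ.^ n) * k) ⊞ const (+ p) ⊛ N
      one-y^-^^pⁿ k zero = [] , ≈-trans (⊛-comm (one-y^ k) (const 1ℤ)) (≈-trans (⊛-identityˡ (one-y^ k))
        (≈-trans (≡⇒≈ (cong one-y^ (sym (ℤₚ.*-identityˡ k)))) (≈-sym (⊞-0 (const (+ p)) (one-y^ (1ℤ * k))))))
      one-y^-^^pⁿ k (suc n) with one-y^-^^pⁿ k n
      ... | N , e with ^^-mod (+ p) (one-y^ (+ (p ℕ.^ n) * k)) N p | ^^p-σ (one-y^ (+ (p ℕ.^ n) * k))
      ...   | M , e₁ | M′ , e₂ = M′ ⊞ M , (begin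
        one-y^ k ^^ (p ℕ.* p ℕ.^ n)                                    ≈⟨ ^^-* (one-y^ k) p (p ℕ.^ n) ⟩
        (one-y^ k ^^ (p ℕ.^ n)) ^^ p                                   ≈⟨ ^^-cong p e ⟩
        (one-y^ l ⊞ P ⊛ N) ^^ p                                        ≈⟨ e₁ ⟩
        one-y^ l ^^ p ⊞ P ⊛ M                                          ≈⟨ ⊞-cong e₂ (≈-refl {P ⊛ M}) ⟩
        σ (+ p) (one-y^ l) ⊞ P ⊛ M′ ⊞ P ⊛ M                            ≈⟨ rearr (σ (+ p) (one-y^ l)) P M′ M ⟩
        σ (+ p) (one-y^ l) ⊞ P ⊛ (M′ ⊞ M)                              ≡⟨ cong (_⊞ P ⊛ (M′ ⊞ M)) (trans (σ-one-y^ (+ p) l) (cong one-y^ pl)) ⟩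
        one-y^ (+ (p ℕ.* p ℕ.^ n) * k) ⊞ P ⊛ (M′ ⊞ M)                  ∎)
        where
        P = const (+ p)
        l = + (p ℕ.^ n) * k
        rearr : ∀ s p m n → s ⊞ p ⊛ m ⊞ p ⊛ n ≈ s ⊞ p ⊛ (m ⊞ n)
        rearr = solve 4 (λ s p m n → s :+ p :* m :+ p :* n := s :+ p :* (m :+ n)) ≈-refl
        pl : + p * l ≡ + (p ℕ.* p ℕ.^ n) * k
        pl = trans (sym (ℤₚ.*-assoc (+ p) (+ (p ℕ.^ n)) k)) (cong (_* k) (sym (ℤₚ.pos-* p (p ℕ.^ n))))

    module _ {q : ℕ} (pr : Prime (suc q)) where
      open Algebra.Properties.CommutativeSemiring.Binomial commutativeSemiring

      -- The i-th binomial term is (-1)^i C(q,i) y^(ik), and (-1)^i C(q,i) ≡ 1 modulo the prime q +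
      -- 1 by `prime∣C-±1`.
      one-y^-^^q : ∀ k → ∃ λ N → one-y^ k ^^ q ≈ lsum (suc q) (λ i → y^ (+ i * k)) ⊞ const (+ suc q) ⊛ N
      one-y^-^^q k = N , (begin
        one-y^ k ^^ q                                         ≈⟨ ^^-cong q (⊞-comm (const 1ℤ) (mono -1ℤ k)) ⟩
        (mono -1ℤ k ⊞ const 1ℤ) ^^ q                          ≡⟨ ^-≡ (mono -1ℤ k ⊞ const 1ℤ) q ⟨
        (mono -1ℤ k ⊞ const 1ℤ) ^ᴿ q                          ≈⟨ theorem q (mono -1ℤ k) (const 1ℤ) ⟩
        sum (binomialTerm (mono -1ℤ k) (const 1ℤ) q)          ≈⟨ sum≈lsum (suc q) t ⟩
        lsum (suc q) t                                        ≈⟨ lsum-cong (suc q) (λ i i≤q → tᵢ i (ℕ.s≤s⁻¹ i≤q)) ⟩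
        lsum (suc q) (λ i → y^ (+ i * k) ⊞ P ⊛ c i)           ≈⟨ split (suc q) (λ i → y^ (+ i * k)) c ⟩
        lsum (suc q) (λ i → y^ (+ i * k)) ⊞ P ⊛ N             ∎)
        where
        P = const (+ suc q)
        t : ℕ → Laurent
        t i = (q C i) ×ᴿ (mono -1ℤ k ^ᴿ i ⊛ const 1ℤ ^ᴿ (q ∸ i))
        c : ℕ → Laurent
        c i with i ℕ.≤? q
        ... | yes i≤q = mono (_∣_.quotient (prime∣C-±1 pr i i≤q) * -1ℤ ^ i) (+ i * k)
        -- A default for i > q, outside the range of the sum.
        ... | no _    = []
        N = lsum (suc q) c
        split : ∀ n f g → lsum n (λ i → f i ⊞ P ⊛ g i) ≈ lsum n f ⊞ P ⊛ lsum n g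
        split zero    f g = ≈-sym (⊞-0 P [])
        split (suc n) f g = ≈-trans (⊞-cong (≈-refl {f 0 ⊞ P ⊛ g 0}) (split n (f ∘ suc) (g ∘ suc)))
          (rearr (f 0) P (g 0) (lsum n (f ∘ suc)) (lsum n (g ∘ suc)))
          where
          rearr : ∀ f p g x y → f ⊞ p ⊛ g ⊞ (x ⊞ p ⊛ y) ≈ f ⊞ x ⊞ p ⊛ (g ⊞ y)
          rearr = solve 5 (λ f p g x y → f :+ p :* g :+ (x :+ p :* y) := f :+ x :+ p :* (g :+ y)) ≈-refl
        ±1² : ∀ i → -1ℤ ^ i * -1ℤ ^ i ≡ 1ℤ
        ±1² zero    = refl
        ±1² (suc i) = trans (eq′ (-1ℤ ^ i)) (±1² i)
          where
          eq′ : ∀ x → -1ℤ * x * (-1ℤ * x) ≡ x * x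
          eq′ = solve-∀
        tᵢ : ∀ i → i ℕ.≤ q → t i ≈ y^ (+ i * k) ⊞ P ⊛ c i
        tᵢ i i≤q with i ℕ.≤? q
        ... | no i≰q = contradiction i≤q i≰q
        ... | yes i≤q′ with prime∣C-±1 pr i i≤q′
        ...   | divides r eq = begin
          (q C i) ×ᴿ (mono -1ℤ k ^ᴿ i ⊛ const 1ℤ ^ᴿ (q ∸ i))
            ≈⟨ ×-≈ (q C i) _ ⟩
          const (+ (q C i)) ⊛ (mono -1ℤ k ^ᴿ i ⊛ const 1ℤ ^ᴿ (q ∸ i))
            ≡⟨ cong₂ (λ x y → const (+ (q C i)) ⊛ (x ⊛ y)) (trans (^-≡ (mono -1ℤ k) i) (mono-^^ -1ℤ k i))
                 (trans (^-≡ (const 1ℤ) (q ∸ i)) (trans (const-^^ 1ℤ (q ∸ i)) (cong const (ℤₚ.^-zeroˡ (q ∸ i))))) ⟩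
          const (+ (q C i)) ⊛ (mono (-1ℤ ^ i) (+ i * k) ⊛ const 1ℤ)
            ≈⟨ ⊛-cong (≈-refl {const (+ (q C i))}) (≈-trans (⊛-comm (mono (-1ℤ ^ i) (+ i * k)) (const 1ℤ)) (⊛-identityˡ _)) ⟩
          const (+ (q C i)) ⊛ mono (-1ℤ ^ i) (+ i * k)
            ≈⟨ const-⊛-mono (+ (q C i)) (-1ℤ ^ i) (+ i * k) ⟩
          mono (+ (q C i) * -1ℤ ^ i) (+ i * k)
            ≡⟨ cong (λ x → mono x (+ i * k)) coef ⟩
          mono (1ℤ + + suc q * (r * -1ℤ ^ i)) (+ i * k)
            ≈⟨ mono-split 1ℤ (+ suc q) (r * -1ℤ ^ i) (+ i * k) ⟩
          y^ (+ i * k) ⊞ P ⊛ mono (r * -1ℤ ^ i) (+ i * k) ∎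
          where
          eq₂ : ∀ a s → a * s ≡ s * s + (a - s) * s
          eq₂ = solve-∀
          eq₃ : ∀ r p s → r * p * s ≡ p * (r * s)
          eq₃ = solve-∀
          coef : + (q C i) * -1ℤ ^ i ≡ 1ℤ + + suc q * (r * -1ℤ ^ i)
          coef = trans (eq₂ (+ (q C i)) (-1ℤ ^ i)) (cong₂ _+_ (±1² i)
            (trans (cong (_* -1ℤ ^ i) eq) (eq₃ r (+ suc q) (-1ℤ ^ i))))

    one-y^-^^p-1 : ∀ {p} → Prime p → ∀ k → ∃ λ N → one-y^ k ^^ (p ∸ 1) ≈ lsum p (λ i → y^ (+ i * k)) ⊞ const (+ p) ⊛ N
    one-y^-^^p-1 {zero}  pr k = contradiction pr λ ()
    one-y^-^^p-1 {suc q} pr k = one-y^-^^q pr k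

    ⊞-interchange : ∀ K L M N → K ⊞ L ⊞ (M ⊞ N) ≈ K ⊞ M ⊞ (L ⊞ N)
    ⊞-interchange = solve 4 (λ a b c d → a :+ b :+ (c :+ d) := a :+ c :+ (b :+ d)) ≈-refl

    module Modulo (π : Laurent) where

      infix 4 _∼_
      _∼_ : Laurent → Laurent → Set
      L ∼ M = ∃ λ N → L ≈ M ⊞ π ⊛ N

      ≈⇒∼ : ∀ {L M} → L ≈ M → L ∼ M
      ≈⇒∼ {L} {M} e = [] , ≈-trans e (≈-sym (⊞-0 π M))

      ∼-trans : ∀ {K L M} → K ∼ L → L ∼ M → K ∼ M
      ∼-trans {K} {L} {M} (A , e) (B , f) = B ⊞ A , ≈-trans e (≈-trans (⊞-cong f (≈-refl {π ⊛ A})) (rearr M π B A))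
        where
        rearr : ∀ m p b a → m ⊞ p ⊛ b ⊞ p ⊛ a ≈ m ⊞ p ⊛ (b ⊞ a)
        rearr = solve 4 (λ m p b a → m :+ p :* b :+ p :* a := m :+ p :* (b :+ a)) ≈-refl

      ∼-sym : ∀ {L M} → L ∼ M → M ∼ L
      ∼-sym {L} {M} (A , e) = neg A , ≈-trans (rearr M π A) (⊞-cong (≈-sym e) (≈-refl {π ⊛ neg A}))
        where
        rearr : ∀ m p a → m ≈ m ⊞ p ⊛ a ⊞ p ⊛ neg a
        rearr = solve 3 (λ m p a → m := m :+ p :* a :+ p :* (:- a)) ≈-refl

      ∼-⊞ : ∀ {L L′ M M′} → L ∼ L′ → M ∼ M′ → L ⊞ M ∼ L′ ⊞ M′
      ∼-⊞ {L} {L′} {M} {M′} (A , e) (B , f) = A ⊞ B , ≈-trans (⊞-cong e f) (rearr L′ M′ π A B)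
        where
        rearr : ∀ l m p a b → l ⊞ p ⊛ a ⊞ (m ⊞ p ⊛ b) ≈ l ⊞ m ⊞ p ⊛ (a ⊞ b)
        rearr = solve 5 (λ l m p a b → l :+ p :* a :+ (m :+ p :* b) := l :+ m :+ p :* (a :+ b)) ≈-refl

      ∼-multiple : ∀ {K L M} → K ∼ [] → L ∼ K ⊛ M → ∃ λ N → L ≈ π ⊛ N
      ∼-multiple {K} {L} {M} (B , f) (A , e) = B ⊛ M ⊞ A , ≈-trans e (≈-trans
        (⊞-cong (⊛-cong (≈-trans f (≡⇒≈ (⊞-identityˡ _))) (≈-refl {M})) (≈-refl {π ⊛ A})) (rearr π B M A))
        where
        rearr : ∀ p b k a → (p ⊛ b) ⊛ k ⊞ p ⊛ a ≈ p ⊛ (b ⊛ k ⊞ a)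
        rearr = solve 4 (λ p b k a → (p :* b) :* k :+ p :* a := p :* (b :* k :+ a)) ≈-refl

  -- The cyclotomic group ring ℤ[C_w][ζ]

  act-δ-fold : ∀ q m .{{_ : ℕ.NonZero q}} .{{_ : ℕ.NonZero m}} L g →
    act L (δ (+ m)) g ≡ ∑ q (λ j → act L (δ (+ (q ℕ.* m))) (g - + j * + m))
  act-δ-fold q m L g = trans (act-cong L (∑-fold-δ q m) g) (trans (act-∑ L q (λ j n → δ (+ (q ℕ.* m)) (n - + j * + m)) g)
    (∑-cong q λ j → act-translate L (δ (+ (q ℕ.* m))) (- (+ j * + m)) g))

  ∑-∣ : ∀ {m} n {f : ℕ → ℤ} → (∀ i → m ∣ f i) → m ∣ ∑ n f
  ∑-∣ zero    h = divides 0ℤ refl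
  ∑-∣ (suc n) h = ∣m∣n⇒∣m+n (h n) (∑-∣ n h)

  act-diff : ∀ L (D E : ℤ → ℤ) g → act L (λ n → D n - E n) g ≡ act L D g - act L E g
  act-diff L D E g = trans (act-cong L (λ n → trans (eq (D n) (E n)) (cong (λ x → -1ℤ * E x + D n) (sym (ℤₚ.+-identityʳ n)))) g)
    (trans (act-linear L -1ℤ 0ℤ E D g) (trans (cong (λ x → -1ℤ * act L E x + act L D g) (ℤₚ.+-identityʳ g)) (sym (eq (act L D g) (act L E g)))))
    where
    eq : ∀ d e → d - e ≡ -1ℤ * e + d
    eq = solve-∀

  act-∣ : ∀ {m} L {D : ℤ → ℤ} → (∀ g → m ∣ D g) → ∀ g → m ∣ act L D g
  act-∣ {m} L {D} h g = divides (act L (λ n → _∣_.quotient (h n)) g) (trans (act-cong L eq₁ g)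
    (trans (act-linear L m 0ℤ D′ (λ _ → 0ℤ) g) (trans (cong₂ (λ x y → m * act L D′ x + y) (ℤₚ.+-identityʳ g) (act-0 L (λ _ → refl) g))
      (eq₂ m (act L D′ g)))))
    where
    D′ = λ n → _∣_.quotient (h n)
    eq₂ : ∀ m x → m * x + 0ℤ ≡ x * m
    eq₂ = solve-∀
    eq₁ : ∀ n → D n ≡ m * D′ (n - 0ℤ) + 0ℤ
    eq₁ n = trans (_∣_.equality (h n)) (trans (sym (eq₂ m (D′ n))) (cong (λ x → m * D′ x + 0ℤ) (sym (ℤₚ.+-identityʳ n))))

  ∤-positive : ∀ {w a b} → a ℕ.< b → b ℕ.< w → ¬ + w ∣ + b - + a
  ∤-positive {w} {a} {b} a<b b<w e = ℕ∣.>⇒∤ {{ℕ.>-nonZero (ℕₚ.m<n⇒0<n∸m a<b)}} (ℕₚ.≤-<-trans (ℕₚ.m∸n≤m b a) b<w)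
    (∣⇒∣ᵤ (subst (+ w ∣_) (trans (ℤₚ.m-n≡m⊖n b a) (ℤₚ.⊖-≥ (ℕₚ.<⇒≤ a<b))) e))

  ∤-difference : ∀ {w h r} → h ℕ.< w → r ℕ.< w → h ≢ r → ¬ + w ∣ + h - + r
  ∤-difference {w} {h} {r} h<w r<w h≢r d with ℕₚ.<-cmp h r
  ... | tri≈ _ h≡r _ = h≢r h≡r
  ... | tri< h<r _ _ = ∤-positive h<r r<w (∣-flip (+ h) (+ r) d)
  ... | tri> _ _ r<h = ∤-positive r<h h<w d

  -- This is the product L σ(L) ... σ^(n-1)(L) for σ = `σ u`, a norm when u^n acts trivially.
  norm : ℤ → ℕ → Laurent → Laurent
  norm u zero    L = const 1ℤ
  norm u (suc n) L = L ⊛ σ u (norm u n L)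

  poly : ℕ → (ℤ → ℤ) → Laurent
  poly zero    f = []
  poly (suc n) f = mono (f (+ n)) (+ n) ⊞ poly n f

  module All = LaurentPowers {ℤ → ℤ} (λ D → D)

  act-one-y^ : ∀ k D g → act (one-y^ k) D g ≡ D g - D (g - k)
  act-one-y^ k D g = trans (act-⊞ (const 1ℤ) (mono -1ℤ k) D g) (cong₂ _+_
    (trans (act-const 1ℤ D g) (ℤₚ.*-identityˡ _)) (trans (act-mono -1ℤ k D g) (ℤₚ.-1*i≡-i _)))

  ^≢0 : ∀ i n .{{_ : ℤ.NonZero i}} → ℤ.NonZero (i ^ n)
  ^≢0 i zero    = ℤ.≢-nonZero {1ℤ} λ ()
  ^≢0 i (suc n) {{i≢0}} = ℤₚ.i*j≢0 i (i ^ n) {{i≢0}} {{^≢0 i n}}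

  ^-distrib-* : ∀ i j n → (i * j) ^ n ≡ i ^ n * j ^ n
  ^-distrib-* i j zero    = refl
  ^-distrib-* i j (suc n) = trans (cong (i * j *_) (^-distrib-* i j n)) (eq i j (i ^ n) (j ^ n))
    where
    eq : ∀ a b c d → a * b * (c * d) ≡ a * c * (b * d)
    eq = solve-∀

  module Cyclotomic (p b w : ℕ) (pr : Prime p) (p⊥w : Coprime p w) {{w≢0 : ℕ.NonZero w}} where

    instance
      p≢0 : ℕ.NonZero p
      p≢0 = prime⇒nonZero pr

      q≢0 : ℕ.NonZero (p ℕ.^ b)
      q≢0 = ℕₚ.m^n≢0 p b

      z≢0 : ℕ.NonZero (p ℕ.^ b ℕ.* w)
      z≢0 = ℕₚ.m*n≢0 (p ℕ.^ b) w

    -- The exponent of p in the theorem is `suc b`, so that the subgroup of order p is generated by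
    -- y^z without any subtraction in exponents.
    z v : ℕ
    z = p ℕ.^ b ℕ.* w
    v = p ℕ.* z

    instance
      v≢0 : ℕ.NonZero v
      v≢0 = ℕₚ.m*n≢0 p z

    -- The coefficient function of y^(-z) - 1 in ℤ[C_v]. An element kills it exactly when it is
    -- invariant under y^z, that is, when it is a multiple of the sum of the subgroup of order p.
    Δ : ℤ → ℤ
    Δ n = δ (+ v) (n + + z) - δ (+ v) n

    -- The relation ≈ is equality in S = ℤ[C_w][ζ], where ζ = y^w has order p^(b+1): S is the quotient of ℤ[C_v] by the sum
    -- of the elements of its subgroup of order p.
    open LaurentPowers {⊤} (λ _ → Δ) public
    -- ℤ[C_w], in which ζ = 1.
    module W = LaurentPowers {⊤} (λ _ → δ (+ w))

    All⇒S : ∀ {L M} → L All.≈ M → L ≈ M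
    All⇒S e = mk λ _ g → All.at e Δ g

    All⇒W : ∀ {L M} → L All.≈ M → L W.≈ M
    All⇒W e = W.mk λ _ g → All.at e (δ (+ w)) g

    coeff : Laurent → ℤ → ℤ
    coeff L = act L (δ (+ v))

    act-Δ : ∀ L g → act L Δ g ≡ coeff L (g + + z) - coeff L g
    act-Δ L g = trans (act-diff L (λ n → δ (+ v) (n + + z)) (δ (+ v)) g)
      (cong (λ x → x - coeff L g) (act-translate L (δ (+ v)) (+ z) g))

    gap : Laurent → Laurent → ℤ → ℤ
    gap L M g = coeff L g - coeff M g

    private
      swap-diff : ∀ a b c d → a - b - (c - d) ≡ (a - c) - (b - d)
      swap-diff = solve-∀

    ≈⇒periodic : ∀ {L M} → L ≈ M → Periodic (+ z) (gap L M)
    ≈⇒periodic {L} {M} e g = ℤₚ.i-j≡0⇒i≡j _ _ (trans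
      (swap-diff (coeff L (g + + z)) (coeff M (g + + z)) (coeff L g) (coeff M g))
      (ℤₚ.i≡j⇒i-j≡0 (trans (sym (act-Δ L g)) (trans (at e tt g) (act-Δ M g)))))

    periodic⇒≈ : ∀ {L M} → Periodic (+ z) (gap L M) → L ≈ M
    periodic⇒≈ {L} {M} per = mk λ _ g → trans (act-Δ L g) (trans (ℤₚ.i-j≡0⇒i≡j _ _ (trans
      (swap-diff (coeff L (g + + z)) (coeff L g) (coeff M (g + + z)) (coeff M g))
      (ℤₚ.i≡j⇒i-j≡0 (per g)))) (sym (act-Δ M g)))

    -- The kernel of S → 𝔽_p[C_w], ζ ↦ 1; it is generated by 1 - ζ.
    I : Laurent → Set
    I L = ∀ g → + p ∣ act L (δ (+ w)) g

    I-W : ∀ {L M} → L W.≈ M → I L → I M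
    I-W e h g = subst (+ p ∣_) (W.at e tt g) (h g)

    I-⊛ : ∀ L {M} → I M → I (L ⊛ M)
    I-⊛ L {M} h g = subst (+ p ∣_) (sym (act-⊛ L M (δ (+ w)) g)) (act-∣ L h g)

    -- Equal elements of S differ by a z-periodic coefficient function. Folding C_v onto C_z adds p
    -- equal values of it, and the further folding onto C_w keeps the factor p. Hence ζ ↦ 1 is well
    -- defined from S to 𝔽_p[C_w].
    ≈⇒p∣diff : ∀ {L M} → L ≈ M → ∀ g → + p ∣ act L (δ (+ w)) g - act M (δ (+ w)) g
    ≈⇒p∣diff {L} {M} e = p∣diff
      where
      gap-z : ∀ g → act L (δ (+ z)) g - act M (δ (+ z)) g ≡ + p * gap L M g
      gap-z g = trans (cong₂ _-_ (act-δ-fold p z L g) (act-δ-fold p z M g))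
        (trans (sym (∑-- p (λ i → coeff L (g - + i * + z)) (λ i → coeff M (g - + i * + z))))
        (trans (∑-cong p λ i → periodic-∣ {gap L M} (≈⇒periodic e) (g - + i * + z) g (divides (- + i) (eq₁ g (+ i) (+ z))))
          (∑-const p (gap L M g))))
        where
        eq₁ : ∀ g i z → g - i * z - g ≡ - i * z
        eq₁ = solve-∀
      p∣diff : ∀ g → + p ∣ act L (δ (+ w)) g - act M (δ (+ w)) g
      p∣diff g = subst (+ p ∣_) (sym (trans (cong₂ _-_ (act-δ-fold (p ℕ.^ b) w L g) (act-δ-fold (p ℕ.^ b) w M g))
        (sym (∑-- (p ℕ.^ b) (λ j → act L (δ (+ z)) (g - + j * + w)) (λ j → act M (δ (+ z)) (g - + j * + w))))))
        (∑-∣ (p ℕ.^ b) λ j → divides (gap L M (g - + j * + w)) (trans (gap-z (g - + j * + w)) (ℤₚ.*-comm (+ p) (gap L M (g - + j * + w)))))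

    I-S : ∀ {L M} → L ≈ M → I L → I M
    I-S {L} {M} e h g = subst (+ p ∣_) (eq (act L (δ (+ w)) g) (act M (δ (+ w)) g)) (∣m∣n⇒∣m-n (h g) (≈⇒p∣diff e g))
      where
      eq : ∀ a b → a - (a - b) ≡ b
      eq = solve-∀

    w∣p*⇒w∣ : ∀ n → + w ∣ + p * n → + w ∣ n
    w∣p*⇒w∣ n d = ∣ᵤ⇒∣ (coprime-divisor (Coprimality.sym p⊥w) (subst (w ℕ∣.∣_) (ℤₚ.abs-* (+ p) n) (∣⇒∣ᵤ d)))

    I-const-p : ∀ L → I (const (+ p) ⊛ L)
    I-const-p L g = divides (act L (δ (+ w)) g) (trans (act-⊛ (const (+ p)) L (δ (+ w)) g)
      (trans (act-const (+ p) (act L (δ (+ w))) g) (ℤₚ.*-comm (+ p) (act L (δ (+ w)) g))))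

    -- Modulo p, L^p is `σ (+ p) L`. As p is prime to w, its coefficient at p g in C_w is that of L
    -- at g, so no coefficient is lost.
    I-^^p : ∀ L → I (L ^^ p) → I L
    I-^^p L h g with All.^^p-σ pr L
    ... | N , e = subst (+ p ∣_) σ-eq (∣m+n∣m⇒∣n (subst (+ p ∣_) (trans (All.at e (δ (+ w)) (+ p * g))
        (trans (act-⊞ (σ (+ p) L) (const (+ p) ⊛ N) (δ (+ w)) (+ p * g)) (ℤₚ.+-comm _ (act (const (+ p) ⊛ N) (δ (+ w)) (+ p * g)))))
        (h (+ p * g))) (I-const-p N (+ p * g)))
      where
      eq : ∀ p g k → p * g - p * k ≡ p * (g - k)
      eq = solve-∀
      σ-eq : act (σ (+ p) L) (δ (+ w)) (+ p * g) ≡ act L (δ (+ w)) g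
      σ-eq = act-σ (λ k → δ-iff (λ d → w∣p*⇒w∣ (g - k) (subst (+ w ∣_) (eq (+ p) g k) d))
        (λ d → subst (+ w ∣_) (sym (eq (+ p) g k)) (∣n⇒∣m*n (+ p) d))) L

    I-^^pⁿ : ∀ n L → I (L ^^ (p ℕ.^ n)) → I L
    I-^^pⁿ zero    L h = I-W (W.≈-trans (W.⊛-comm L (const 1ℤ)) (W.⊛-identityˡ L)) h
    I-^^pⁿ (suc n) L h = I-^^pⁿ n L (I-^^p (L ^^ (p ℕ.^ n)) (I-W (W.^^-* L p (p ℕ.^ n)) h))

    -- Since n ≤ p^n, the power L^(p^n) lies in `I` as well, and p-th roots can be taken n times.
    I-radical : ∀ n L → I (L ^^ n) → I L
    I-radical n L h = I-^^pⁿ n L (I-W (W.≈-trans (W.≈-sym (W.^^-+ L (p ℕ.^ n ∸ n) n)) (W.≡⇒≈ (cong (L ^^_) (ℕₚ.m∸n+n≡m (n≤pⁿ n)))))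
      (I-⊛ (L ^^ (p ℕ.^ n ∸ n)) h))
      where
      n≤pⁿ : ∀ n → n ℕ.≤ p ℕ.^ n
      n≤pⁿ zero    = ℕ.z≤n
      n≤pⁿ (suc n) = ℕₚ.≤-trans (ℕₚ.+-mono-≤ (ℕₚ.m^n>0 p n) (n≤pⁿ n)) (ℕₚ.≤-trans (ℕₚ.≤-reflexive (cong (p ℕ.^ n ℕ.+_) (sym (ℕₚ.+-identityʳ _))))
        (ℕₚ.*-monoˡ-≤ (p ℕ.^ n) (ℕ.nonTrivial⇒n>1 p {{prime⇒nonTrivial pr}})))

    -- The ideal of 1 - ζ and total ramification

    π : Laurent
    π = one-y^ (+ w)

    open Modulo π

    mono-shift : ∀ c k → mono c (k + + w) ∼ mono c k
    mono-shift c k = mono (- c) k , mk λ _ g → begin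
      act (mono c (k + + w)) Δ g                        ≡⟨ act-mono c (k + + w) Δ g ⟩
      c * Δ (g - (k + + w))                             ≡⟨ cong (λ x → c * Δ x) (eq₁ g k (+ w)) ⟩
      c * Δ (g - + w - k)                               ≡⟨ eq₂ c (Δ (g - k)) (Δ (g - + w - k)) ⟩
      c * Δ (g - k) + (- c * Δ (g - k) - - c * Δ (g - + w - k))
        ≡⟨ cong₂ _+_ (sym (act-mono c k Δ g)) (cong₂ _-_ (sym (act-mono (- c) k Δ g)) (sym (act-mono (- c) k Δ (g - + w)))) ⟩
      act (mono c k) Δ g + (act (mono (- c) k) Δ g - act (mono (- c) k) Δ (g - + w))
        ≡⟨ ℤ-+-congˡ (act (mono c k) Δ g) (sym (trans (act-⊛ π (mono (- c) k) Δ g) (act-one-y^ (+ w) (act (mono (- c) k) Δ) g))) ⟩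
      act (mono c k) Δ g + act (π ⊛ mono (- c) k) Δ g
        ≡⟨ act-⊞ (mono c k) (π ⊛ mono (- c) k) Δ g ⟨
      act (mono c k ⊞ π ⊛ mono (- c) k) Δ g             ∎
      where
      open ≡-Reasoning
      eq₁ : ∀ g k w → g - (k + w) ≡ g - w - k
      eq₁ = solve-∀
      eq₂ : ∀ c x y → c * y ≡ c * x + (- c * x - - c * y)
      eq₂ = solve-∀

    mono-shift-* : ∀ c k q → mono c (k + q * + w) ∼ mono c k
    mono-shift-* c k (+ n) = shiftⁿ c k n
      where
      eq₀ : ∀ k w → k + 0ℤ * w ≡ k
      eq₀ = solve-∀
      eq₁ : ∀ k n w → k + (1ℤ + n) * w ≡ k + n * w + w
      eq₁ = solve-∀
      shiftⁿ : ∀ c k n → mono c (k + + n * + w) ∼ mono c k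
      shiftⁿ c k zero    = ≈⇒∼ (≡⇒≈ (cong (mono c) (eq₀ k (+ w))))
      shiftⁿ c k (suc n) = ∼-trans (≈⇒∼ (≡⇒≈ (cong (mono c) (eq₁ k (+ n) (+ w))))) (∼-trans (mono-shift c (k + + n * + w)) (shiftⁿ c k n))
    mono-shift-* c k ℤ.-[1+ n ] = ∼-sym (∼-trans (≈⇒∼ (≡⇒≈ (cong (mono c) (eq k (+ suc n) (+ w)))))
        (mono-shift-* c (k + ℤ.-[1+ n ] * + w) (+ suc n)))
      where
      eq : ∀ k n w → k ≡ k + - n * w + n * w
      eq = solve-∀

    mono-0 : ∀ k → mono 0ℤ k ≈ []
    mono-0 k = mk λ _ g → trans (act-mono 0ℤ k Δ g) (trans (ℤₚ.*-zeroˡ (Δ (g - k))) (sym (act-[] Δ g)))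

    poly-zero : ∀ n f → (∀ h → h ℕ.< n → f (+ h) ≡ 0ℤ) → poly n f ≈ []
    poly-zero zero    f h = ≈-refl
    poly-zero (suc n) f h = ≈-trans (⊞-cong (≈-trans (≡⇒≈ (cong (λ c → mono c (+ n)) (h n ℕₚ.≤-refl))) (mono-0 (+ n)))
      (poly-zero n f λ i i<n → h i (ℕₚ.m≤n⇒m≤1+n i<n))) (≡⇒≈ (⊞-identityˡ []))

    poly-single : ∀ n f r → r ℕ.< n → (∀ h → h ℕ.< n → h ≢ r → f (+ h) ≡ 0ℤ) → poly n f ≈ mono (f (+ r)) (+ r)
    poly-single (suc n) f r r<sn h with r ℕ.≟ n
    ... | yes refl = ≈-trans (⊞-cong (≈-refl {mono (f (+ n)) (+ n)}) (poly-zero n f λ i i<n → h i (ℕₚ.m≤n⇒m≤1+n i<n) (ℕₚ.<⇒≢ i<n)))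
      (≡⇒≈ (⊞-identityʳ _))
    ... | no r≢n = ≈-trans (⊞-cong (≈-trans (≡⇒≈ (cong (λ c → mono c (+ n)) (h n ℕₚ.≤-refl (λ e → r≢n (sym e))))) (mono-0 (+ n)))
      (poly-single n f r (ℕₚ.≤∧≢⇒< (ℕ.s≤s⁻¹ r<sn) r≢n) λ i i<n → h i (ℕₚ.m≤n⇒m≤1+n i<n))) (≡⇒≈ (⊞-identityˡ _))

    poly-⊞ : ∀ n f g → poly n (λ h → f h + g h) ≈ poly n f ⊞ poly n g
    poly-⊞ zero    f g = ≈-sym (≡⇒≈ (⊞-identityˡ []))
    poly-⊞ (suc n) f g = ≈-trans (⊞-cong (mono-⊞ (f (+ n)) (g (+ n)) (+ n)) (poly-⊞ n f g))
      (⊞-interchange (mono (f (+ n)) (+ n)) (mono (g (+ n)) (+ n)) (poly n f) (poly n g))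

    poly-* : ∀ n m f → poly n (λ h → m * f h) ≈ const m ⊛ poly n f
    poly-* zero    m f = ≈-sym (≈-trans (≡⇒≈ (sym (⊞-identityˡ _))) (⊞-0 (const m) []))
    poly-* (suc n) m f = ≈-trans (⊞-cong (≈-sym (const-⊛-mono m (f (+ n)) (+ n))) (poly-* n m f))
      (≈-sym (⊛-distribˡ (const m) (mono (f (+ n)) (+ n)) (poly n f)))

    poly-cong : ∀ n {f g} → (∀ h → f h ≡ g h) → poly n f ≈ poly n g
    poly-cong zero    e = ≈-refl
    poly-cong (suc n) e = ⊞-cong (≡⇒≈ (cong (λ c → mono c (+ n)) (e (+ n)))) (poly-cong n e)

    mono∼poly : ∀ c k → mono c k ∼ poly w (act (mono c k) (δ (+ w)))
    mono∼poly c k = ∼-trans (≈⇒∼ (≡⇒≈ (cong (mono c) (a≡a%ℕn+[a/ℕn]*n k w))))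
      (∼-trans (mono-shift-* c (+ r) (k /ℕ w)) (≈⇒∼ (≈-sym (≈-trans
        (poly-single w (act (mono c k) (δ (+ w))) r (n%ℕd<d k w) off) (≡⇒≈ (cong (λ x → mono x (+ r)) diag))))))
      where
      r = k %ℕ w
      eq : ∀ r q w → r - (r + q * w) ≡ - q * w
      eq = solve-∀
      eq₁ : ∀ h r q w → h - (r + q * w) + q * w ≡ h - r
      eq₁ = solve-∀
      off : ∀ h → h ℕ.< w → h ≢ r → act (mono c k) (δ (+ w)) (+ h) ≡ 0ℤ
      off h h<w h≢r = trans (act-mono c k (δ (+ w)) (+ h)) (trans (cong (c *_) (δ-no λ d → ∤-difference h<w (n%ℕd<d k w) h≢r
        (subst (+ w ∣_) (eq₁ (+ h) (+ r) (k /ℕ w) (+ w)) (∣m∣n⇒∣m+n (subst (λ x → + w ∣ + h - x) (a≡a%ℕn+[a/ℕn]*n k w) d)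
          (divides (k /ℕ w) refl))))) (ℤₚ.*-zeroʳ c))
      diag : act (mono c k) (δ (+ w)) (+ r) ≡ c
      diag = trans (act-mono c k (δ (+ w)) (+ r)) (trans (cong (c *_) (δ-yes (divides (- (k /ℕ w))
        (trans (cong (λ x → + r - x) (a≡a%ℕn+[a/ℕn]*n k w)) (eq (+ r) (k /ℕ w) (+ w)))))) (ℤₚ.*-identityʳ c))

    ∼poly : ∀ L → L ∼ poly w (act L (δ (+ w)))
    ∼poly [] = ≈⇒∼ (≈-sym (poly-zero w (act [] (δ (+ w))) λ h _ → act-[] (δ (+ w)) (+ h)))
    ∼poly ((c , k) ∷ L) = ∼-trans (≈⇒∼ (≡⇒≈ (∷≡⊞ c k L))) (∼-trans (∼-⊞ (mono∼poly c k) (∼poly L))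
      (≈⇒∼ (≈-sym (≈-trans (poly-cong w λ h → trans (cong (λ K → act K (δ (+ w)) h) (∷≡⊞ c k L)) (act-⊞ (mono c k) L (δ (+ w)) h))
        (poly-⊞ w (act (mono c k) (δ (+ w))) (act L (δ (+ w))))))))

    periods : Laurent
    periods = lsum p (λ i → y^ (+ i * + z))

    -- Applied to `Δ` the sum telescopes to δ(g + z) - δ(g + z - p z), and p z = v.
    periods≈0 : periods ≈ []
    periods≈0 = mk λ _ g → trans (act-lsum p (λ i → y^ (+ i * + z)) Δ g)
      (trans (∑-cong p λ i → trans (act-y^ (+ i * + z) Δ g) (cong (λ x → δ (+ v) x - δ (+ v) (g - + i * + z)) (eq₁ g (+ i) (+ z))))
      (trans (telescope g p) (trans (ℤₚ.i≡j⇒i-j≡0 (sym (δ-cong (g + + z - + p * + z) (g + + z)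
        (divides -1ℤ (trans (eq₂ g (+ z) (+ p * + z)) (cong (-1ℤ *_) (sym (ℤₚ.pos-* p z)))))))) (sym (act-[] Δ g)))))
      where
      eq₁ : ∀ g i z → g - i * z + z ≡ g + z - i * z
      eq₁ = solve-∀
      eq₂ : ∀ g z x → g + z - x - (g + z) ≡ -1ℤ * x
      eq₂ = solve-∀
      eq₃ : ∀ g i z → g - i * z ≡ g + z - (1ℤ + i) * z
      eq₃ = solve-∀
      eq₄ : ∀ a b c → b - c + (a - b) ≡ a - c
      eq₄ = solve-∀
      eq₅ : ∀ x z → x ≡ x - 0ℤ * z
      eq₅ = solve-∀
      telescope : ∀ g n → ∑ n (λ i → δ (+ v) (g + + z - + i * + z) - δ (+ v) (g - + i * + z))
                          ≡ δ (+ v) (g + + z) - δ (+ v) (g + + z - + n * + z)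
      telescope g zero    = sym (ℤₚ.i≡j⇒i-j≡0 (cong (δ (+ v)) (eq₅ (g + + z) (+ z))))
      telescope g (suc n) = trans (cong₂ _+_ (cong (λ x → δ (+ v) (g + + z - + n * + z) - δ (+ v) x) (eq₃ g (+ n) (+ z))) (telescope g n))
        (eq₄ (δ (+ v) (g + + z)) (δ (+ v) (g + + z - + n * + z)) (δ (+ v) (g + + z - + suc n * + z)))

    -- Each of the p terms of `periods` is a power of ζ, hence 1 modulo 1 - ζ, while their sum is 0
    -- in S.
    p∼0 : const (+ p) ∼ []
    p∼0 = ∼-trans (∼-sym (ones p)) (≈⇒∼ periods≈0)
      where
      ones : ∀ n → lsum n (λ i → y^ (+ i * + z)) ∼ const (+ n)
      ones n = go n (λ i → + i * + (p ℕ.^ b)) _ λ i → trans (cong (+ i *_) (ℤₚ.pos-* (p ℕ.^ b) w)) (eq₁ (+ i) (+ (p ℕ.^ b)) (+ w))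
        where
        eq₁ : ∀ i q w → i * (q * w) ≡ 0ℤ + i * q * w
        eq₁ = solve-∀
        go : ∀ n (q : ℕ → ℤ) (k : ℕ → ℤ) → (∀ i → k i ≡ 0ℤ + q i * + w) → lsum n (λ i → y^ (k i)) ∼ const (+ n)
        go zero    q k h = ≈⇒∼ (≈-sym const-0)
        go (suc n) q k h = ∼-trans (∼-⊞ (∼-trans (≈⇒∼ (≡⇒≈ (cong y^ (h 0)))) (mono-shift-* 1ℤ 0ℤ (q 0)))
          (go n (λ i → q (suc i)) (λ i → k (suc i)) (λ i → h (suc i)))) (≈⇒∼ (≈-sym (const-+ 1ℤ (+ n))))

    -- Modulo 1 - ζ exponents count only modulo w, so L is congruent to the polynomial of degree
    -- below w formed from its coefficients in ℤ[C_w]. These are multiples of p, and p is a multiple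
    -- of 1 - ζ.
    I⇒π∣ : ∀ L → I L → ∃ λ M → L ≈ π ⊛ M
    I⇒π∣ L h = ∼-multiple p∼0 (∼-trans (∼poly L) (≈⇒∼ (≈-trans
      (poly-cong w λ g → trans (_∣_.equality (h g)) (ℤₚ.*-comm (_∣_.quotient (h g)) (+ p)))
      (poly-* w (+ p) (λ g → _∣_.quotient (h g))))))

    π≈0 : π W.≈ []
    π≈0 = W.mk λ _ g → trans (act-one-y^ (+ w) (δ (+ w)) g) (trans
      (ℤₚ.i≡j⇒i-j≡0 (δ-cong g (g - + w) (divides 1ℤ (eq g (+ w))))) (sym (act-[] (δ (+ w)) g)))
      where
      eq : ∀ g w → g - (g - w) ≡ 1ℤ * w
      eq = solve-∀

    W-zero : ∀ {L} M → L W.≈ [] → L ⊛ M W.≈ []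
    W-zero {L} M e = W.≈-trans (W.⊛-cong e (W.≈-refl {M})) (W.≈-trans (W.⊛-comm [] M)
      (W.≈-trans (W.≡⇒≈ (sym (⊞-identityˡ _))) (W.⊞-0 M [])))

    I-0 : ∀ {L} → L W.≈ [] → I L
    I-0 e = I-W (W.≈-sym e) λ g → divides 0ℤ (act-[] (δ (+ w)) g)

    -- Euler's function of p^(b+1), which is the ramification index of p.
    φ : ℕ
    φ = (p ∸ 1) ℕ.* p ℕ.^ b

    φ>0 : 0 ℕ.< φ
    φ>0 = ℕₚ.m<n⇒0<n∸m {0} (ℕₚ.*-mono-≤ {1} (ℕₚ.m<n⇒0<n∸m (ℕ.nonTrivial⇒n>1 p {{prime⇒nonTrivial pr}})) (ℕₚ.m^n>0 p b))

    periods-W : periods W.≈ const (+ p)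
    periods-W = W.mk λ _ g → trans (act-lsum p (λ i → y^ (+ i * + z)) (δ (+ w)) g)
      (trans (∑-cong p λ i → trans (act-y^ (+ i * + z) (δ (+ w)) g) (δ-cong (g - + i * + z) g
        (divides (- (+ i * + (p ℕ.^ b))) (trans (cong (λ x → g - + i * x - g) (ℤₚ.pos-* (p ℕ.^ b) w)) (eq g (+ i) (+ (p ℕ.^ b)) (+ w))))))
      (trans (∑-const p (δ (+ w) g)) (sym (act-const (+ p) (δ (+ w)) g))))
      where
      eq : ∀ g i q w → g - i * (q * w) - g ≡ - (i * q) * w
      eq = solve-∀

    -- Modulo p, (1 - ζ)^(p^b) is 1 - y^z, whose (p-1)-st power is `periods`. The congruence is
    -- taken in ℤ[y, y⁻¹], so it can be read in two quotients: in S `periods` vanishes, which gives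
    -- π^φ = p c₀; in ℤ[C_w] it reads 0 = p + p c₀, which gives c₀ = -1 there.
    ramification : ∃ λ c₀ → π ^^ φ ≈ const (+ p) ⊛ c₀ × c₀ W.≈ neg (const 1ℤ)
    ramification with All.one-y^-^^pⁿ pr (+ w) b
    ... | N , e₁ with All.^^-mod (+ p) (one-y^ (+ (p ℕ.^ b) * + w)) N (p ∸ 1) | All.one-y^-^^p-1 pr (+ z)
    ...   | M , e₂ | K , e₃ = K ⊞ M , ≈-trans (All⇒S e) (≈-trans (⊞-cong periods≈0 (≈-refl {const (+ p) ⊛ (K ⊞ M)})) (≡⇒≈ (⊞-identityˡ _))) , c₀-W
      where
      e : π ^^ φ All.≈ periods ⊞ const (+ p) ⊛ (K ⊞ M)
      e = All.≈-trans (All.^^-* π (p ∸ 1) (p ℕ.^ b)) (All.≈-trans (All.^^-cong (p ∸ 1) e₁) (All.≈-trans e₂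
        (All.≈-trans (All.⊞-cong (All.≈-trans (All.≡⇒≈ (cong (λ x → one-y^ x ^^ (p ∸ 1)) (sym (ℤₚ.pos-* (p ℕ.^ b) w)))) e₃) (All.≈-refl {const (+ p) ⊛ M}))
        (All.≈-trans (All.≡⇒≈ (⊞-assoc periods (const (+ p) ⊛ K) (const (+ p) ⊛ M)))
          (All.⊞-cong (All.≈-refl {periods}) (All.≈-sym (All.⊛-distribˡ (const (+ p)) K M)))))))
      c₀-W : K ⊞ M W.≈ neg (const 1ℤ)
      c₀-W = W.const-cancel (+ p) (W.mk λ _ g → ℤₚ.i-j≡0⇒i≡j _ _ (trans (eq g) (trans (sym (W.at (All⇒W e) tt g))
          (trans (W.at π^φ≈0 tt g) (act-[] (δ (+ w)) g)))))
        where
        π^φ≈0 : π ^^ φ W.≈ []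
        π^φ≈0 = W.≈-trans (W.≡⇒≈ (cong (π ^^_) (sym (ℕₚ.suc-pred φ {{ℕ.>-nonZero φ>0}})))) (W-zero (π ^^ ℕ.pred φ) π≈0)
        eq₁ : ∀ a p d → a - p * - (1ℤ * d) ≡ p * d + a
        eq₁ = solve-∀
        eq : ∀ g → act (const (+ p) ⊛ (K ⊞ M)) (δ (+ w)) g - act (const (+ p) ⊛ neg (const 1ℤ)) (δ (+ w)) g
                 ≡ act (periods ⊞ const (+ p) ⊛ (K ⊞ M)) (δ (+ w)) g
        eq g = trans (cong (λ x → act (const (+ p) ⊛ (K ⊞ M)) (δ (+ w)) g - x) (trans (act-⊛ (const (+ p)) (neg (const 1ℤ)) (δ (+ w)) g)
            (trans (act-const (+ p) _ g) (cong (+ p *_) (trans (act-neg (const 1ℤ) (δ (+ w)) g) (cong -_ (act-const 1ℤ (δ (+ w)) g)))))))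
          (trans (eq₁ (act (const (+ p) ⊛ (K ⊞ M)) (δ (+ w)) g) (+ p) (δ (+ w) g))
          (sym (trans (act-⊞ periods (const (+ p) ⊛ (K ⊞ M)) (δ (+ w)) g) (cong (λ x → x + act (const (+ p) ⊛ (K ⊞ M)) (δ (+ w)) g)
            (trans (W.at periods-W tt g) (act-const (+ p) (δ (+ w)) g))))))

    -- Norms for the automorphisms y ↦ y^u, and divisibility by p

    record Galois (u : ℤ) (r : ℕ) : Set where
      field
        u≡1   : + w ∣ u - 1ℤ
        order : + v ∣ u ^ suc r - 1ℤ

    coeff⇒≈ : ∀ {L M} → (∀ g → coeff L g ≡ coeff M g) → L ≈ M
    coeff⇒≈ {L} {M} h = mk λ _ g → trans (act-Δ L g) (trans (cong₂ _-_ (h (g + + z)) (h g)) (sym (act-Δ M g)))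

    module _ {u : ℤ} {r : ℕ} (gal : Galois u r) where
      open Galois gal

      σ-W : ∀ L → σ u L W.≈ L
      σ-W L = W.mk λ _ g → act-σ (λ k → δ-cong (g - u * k) (g - k) (subst (+ w ∣_) (eq g u k) (∣n⇒∣m*n (- k) u≡1))) L
        where
        eq : ∀ g u k → - k * (u - 1ℤ) ≡ g - u * k - (g - k)
        eq = solve-∀

      -- u^r is the inverse of u modulo v; the exponent in `Galois` is written `suc r` to have it at
      -- hand.
      coeff-σ : ∀ L g → coeff (σ u L) g ≡ coeff L (u ^ r * g)
      coeff-σ L g = act-σ (λ k → δ-iff
        (λ d → subst (+ v ∣_) (eq₁ u (u ^ r) g k) (∣m∣n⇒∣m+n (∣n⇒∣m*n (u ^ r) d) (∣n⇒∣m*n k order)))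
        (λ d → subst (+ v ∣_) (eq₂ u (u ^ r) g k) (∣m∣n⇒∣m-n (∣n⇒∣m*n u d) (∣n⇒∣m*n g order)))) L
        where
        eq₁ : ∀ u x g k → x * (g - u * k) + k * (u * x - 1ℤ) ≡ x * g - k
        eq₁ = solve-∀
        eq₂ : ∀ u x g k → u * (x * g - k) - g * (u * x - 1ℤ) ≡ g - u * k
        eq₂ = solve-∀

      σ-cong : ∀ {L M} → L ≈ M → σ u L ≈ σ u M
      σ-cong {L} {M} e = periodic⇒≈ λ g → trans (gap-σ (g + + z)) (trans (cong (gap L M) (ℤₚ.*-distribˡ-+ (u ^ r) g (+ z)))
        (trans (periodic-* {gap L M} (≈⇒periodic e) (u ^ r) (u ^ r * g)) (sym (gap-σ g))))
        where
        gap-σ : ∀ g → gap (σ u L) (σ u M) g ≡ gap L M (u ^ r * g)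
        gap-σ g = cong₂ _-_ (coeff-σ L g) (coeff-σ M g)

      σ-order : ∀ L → σ (u ^ suc r) L ≈ L
      σ-order L = coeff⇒≈ λ g → act-σ (λ k → δ-cong (g - u ^ suc r * k) (g - k)
          (subst (+ v ∣_) (eq g (u ^ suc r) k) (∣n⇒∣m*n (- k) order))) L
        where
        eq : ∀ g u k → - k * (u - 1ℤ) ≡ g - u * k - (g - k)
        eq = solve-∀

      norm-cong : ∀ n {L M} → L ≈ M → norm u n L ≈ norm u n M
      norm-cong zero    e = ≈-refl
      norm-cong (suc n) e = ⊛-cong e (σ-cong (norm-cong n e))

      norm-⊛ : ∀ n L M → norm u n (L ⊛ M) ≈ norm u n L ⊛ norm u n M
      norm-⊛ zero    L M = ≈-sym (⊛-identityˡ (const 1ℤ))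
      norm-⊛ (suc n) L M = ≈-trans (⊛-cong (≈-refl {L ⊛ M}) (≈-trans (σ-cong (norm-⊛ n L M)) (≡⇒≈ (σ-⊛ u (norm u n L) (norm u n M)))))
        (⊛-interchange L M (σ u (norm u n L)) (σ u (norm u n M)))

      norm-const : ∀ n c → norm u n (const c) ≡ const (c ^ n)
      norm-const zero    c = refl
      norm-const (suc n) c = trans (cong (λ x → const c ⊛ x) (trans (cong (σ u) (norm-const n c)) (σ-const u (c ^ n))))
        (mono-⊛ c 0ℤ (c ^ n) 0ℤ)

      -- σ is the identity where ζ = 1, so a norm becomes a power there and `I-radical` applies to
      -- it.
      norm-W : ∀ n L → norm u n L W.≈ L ^^ n
      norm-W zero    L = W.≈-refl
      norm-W (suc n) L = W.⊛-cong (W.≈-refl {L}) (W.≈-trans (σ-W (norm u n L)) (norm-W n L))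

      -- Both sides are the product of σ^i(L) over 0 ≤ i ≤ n, split at opposite ends.
      norm-rotate : ∀ n L → L ⊛ σ u (norm u n L) ≈ norm u n L ⊛ σ (u ^ n) L
      norm-rotate zero    L = ≈-trans (⊛-cong (≈-refl {L}) (≡⇒≈ (σ-const u 1ℤ))) (≈-trans (⊛-comm L (const 1ℤ))
        (⊛-cong (≈-refl {const 1ℤ}) (≡⇒≈ (sym (σ-1 L)))))
      norm-rotate (suc n) L = ≈-trans (⊛-cong (≈-refl {L}) (≈-trans (σ-cong (norm-rotate n L))
          (≡⇒≈ (trans (σ-⊛ u (norm u n L) (σ (u ^ n) L)) (cong (λ x → σ u (norm u n L) ⊛ x) (σ-∘ u (u ^ n) L))))))
        (≈-sym (⊛-assoc L (σ u (norm u n L)) (σ (u ^ suc n) L)))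

      -- At n = `suc r` the last factor σ^n(L) in `norm-rotate` is L again, and L cancels because it
      -- divides m.
      σ-norm : ∀ m .{{_ : ℤ.NonZero m}} {L M} → L ⊛ M ≈ const m → σ u (norm u (suc r) L) ≈ norm u (suc r) L
      σ-norm m {L} {M} d = divisor-cancel m d (≈-trans (norm-rotate (suc r) L) (≈-trans (⊛-cong (≈-refl {norm u (suc r) L}) (σ-order L))
        (⊛-comm (norm u (suc r) L) L)))

      I-norm : ∀ n L → I (norm u n L) → I L
      I-norm n L h = I-radical n L (I-W (norm-W n L) h)

      norm-cancel : ∀ n m .{{_ : ℤ.NonZero m}} {K L M c P} → norm u n K ≈ const m → norm u n L ≈ const m ⊛ c → L ⊛ P ≈ K ⊛ M →
        c ⊛ norm u n P ≈ norm u n M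
      norm-cancel n m {K} {L} {M} {c} {P} k e LP = const-cancel m
        (≈-trans (≈-sym (⊛-assoc (const m) c (norm u n P))) (≈-trans (⊛-cong (≈-sym e) (≈-refl {norm u n P}))
        (≈-trans (≈-sym (norm-⊛ n L P)) (≈-trans (norm-cong n LP) (≈-trans (norm-⊛ n K M) (⊛-cong k (≈-refl {norm u n M})))))))

      I-neg : ∀ M → I (neg (const 1ℤ) ⊛ M) → I M
      I-neg M h g = subst (+ p ∣_) (trans (cong -_ (trans (act-⊛ (neg (const 1ℤ)) M (δ (+ w)) g)
        (trans (act-neg (const 1ℤ) (act M (δ (+ w))) g) (cong -_ (act-const 1ℤ (act M (δ (+ w))) g))))) (eq (act M (δ (+ w)) g)))
        (∣m⇒∣-m (h g))
        where
        eq : ∀ x → - - (1ℤ * x) ≡ x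
        eq = solve-∀

      I-norm-π : ∀ k → I (norm u (suc r) (π ^^ suc k))
      I-norm-π k = I-W (W.≈-sym (norm-W (suc r) (π ^^ suc k))) (I-0 (W-zero ((π ^^ suc k) ^^ r) (W-zero (π ^^ k) π≈0)))

      -- Since S/(1 - ζ) is reduced, S is integrally closed at p; the factors 1 - ζ are split off one at a time.
      split-π : ∀ {c₀} → π ^^ φ ≈ const (+ p) ⊛ c₀ → c₀ W.≈ neg (const 1ℤ) → ∀ m .{{_ : ℤ.NonZero m}} →
        norm u (suc r) (const (+ p)) ≈ const m → ∀ {L c} → norm u (suc r) L ≈ const m ⊛ c →
        ∀ k j → suc k ℕ.+ j ≡ φ → ∀ M → L ≈ π ^^ j ⊛ M → I M
      split-π {c₀} ram c₀-W m km {L} {c} e k j eq M f = I-neg M (I-W (W.⊛-cong c₀-W (W.≈-refl {M}))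
        (I-norm (suc r) (c₀ ⊛ M) (I-S (norm-cancel (suc r) m km e LP) (I-⊛ c (I-norm-π k)))))
        where
        LP : L ⊛ π ^^ suc k ≈ const (+ p) ⊛ (c₀ ⊛ M)
        LP = ≈-trans (⊛-comm L (π ^^ suc k)) (≈-trans (⊛-cong (≈-refl {π ^^ suc k}) f) (≈-trans (≈-sym (⊛-assoc (π ^^ suc k) (π ^^ j) M))
          (≈-trans (⊛-cong (≈-trans (≈-sym (^^-+ π (suc k) j)) (≈-trans (≡⇒≈ (cong (π ^^_) eq)) ram)) (≈-refl {M}))
            (⊛-assoc (const (+ p)) c₀ M))))

      -- `split-π` raises the exponent of π in L from 0 to φ one unit at a time, and π^φ is a
      -- multiple of p.
      ramified-norm-p∣⇒p∣ : ∀ {c₀} → π ^^ φ ≈ const (+ p) ⊛ c₀ → c₀ W.≈ neg (const 1ℤ) → ∀ m .{{_ : ℤ.NonZero m}} →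
        norm u (suc r) (const (+ p)) ≈ const m → ∀ {L c} → norm u (suc r) L ≈ const m ⊛ c → ∃ λ M → L ≈ const (+ p) ⊛ M
      ramified-norm-p∣⇒p∣ {c₀} ram c₀-W m km {L} {c} e = conclude (steps φ ℕₚ.≤-refl)
        where
        steps : ∀ j → j ℕ.≤ φ → ∃ λ M → L ≈ π ^^ j ⊛ M
        steps zero    _   = L , ≈-sym (⊛-identityˡ L)
        steps (suc j) j<φ = extend (steps j (ℕₚ.<⇒≤ j<φ))
          where
          append : ∀ {M} → L ≈ π ^^ j ⊛ M → (∃ λ N → M ≈ π ⊛ N) → ∃ λ N → L ≈ π ^^ suc j ⊛ N
          append f (N , g) = N , ≈-trans f (≈-trans (⊛-cong (≈-refl {π ^^ j}) g)
            (≈-trans (⊛-swap (π ^^ j) π N) (≈-sym (⊛-assoc π (π ^^ j) N))))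
          extend : (∃ λ M → L ≈ π ^^ j ⊛ M) → ∃ λ N → L ≈ π ^^ suc j ⊛ N
          extend (M , f) = append f (I⇒π∣ M (split-π ram c₀-W m km e (φ ∸ suc j) j
            (trans (sym (ℕₚ.+-suc (φ ∸ suc j) j)) (ℕₚ.m∸n+n≡m j<φ)) M f))
        conclude : (∃ λ M → L ≈ π ^^ φ ⊛ M) → ∃ λ M → L ≈ const (+ p) ⊛ M
        conclude (M , f) = c₀ ⊛ M , ≈-trans f (≈-trans (⊛-cong ram (≈-refl {M})) (⊛-assoc (const (+ p)) c₀ M))

      norm-p∣⇒p∣ : ∀ {L c} → norm u (suc r) L ≈ const ((+ p) ^ suc r) ⊛ c → ∃ λ M → L ≈ const (+ p) ⊛ M
      norm-p∣⇒p∣ = ramified-norm-p∣⇒p∣ (proj₁ (proj₂ ramification)) (proj₂ (proj₂ ramification)) ((+ p) ^ suc r)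
        {{^≢0 (+ p) (suc r)}} (≡⇒≈ (norm-const (suc r) (+ p)))

      norm-pⁿ∣⇒pⁿ∣ : ∀ n {L c} → norm u (suc r) L ≈ const (((+ p) ^ n) ^ suc r) ⊛ c → ∃ λ M → L ≈ const ((+ p) ^ n) ⊛ M
      norm-pⁿ∣⇒pⁿ∣ zero    {L}     e = L , ≈-sym (⊛-identityˡ L)
      norm-pⁿ∣⇒pⁿ∣ (suc n) {L} {c} e = go (norm-p∣⇒p∣ e′)
        where
        split : ∀ a b d → const a ≈ const b ⊛ const d → const a ⊛ c ≈ const b ⊛ (const d ⊛ c)
        split a b d e = ≈-trans (⊛-cong e (≈-refl {c})) (⊛-assoc (const b) (const d) c)
        e′ : norm u (suc r) L ≈ const ((+ p) ^ suc r) ⊛ (const (((+ p) ^ n) ^ suc r) ⊛ c)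
        e′ = ≈-trans e (split (((+ p) ^ suc n) ^ suc r) ((+ p) ^ suc r) (((+ p) ^ n) ^ suc r)
          (≈-trans (≡⇒≈ (cong const (^-distrib-* (+ p) ((+ p) ^ n) (suc r)))) (const-* ((+ p) ^ suc r) (((+ p) ^ n) ^ suc r))))
        go : (∃ λ M → L ≈ const (+ p) ⊛ M) → ∃ λ M → L ≈ const ((+ p) ^ suc n) ⊛ M
        go (M , f) = ascend (norm-pⁿ∣⇒pⁿ∣ n {M} {c} (const-cancel ((+ p) ^ suc r) {{^≢0 (+ p) (suc r)}} cancelled))
          where
          cancelled : const ((+ p) ^ suc r) ⊛ norm u (suc r) M ≈ const ((+ p) ^ suc r) ⊛ (const (((+ p) ^ n) ^ suc r) ⊛ c)
          cancelled = ≈-trans (⊛-cong (≡⇒≈ (sym (norm-const (suc r) (+ p)))) (≈-refl {norm u (suc r) M}))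
            (≈-trans (≈-sym (norm-⊛ (suc r) (const (+ p)) M)) (≈-trans (norm-cong (suc r) (≈-sym f)) e′))
          ascend : (∃ λ N → M ≈ const ((+ p) ^ n) ⊛ N) → ∃ λ N → L ≈ const ((+ p) ^ suc n) ⊛ N
          ascend (N , g) = N , ≈-trans f (≈-trans (⊛-cong (≈-refl {const (+ p)}) g)
            (≈-trans (≈-sym (⊛-assoc (const (+ p)) (const ((+ p) ^ n)) N)) (⊛-cong (≈-sym (const-* (+ p) ((+ p) ^ n))) (≈-refl {N}))))

  -- Multipliers

  bar : Laurent → Laurent
  bar = σ -1ℤ

  correlation : ℕ → (F G : ℤ → ℤ) → ℤ → ℤ
  correlation v F G g = ∑ v (λ n → F (+ n + g) * G (+ n))

  -- Multiplication by `bar M` is correlation with the coefficients of M. For a monomial c y^k the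
  -- sum against δ picks out c E(k + g).
  act-bar : ∀ v .{{_ : ℕ.NonZero v}} M {E} → Periodic (+ v) E → ∀ g → act (bar M) E g ≡ correlation v E (act M (δ (+ v))) g
  act-bar v [] {E} per g = trans (cong (λ L → act L E g) (σ-[] -1ℤ)) (trans (act-[] E g) (sym (trans
    (∑-cong v λ n → trans (cong (E (+ n + g) *_) (act-[] (δ (+ v)) (+ n))) (ℤₚ.*-zeroʳ (E (+ n + g)))) (∑-0 v))))
  act-bar v ((c , k) ∷ M) {E} per g = begin
    act (bar ((c , k) ∷ M)) E g
      ≡⟨ cong (λ L → act L E g) (trans (cong bar (∷≡⊞ c k M)) (trans (σ-⊞ -1ℤ (mono c k) M) (cong (_⊞ bar M) (σ-mono -1ℤ c k)))) ⟩
    act (mono c (-1ℤ * k) ⊞ bar M) E g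
      ≡⟨ act-⊞ (mono c (-1ℤ * k)) (bar M) E g ⟩
    act (mono c (-1ℤ * k)) E g + act (bar M) E g
      ≡⟨ cong₂ _+_ (trans (act-mono c (-1ℤ * k) E g) (cong (λ x → c * E x) (eq₁ g k))) (act-bar v M per g) ⟩
    c * E (k + g) + correlation v E (act M (δ (+ v))) g
      ≡⟨ cong (λ x → c * x + correlation v E (act M (δ (+ v))) g) (∑-δ v {λ n → E (n + g)} (λ n → trans (cong E (eq₂ n (+ v) g)) (per (n + g))) k) ⟨
    c * ∑ v (λ n → E (+ n + g) * δ (+ v) (+ n - k)) + correlation v E (act M (δ (+ v))) g
      ≡⟨ cong (_+ correlation v E (act M (δ (+ v))) g) (∑-* v c (λ n → E (+ n + g) * δ (+ v) (+ n - k))) ⟨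
    ∑ v (λ n → c * (E (+ n + g) * δ (+ v) (+ n - k))) + correlation v E (act M (δ (+ v))) g
      ≡⟨ ∑-+ v (λ n → c * (E (+ n + g) * δ (+ v) (+ n - k))) (λ n → E (+ n + g) * act M (δ (+ v)) (+ n)) ⟨
    ∑ v (λ n → c * (E (+ n + g) * δ (+ v) (+ n - k)) + E (+ n + g) * act M (δ (+ v)) (+ n))
      ≡⟨ ∑-cong v (λ n → trans (eq₃ c (E (+ n + g)) (δ (+ v) (+ n - k)) (act M (δ (+ v)) (+ n)))
           (cong (E (+ n + g) *_) (sym (trans (cong (λ L → act L (δ (+ v)) (+ n)) (∷≡⊞ c k M))
             (trans (act-⊞ (mono c k) M (δ (+ v)) (+ n)) (cong (_+ act M (δ (+ v)) (+ n)) (act-mono c k (δ (+ v)) (+ n)))))))) ⟩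
    correlation v E (act ((c , k) ∷ M) (δ (+ v))) g ∎
    where
    open ≡-Reasoning
    eq₁ : ∀ g k → g - -1ℤ * k ≡ k + g
    eq₁ = solve-∀
    eq₂ : ∀ n v g → n + v + g ≡ n + g + v
    eq₂ = solve-∀
    eq₃ : ∀ c e d x → c * (e * d) + e * x ≡ e * (c * d + x)
    eq₃ = solve-∀

  bar-bar : ∀ L → bar (bar L) ≡ L
  bar-bar L = trans (σ-∘ -1ℤ -1ℤ L) (σ-1 L)

  σ-bar : ∀ u L → σ u (bar L) ≡ bar (σ u L)
  σ-bar u L = trans (σ-∘ u -1ℤ L) (trans (cong (λ t → σ t L) (ℤₚ.*-comm u -1ℤ)) (sym (σ-∘ -1ℤ u L)))

  norm-σ : ∀ u n L → norm u n (σ u L) ≡ σ u (norm u n L)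
  norm-σ u zero    L = sym (σ-const u 1ℤ)
  norm-σ u (suc n) L = trans (cong (λ x → σ u L ⊛ σ u x) (norm-σ u n L)) (sym (σ-⊛ u L (σ u (norm u n L))))

  ^-square : ∀ s n → s * s ≡ 1ℤ → s ^ n * s ^ n ≡ 1ℤ
  ^-square s n e = trans (sym (^-distrib-* s s n)) (trans (cong (_^ n) e) (ℤₚ.^-zeroˡ n))

  square≡1 : ∀ s → s * s ≡ 1ℤ → s ≡ 1ℤ ⊎ s ≡ -1ℤ
  square≡1 s e with ℤₚ.i*j≡0⇒i≡0∨j≡0 (s - 1ℤ) {s + 1ℤ} (trans (eq s) (ℤₚ.i≡j⇒i-j≡0 e))
    where
    eq : ∀ s → (s - 1ℤ) * (s + 1ℤ) ≡ s * s - 1ℤ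
    eq = solve-∀
  ... | inj₁ d = inj₁ (ℤₚ.i-j≡0⇒i≡j s 1ℤ d)
  ... | inj₂ d = inj₂ (ℤₚ.i-j≡0⇒i≡j s -1ℤ d)

  square≡1⇒≢0 : ∀ s → s * s ≡ 1ℤ → s ≢ 0ℤ
  square≡1⇒≢0 _ () refl

  bézout : ∀ {m n} → Coprime m n → ∃₂ λ x y → x * + m + y * + n ≡ 1ℤ
  bézout {m} {n} c with Coprimality.coprime-Bézout c
  ... | Bézout.+- x y eq = + x , - + y , trans (cong (λ t → t + - + y * + n) (trans (sym (ℤₚ.pos-* x m)) (trans (cong +_ (sym eq))
      (cong (λ t → 1ℤ + t) (ℤₚ.pos-* y n))))) (eq′ (+ y) (+ n))
    where
    eq′ : ∀ y n → 1ℤ + y * n + - y * n ≡ 1ℤ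
    eq′ = solve-∀
  ... | Bézout.-+ x y eq = - + x , + y , trans (cong (λ t → - + x * + m + t) (trans (sym (ℤₚ.pos-* y n)) (trans (cong +_ (sym eq))
      (cong (λ t → 1ℤ + t) (ℤₚ.pos-* x m))))) (eq′ (+ x) (+ m))
    where
    eq′ : ∀ y n → - y * n + (1ℤ + y * n) ≡ 1ℤ
    eq′ = solve-∀

  coprime-∣ : ∀ {m n k} → Coprime m n → + m ∣ + n * k → + m ∣ k
  coprime-∣ {m} {n} {k} c d = ∣ᵤ⇒∣ (coprime-divisor c (subst (m ℕ∣.∣_) (ℤₚ.abs-* (+ n) k) (∣⇒∣ᵤ d)))

  coprime-*∣ : ∀ {m n k} → Coprime m n → + m ∣ k → + n ∣ k → + m * + n ∣ k
  coprime-*∣ {m} {n} {k} c (divides x e) d with coprime-∣ {n} {m} {x} (Coprimality.sym c) (subst (+ n ∣_) (trans e (ℤₚ.*-comm x (+ m))) d)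
  ... | divides y f = divides y (trans e (trans (cong (_* + m) f) (eq y (+ n) (+ m))))
    where
    eq : ∀ y n m → y * n * m ≡ y * (m * n)
    eq = solve-∀

  module Multipliers (p b w : ℕ) (pr : Prime p) (2<p : 2 ℕ.< p) (p⊥w : Coprime p w) {{w≢0 : ℕ.NonZero w}} where
    open Cyclotomic p b w pr p⊥w

    coeff-periodic : ∀ L → Periodic (+ v) (coeff L)
    coeff-periodic L = act-periodic L (δ-self-periodic (+ v))

    coeff-⊛-bar : ∀ L M g → coeff (L ⊛ bar M) g ≡ correlation v (coeff L) (coeff M) g
    coeff-⊛-bar L M g = trans (act-⊛ L (bar M) (δ (+ v)) g) (trans (act-comm L (bar M) (δ (+ v)) g)
      (act-bar v M (coeff-periodic L) g))

    δ0 : δ (+ v) 0ℤ ≡ 1ℤ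
    δ0 = δ-yes (divides 0ℤ refl)

    z>0 : 0 ℕ.< z
    z>0 = ℕ.>-nonZero⁻¹ z

    v∤z : ¬ + v ∣ + z
    v∤z d = ℕ∣.>⇒∤ (ℕₚ.m<m*n z p (ℕₚ.<-trans (ℕₚ.n<1+n 1) 2<p)) (subst (ℕ∣._∣ z) (ℕₚ.*-comm p z) (∣⇒∣ᵤ d))

    v∤2z : ¬ + v ∣ + z + + z
    v∤2z d = ℕ∣.>⇒∤ {{ℕ.>-nonZero (ℕₚ.<-≤-trans z>0 (ℕₚ.m≤m+n z z))}}
      (ℕₚ.<-≤-trans (ℕₚ.≤-reflexive (cong (λ x → suc (z ℕ.+ x)) (sym (ℕₚ.+-identityʳ z)))) (ℕₚ.*-monoˡ-< z 2<p)) (∣⇒∣ᵤ d)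

    -- For F the coefficient function of U and D n = F (n + z) - F n, the sums Σ D(n)² = 2 and Σ D(n + z) D(n) = -1 leave no
    -- choice but D = ± (δ_g - δ_{g+z}).
    module _ (U : Laurent) (unit : U ⊛ bar U ≈ const 1ℤ) where
      private
        F D : ℤ → ℤ
        F = coeff U
        D n = F (n + + z) - F n
        C : ℤ → ℤ
        C = correlation v F F

        per-shift : ∀ {f k} → Periodic (+ v) f → Periodic (+ v) (λ n → f (n + k))
        per-shift {f} {k} per n = trans (cong f (eq n (+ v) k)) (per (n + k))
          where
          eq : ∀ n v k → n + v + k ≡ n + k + v
          eq = solve-∀

        F-per : Periodic (+ v) F
        F-per = coeff-periodic U

        D-per : Periodic (+ v) D
        D-per n = cong₂ _-_ (per-shift F-per n) (F-per n)

        gap-C : ∀ g → C (g + + z) - δ (+ v) (g + + z) ≡ C g - δ (+ v) g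
        gap-C g = trans (sym (eq (g + + z))) (trans (≈⇒periodic unit g) (eq g))
          where
          eq : ∀ g → gap (U ⊛ bar U) (const 1ℤ) g ≡ C g - δ (+ v) g
          eq g = cong₂ _-_ (coeff-⊛-bar U U g) (trans (act-const 1ℤ (δ (+ v)) g) (ℤₚ.*-identityˡ (δ (+ v) g)))

        C-z : C (+ z) ≡ C 0ℤ - 1ℤ
        C-z = trans (sym (ℤₚ.+-identityʳ (C (+ z)))) (trans (cong (λ x → C (+ z) - x) (sym (δ-no v∤z)))
          (trans (cong (λ x → C x - δ (+ v) x) (sym (ℤₚ.+-identityˡ (+ z)))) (trans (gap-C 0ℤ) (cong (λ x → C 0ℤ - x) δ0))))

        -- C - δ is z-periodic because U is unitary in S. As p > 2, neither z nor 2z is a multiple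
        -- of v, so C takes the same value at both; this makes Σ D(n + z) D(n) equal to -1.
        C-2z : C (+ z + + z) ≡ C (+ z)
        C-2z = trans (sym (ℤₚ.+-identityʳ (C (+ z + + z)))) (trans (cong (λ x → C (+ z + + z) - x) (sym (δ-no v∤2z)))
          (trans (gap-C (+ z)) (trans (cong (λ x → C (+ z) - x) (δ-no v∤z)) (ℤₚ.+-identityʳ (C (+ z))))))

        C-shift : ∀ g → ∑ v (λ n → F (+ n + + z + g) * F (+ n + + z)) ≡ C g
        C-shift g = ∑-translate v {λ n → F (n + g) * F n} (λ n → cong₂ _*_ (per-shift F-per n) (F-per n)) (+ z)

        ∑F² : ∑ v (λ n → F (+ n) * F (+ n)) ≡ C 0ℤ
        ∑F² = ∑-cong v λ n → cong (λ x → F x * F (+ n)) (sym (ℤₚ.+-identityʳ (+ n)))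

        ∑F²z : ∑ v (λ n → F (+ n + + z) * F (+ n + + z)) ≡ C 0ℤ
        ∑F²z = trans (∑-translate v {λ n → F n * F n} (λ n → cong₂ _*_ (F-per n) (F-per n)) (+ z)) ∑F²

        ∑D² : ∑ v (λ n → D (+ n) * D (+ n)) ≡ + 2
        ∑D² = begin
          ∑ v (λ n → D (+ n) * D (+ n))
            ≡⟨ ∑-cong v (λ n → eq₁ (F (+ n + + z)) (F (+ n))) ⟩
          ∑ v (λ n → F (+ n + + z) * F (+ n + + z) - F (+ n + + z) * F (+ n) - (F (+ n + + z) * F (+ n) - F (+ n) * F (+ n)))
            ≡⟨ ∑-- v (λ n → F (+ n + + z) * F (+ n + + z) - F (+ n + + z) * F (+ n)) (λ n → F (+ n + + z) * F (+ n) - F (+ n) * F (+ n)) ⟩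
          ∑ v (λ n → F (+ n + + z) * F (+ n + + z) - F (+ n + + z) * F (+ n)) - ∑ v (λ n → F (+ n + + z) * F (+ n) - F (+ n) * F (+ n))
            ≡⟨ cong₂ _-_ (∑-- v (λ n → F (+ n + + z) * F (+ n + + z)) (λ n → F (+ n + + z) * F (+ n)))
                         (∑-- v (λ n → F (+ n + + z) * F (+ n)) (λ n → F (+ n) * F (+ n))) ⟩
          _ ≡⟨ cong₂ (λ x y → x - C (+ z) - (C (+ z) - y)) ∑F²z ∑F² ⟩
          C 0ℤ - C (+ z) - (C (+ z) - C 0ℤ)
            ≡⟨ cong (λ x → C 0ℤ - x - (x - C 0ℤ)) C-z ⟩
          C 0ℤ - (C 0ℤ - 1ℤ) - (C 0ℤ - 1ℤ - C 0ℤ)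
            ≡⟨ eq₂ (C 0ℤ) ⟩
          + 2 ∎
          where
          open ≡-Reasoning
          eq₁ : ∀ a b → (a - b) * (a - b) ≡ a * a - a * b - (a * b - b * b)
          eq₁ = solve-∀
          eq₂ : ∀ c → c - (c - 1ℤ) - (c - 1ℤ - c) ≡ + 2
          eq₂ = solve-∀

        ∑DD : ∑ v (λ n → D (+ n + + z) * D (+ n)) ≡ -1ℤ
        ∑DD = begin
          ∑ v (λ n → D (+ n + + z) * D (+ n))
            ≡⟨ ∑-cong v (λ n → eq₁ (F (+ n + + z + + z)) (F (+ n + + z)) (F (+ n))) ⟩
          ∑ v (λ n → F (+ n + + z + + z) * F (+ n + + z) - F (+ n + + z + + z) * F (+ n) - (F (+ n + + z) * F (+ n + + z) - F (+ n + + z) * F (+ n)))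
            ≡⟨ ∑-- v (λ n → F (+ n + + z + + z) * F (+ n + + z) - F (+ n + + z + + z) * F (+ n)) (λ n → F (+ n + + z) * F (+ n + + z) - F (+ n + + z) * F (+ n)) ⟩
          ∑ v (λ n → F (+ n + + z + + z) * F (+ n + + z) - F (+ n + + z + + z) * F (+ n)) - ∑ v (λ n → F (+ n + + z) * F (+ n + + z) - F (+ n + + z) * F (+ n))
            ≡⟨ cong₂ _-_ (∑-- v (λ n → F (+ n + + z + + z) * F (+ n + + z)) (λ n → F (+ n + + z + + z) * F (+ n)))
                         (∑-- v (λ n → F (+ n + + z) * F (+ n + + z)) (λ n → F (+ n + + z) * F (+ n))) ⟩
          _ ≡⟨ cong₂ (λ x y → x - ∑ v (λ n → F (+ n + + z + + z) * F (+ n)) - (y - C (+ z))) (C-shift (+ z)) ∑F²z ⟩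
          C (+ z) - ∑ v (λ n → F (+ n + + z + + z) * F (+ n)) - (C 0ℤ - C (+ z))
            ≡⟨ cong (λ x → C (+ z) - x - (C 0ℤ - C (+ z))) (trans (∑-cong v λ n → cong (λ x → F x * F (+ n)) (ℤₚ.+-assoc (+ n) (+ z) (+ z))) C-2z) ⟩
          C (+ z) - C (+ z) - (C 0ℤ - C (+ z))
            ≡⟨ cong (λ x → x - x - (C 0ℤ - x)) C-z ⟩
          C 0ℤ - 1ℤ - (C 0ℤ - 1ℤ) - (C 0ℤ - (C 0ℤ - 1ℤ))
            ≡⟨ eq₂ (C 0ℤ) ⟩
          -1ℤ ∎
          where
          open ≡-Reasoning
          eq₁ : ∀ a b c → (a - b) * (b - c) ≡ a * b - a * c - (b * b - b * c)
          eq₁ = solve-∀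
          eq₂ : ∀ c → c - 1ℤ - (c - 1ℤ) - (c - (c - 1ℤ)) ≡ -1ℤ
          eq₂ = solve-∀

        module _ (g : ℤ) (neg : D (g + + z) * D g ℤ.< 0ℤ) where
          s : ℤ
          s = D g

          K Q : ℤ → ℤ
          K n = δ (+ v) (n - g) - δ (+ v) (n - (g + + z))
          Q n = D n - s * K n

          K-per : Periodic (+ v) K
          K-per n = cong₂ _-_ (δ-periodic (+ v) g n) (δ-periodic (+ v) (g + + z) n)

          K-g : K g ≡ 1ℤ
          K-g = cong₂ _-_ (trans (cong (δ (+ v)) (ℤₚ.+-inverseʳ g)) δ0)
            (δ-no λ d → v∤z (subst (+ v ∣_) (eq g (+ z)) (∣m⇒∣-m d)))
            where
            eq : ∀ g z → - (g - (g + z)) ≡ z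
            eq = solve-∀

          K-gz : K (g + + z) ≡ -1ℤ
          K-gz = cong₂ _-_ (δ-no λ d → v∤z (subst (+ v ∣_) (eq g (+ z)) d))
            (trans (cong (δ (+ v)) (ℤₚ.+-inverseʳ (g + + z))) δ0)
            where
            eq : ∀ g z → g + z - g ≡ z
            eq = solve-∀

          ∑*K : ∀ f → Periodic (+ v) f → ∑ v (λ n → f (+ n) * K (+ n)) ≡ f g - f (g + + z)
          ∑*K f per = trans (∑-cong v λ n → eq (f (+ n)) (δ (+ v) (+ n - g)) (δ (+ v) (+ n - (g + + z))))
            (trans (∑-- v (λ n → f (+ n) * δ (+ v) (+ n - g)) (λ n → f (+ n) * δ (+ v) (+ n - (g + + z))))
              (cong₂ _-_ (∑-δ v per g) (∑-δ v per (g + + z))))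
            where
            eq : ∀ f a b → f * (a - b) ≡ f * a - f * b
            eq = solve-∀

          -- K is the expected shape of D up to the factor s = D(g), and Q is the deviation from it.
          -- The terms in s² cancel since Σ D K = s - D(g + z) and Σ K² = 2. As D(g + z) s is a
          -- negative integer, the sum is at most 0, so Q = 0.
          ∑Q² : ∑ v (λ n → Q (+ n) * Q (+ n)) ≡ + 2 + + 2 * (D (g + + z) * s)
          ∑Q² = begin
            ∑ v (λ n → Q (+ n) * Q (+ n))
              ≡⟨ ∑-cong v (λ n → eq₁ (D (+ n)) s (K (+ n))) ⟩
            ∑ v (λ n → D (+ n) * D (+ n) - s * (+ 2 * (D (+ n) * K (+ n)) - s * (K (+ n) * K (+ n))))
              ≡⟨ ∑-- v (λ n → D (+ n) * D (+ n)) (λ n → s * (+ 2 * (D (+ n) * K (+ n)) - s * (K (+ n) * K (+ n)))) ⟩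
            ∑ v (λ n → D (+ n) * D (+ n)) - ∑ v (λ n → s * (+ 2 * (D (+ n) * K (+ n)) - s * (K (+ n) * K (+ n))))
              ≡⟨ cong₂ _-_ ∑D² (trans (∑-* v s (λ n → + 2 * (D (+ n) * K (+ n)) - s * (K (+ n) * K (+ n))))
                   (cong (s *_) (trans (∑-- v (λ n → + 2 * (D (+ n) * K (+ n))) (λ n → s * (K (+ n) * K (+ n))))
                     (cong₂ _-_ (trans (∑-* v (+ 2) (λ n → D (+ n) * K (+ n))) (cong (+ 2 *_) (∑*K D D-per)))
                                (trans (∑-* v s (λ n → K (+ n) * K (+ n))) (cong (s *_) (trans (∑*K K K-per) (cong₂ _-_ K-g K-gz)))))))) ⟩
            + 2 - s * (+ 2 * (s - D (g + + z)) - s * (+ 2))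
              ≡⟨ eq₂ s (D (g + + z)) ⟩
            + 2 + + 2 * (D (g + + z) * s) ∎
            where
            open ≡-Reasoning
            eq₁ : ∀ d s k → (d - s * k) * (d - s * k) ≡ d * d - s * (+ 2 * (d * k) - s * (k * k))
            eq₁ = solve-∀
            eq₂ : ∀ s d → + 2 - s * (+ 2 * (s - d) - s * (+ 2)) ≡ + 2 + + 2 * (d * s)
            eq₂ = solve-∀

          ∑Q²≤0 : ∑ v (λ n → Q (+ n) * Q (+ n)) ℤ.≤ 0ℤ
          ∑Q²≤0 = ℤₚ.≤-trans (ℤₚ.≤-reflexive ∑Q²) (ℤₚ.+-monoʳ-≤ (+ 2) {+ 2 * (D (g + + z) * s)} { - + 2} (ℤₚ.*-monoˡ-≤-nonNeg (+ 2) (ℤₚ.i<j⇒i≤pred[j] neg)))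

          Q≡0 : ∀ n → Q n ≡ 0ℤ
          Q≡0 = periodic-∀ v (λ n → cong₂ (λ x y → x - s * y) (D-per n) (K-per n))
            λ i i<v → square≡0 (Q (+ i)) (∑-nonneg-≤0 v (λ i → square≥0 (Q (+ i))) ∑Q²≤0 i i<v)

          D-gz : D (g + + z) ≡ - s
          D-gz = trans (ℤₚ.i-j≡0⇒i≡j (D (g + + z)) (s * K (g + + z)) (Q≡0 (g + + z))) (trans (cong (s *_) K-gz) (eq s))
            where
            eq : ∀ s → s * -1ℤ ≡ - s
            eq = solve-∀

          s²≡1 : s * s ≡ 1ℤ
          -- With Q = 0 and D(g + z) = -s, the value of Σ Q² reads 0 = 2 - 2 s².
          s²≡1 = ℤₚ.*-cancelˡ-≡ (+ 2) (s * s) 1ℤ (trans (eq s) (cong (λ x → + 2 - x) (trans (cong (λ x → + 2 + + 2 * (x * s)) (sym D-gz))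
              (trans (sym ∑Q²) (trans (∑-cong v (λ n → cong (λ x → x * x) (Q≡0 (+ n)))) (∑-0 v))))))
            where
            eq : ∀ s → + 2 * (s * s) ≡ + 2 - (+ 2 + + 2 * (- s * s))
            eq = solve-∀

          U≈mono : U ≈ mono s (g + + z)
          -- `Δ` translated by g + z is K, which is why the exponent is g + z and not g.
          U≈mono = mk λ _ n → trans (act-Δ U n) (trans (ℤₚ.i-j≡0⇒i≡j (D n) (s * K n) (Q≡0 n))
            (sym (trans (act-mono s (g + + z) Δ n) (cong (λ x → s * (δ (+ v) x - δ (+ v) (n - (g + + z)))) (eq n g (+ z))))))
            where
            eq : ∀ n g z → n - (g + z) + z ≡ n - g
            eq = solve-∀

      trivial-unit : ∃₂ λ s k → s * s ≡ 1ℤ × U ≈ mono s k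
      trivial-unit = from-index (∑-neg⇒∃neg v (λ n → D (+ n + + z) * D (+ n)) (ℤₚ.≤-<-trans (ℤₚ.≤-reflexive ∑DD) ℤ.-<+))
        where
        from-index : (∃ λ i → D (+ i + + z) * D (+ i) ℤ.< 0ℤ) → ∃₂ λ s k → s * s ≡ 1ℤ × U ≈ mono s k
        from-index (i , neg) = s (+ i) neg , + i + + z , s²≡1 (+ i) neg , U≈mono (+ i) neg

    -- Unless w divides 2, -1 is not 1 modulo w, so `σ-cong` does not cover `bar`. The gap is read
    -- at -g, and a period z remains a period there.
    bar-cong : ∀ {L M} → L ≈ M → bar L ≈ bar M
    bar-cong {L} {M} e = periodic⇒≈ λ g → trans (gap-bar (g + + z)) (trans (sym (≈⇒periodic e (- (g + + z))))
        (trans (cong (gap L M) (eq₃ g (+ z))) (sym (gap-bar g))))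
      where
      eq₁ : ∀ g k → - (g - -1ℤ * k) ≡ - g - k
      eq₁ = solve-∀
      eq₂ : ∀ g k → - (- g - k) ≡ g - -1ℤ * k
      eq₂ = solve-∀
      eq₃ : ∀ g z → - (g + z) + z ≡ - g
      eq₃ = solve-∀
      coeff-bar : ∀ K g → coeff (bar K) g ≡ coeff K (- g)
      coeff-bar K g = act-σ (λ k → δ-iff (λ d → subst (+ v ∣_) (eq₁ g k) (∣m⇒∣-m d)) (λ d → subst (+ v ∣_) (eq₂ g k) (∣m⇒∣-m d))) K
      gap-bar : ∀ g → gap (bar L) (bar M) g ≡ gap L M (- g)
      gap-bar g = cong₂ _-_ (coeff-bar L g) (coeff-bar M g)

    ⊛-mono-assoc : ∀ s k t l L → mono s k ⊛ (mono t l ⊛ L) ≈ mono (s * t) (k + l) ⊛ L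
    ⊛-mono-assoc s k t l L = ≈-trans (≈-sym (⊛-assoc (mono s k) (mono t l) L)) (⊛-cong (≡⇒≈ (mono-⊛ s k t l)) (≈-refl {L}))

    Δ-0 : Δ 0ℤ ≡ -1ℤ
    Δ-0 = cong₂ _-_ (trans (cong (δ (+ v)) (ℤₚ.+-identityˡ (+ z))) (δ-no v∤z)) δ0

    -- Modulo v, `Δ` is -1 at 0, 1 at -z and 0 elsewhere. Evaluation at l decides everything except
    -- the case l - k ≡ -z, where both sides are nonzero; there evaluation at l + z gives -s on one
    -- side and 0 on the other, because v does not divide 2z.
    mono-injective : ∀ {s k t l} → s * s ≡ 1ℤ → t * t ≡ 1ℤ → mono s k ≈ mono t l → s ≡ t × + v ∣ l - k
    mono-injective {s} {k} {t} {l} ss tt′ e with + v ∣? (l - k) | + v ∣? (l - k + + z)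
    ... | yes d | _ = s≡t , d
      where
      Δ≡-1 : Δ (l - k) ≡ -1ℤ
      Δ≡-1 = cong₂ _-_ (δ-no λ d′ → v∤z (∣m+n∣m⇒∣n d′ d)) (δ-yes d)
      s≡t : s ≡ t
      s≡t = ℤₚ.neg-injective (trans (trans (eq s) (cong (s *_) (sym Δ≡-1))) (trans at-l (trans (cong (t *_) Δ-0) (sym (eq t)))))
        where
        eq : ∀ s → - s ≡ s * -1ℤ
        eq = solve-∀
        at-l : s * Δ (l - k) ≡ t * Δ 0ℤ
        at-l = trans (trans (sym (act-mono s k Δ l)) (trans (at e tt l) (act-mono t l Δ l))) (cong (λ x → t * Δ x) (ℤₚ.+-inverseʳ l))
    ... | no ¬d | yes d = contradiction s≡0 (square≡1⇒≢0 s ss)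
      where
      eq₁ : ∀ l k z → l + z - k ≡ l - k + z
      eq₁ = solve-∀
      eq₂ : ∀ l z → l + z - l ≡ z
      eq₂ = solve-∀
      eq₃ : ∀ s → s ≡ - (s * -1ℤ)
      eq₃ = solve-∀
      eq₄ : ∀ t → - (t * (0ℤ - 0ℤ)) ≡ 0ℤ
      eq₄ = solve-∀
      Δ≡-1 : Δ (l + + z - k) ≡ -1ℤ
      Δ≡-1 = trans (cong Δ (eq₁ l k (+ z))) (cong₂ _-_ (δ-no λ d′ → v∤z (∣m+n∣m⇒∣n d′ d)) (δ-yes d))
      s≡0 : s ≡ 0ℤ
      s≡0 = trans (eq₃ s) (trans (cong -_ (trans (cong (s *_) (sym Δ≡-1)) (trans (sym (act-mono s k Δ (l + + z)))
        (trans (at e tt (l + + z)) (trans (act-mono t l Δ (l + + z)) (trans (cong (λ x → t * Δ x) (eq₂ l (+ z)))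
          (cong (t *_) (cong₂ _-_ (δ-no v∤2z) (δ-no v∤z))))))))) (eq₄ t))
    ... | no ¬d | no ¬d′ = contradiction t≡0 (square≡1⇒≢0 t tt′)
      where
      eq₃ : ∀ s → s ≡ - (s * -1ℤ)
      eq₃ = solve-∀
      eq₄ : ∀ t → - (t * (0ℤ - 0ℤ)) ≡ 0ℤ
      eq₄ = solve-∀
      t≡0 : t ≡ 0ℤ
      t≡0 = trans (eq₃ t) (trans (cong -_ (trans (cong (t *_) (sym Δ-0)) (trans (cong (λ x → t * Δ x) (sym (ℤₚ.+-inverseʳ l)))
        (trans (sym (act-mono t l Δ l)) (trans (sym (at e tt l)) (trans (act-mono s k Δ l)
          (cong (s *_) (cong₂ _-_ (δ-no ¬d′) (δ-no ¬d))))))))) (eq₄ s))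

    -- Multipliers of an element of weight p^n

    module _ (n : ℕ) where
      private
        m : ℤ
        m = (+ p) ^ n
        instance
          m≢0 : ℤ.NonZero m
          m≢0 = ^≢0 (+ p) n

      module _ {u : ℤ} {r : ℕ} (gal : Galois u r) (X : Laurent) (weight : X ⊛ bar X ≈ const m) where

        private
          Z : Laurent
          Z = σ u X ⊛ bar X

          -- X divides m, so its norm is fixed by σ and is also the norm of σ(X). Hence Z has the
          -- same norm as X X̄ = m.
          norm-Z : norm u (suc r) Z ≈ const (m ^ suc r) ⊛ const 1ℤ
          norm-Z = ≈-trans (norm-⊛ gal (suc r) (σ u X) (bar X))
            (≈-trans (⊛-cong (≈-trans (≡⇒≈ (norm-σ u (suc r) X)) (σ-norm gal m weight)) (≈-refl {norm u (suc r) (bar X)}))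
            (≈-trans (≈-sym (norm-⊛ gal (suc r) X (bar X))) (≈-trans (norm-cong gal (suc r) weight)
            (≈-trans (≡⇒≈ (norm-const gal (suc r) m)) (≈-trans (≈-sym (⊛-identityˡ _)) (⊛-comm (const 1ℤ) (const (m ^ suc r))))))))

          module _ (ε : Laurent) (Z≈ : Z ≈ const m ⊛ ε) where
            -- m² ε ε̄ = Z Z̄ = σ(X X̄) X̄ X = m².
            ε-unit : ε ⊛ bar ε ≈ const 1ℤ
            ε-unit = const-cancel m (const-cancel m (≈-trans (≈-trans (≈-sym (⊛-assoc (const m) (const m) (ε ⊛ bar ε))) (≈-trans
                (⊛-interchange (const m) (const m) ε (bar ε))
                (≈-trans (⊛-cong (≈-refl {const m ⊛ ε}) (⊛-cong (≡⇒≈ (sym (σ-const -1ℤ m))) (≈-refl {bar ε})))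
                (≈-trans (⊛-cong (≈-sym Z≈) (≈-trans (≡⇒≈ (sym (σ-⊛ -1ℤ (const m) ε))) (bar-cong (≈-sym Z≈))))
                (≈-trans (⊛-cong (≈-refl {Z}) (≡⇒≈ (trans (σ-⊛ -1ℤ (σ u X) (bar X)) (cong (λ x → bar (σ u X) ⊛ x) (bar-bar X)))))
                (≈-trans (⊛-interchange (σ u X) (bar X) (bar (σ u X)) X)
                  (⊛-cong (≈-trans (≡⇒≈ (trans (cong (σ u X ⊛_) (sym (σ-bar u X))) (sym (σ-⊛ u X (bar X)))))
                      (≈-trans (σ-cong gal weight) (≡⇒≈ (σ-const u m))))
                    (≈-trans (⊛-comm (bar X) X) weight))))))))
              (⊛-cong (≈-refl {const m}) (≈-trans (≈-sym (⊛-identityˡ (const m))) (⊛-comm (const 1ℤ) (const m))))))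

            σX≈ : σ u X ≈ ε ⊛ X
            σX≈ = divisor-cancel m weight (≈-trans (⊛-comm X (σ u X)) (≈-sym rest))
              where
              rest : X ⊛ (ε ⊛ X) ≈ σ u X ⊛ X
              rest = const-cancel m (≈-trans (≈-trans (⊛-swap (const m) X (ε ⊛ X)) (⊛-cong (≈-refl {X}) (≈-sym (⊛-assoc (const m) ε X))))
                (≈-trans (⊛-cong (≈-refl {X}) (⊛-cong (≈-sym Z≈) (≈-refl {X})))
                (≈-trans (⊛-swap X Z X) (≈-trans (⊛-interchange (σ u X) (bar X) X X)
                  (≈-trans (⊛-comm (σ u X ⊛ X) (bar X ⊛ X)) (⊛-cong (≈-trans (⊛-comm (bar X) X) weight) (≈-refl {σ u X ⊛ X})))))))

        multiplier : ∃₂ λ s k → s * s ≡ 1ℤ × σ u X ≈ mono s k ⊛ X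
        multiplier = go (norm-pⁿ∣⇒pⁿ∣ gal n norm-Z)
          where
          go : (∃ λ ε → Z ≈ const m ⊛ ε) → ∃₂ λ s k → s * s ≡ 1ℤ × σ u X ≈ mono s k ⊛ X
          go (ε , Z≈) = go′ (trivial-unit ε (ε-unit ε Z≈))
            where
            go′ : (∃₂ λ s k → s * s ≡ 1ℤ × ε ≈ mono s k) → ∃₂ λ s k → s * s ≡ 1ℤ × σ u X ≈ mono s k ⊛ X
            go′ (s , k , ss , e) = s , k , ss , ≈-trans (σX≈ ε Z≈) (⊛-cong e (≈-refl {X}))

        mono-cancel : ∀ {A B} → A ⊛ X ≈ B ⊛ X → A ≈ B
        mono-cancel {A} {B} e = divisor-cancel m weight (≈-trans (⊛-comm X A) (≈-trans e (⊛-comm B X)))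

        -- The translation part of a multiplier lies in the p-part, by restriction of the cocycle to the part of order w.
        w∣shift : Coprime w (suc r) → ∀ {s k} → s * s ≡ 1ℤ → σ u X ≈ mono s k ⊛ X → + w ∣ k
        w∣shift w⊥r {s} {k} ss e = coprime-∣ w⊥r (subst (+ w ∣_) (eq₄ k (geo (suc r)) (+ suc r))
            (∣m∣n⇒∣m-n w∣kgeo (∣n⇒∣m*n k (geo≡ (suc r)))))
          where
          open Galois gal
          -- `geo n` is 1 + u + ... + u^(n-1), the factor of k in the exponent after n applications
          -- of σ(X) = s y^k X. It is n modulo w, so n = `suc r` gives w ∣ k (r + 1).
          geo : ℕ → ℤ
          geo zero    = 0ℤ
          geo (suc n) = 1ℤ + u * geo n
          eq₁ : ∀ u k x → u * (k * x) + k ≡ k * (1ℤ + u * x)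
          eq₁ = solve-∀
          eq₂ : ∀ u n x → 1ℤ + u * x - (1ℤ + n) ≡ x * (u - 1ℤ) + (x - n)
          eq₂ = solve-∀
          eq₄ : ∀ k x n → k * x - k * (x - n) ≡ n * k
          eq₄ = solve-∀
          geo≡ : ∀ n → + w ∣ geo n - + n
          geo≡ zero    = divides 0ℤ refl
          geo≡ (suc n) = subst (+ w ∣_) (sym (eq₂ u (+ n) (geo n))) (∣m∣n⇒∣m+n (∣n⇒∣m*n (geo n) u≡1) (geo≡ n))
          σⁿ : ∀ n → σ (u ^ n) X ≈ mono (s ^ n) (k * geo n) ⊛ X
          σⁿ zero    = ≈-trans (≡⇒≈ (σ-1 X)) (≈-trans (≈-sym (⊛-identityˡ X)) (≡⇒≈ (cong (λ x → mono 1ℤ x ⊛ X) (sym (ℤₚ.*-zeroʳ k)))))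
          σⁿ (suc n) = ≈-trans (≡⇒≈ (sym (σ-∘ u (u ^ n) X))) (≈-trans (σ-cong gal (σⁿ n))
            (≈-trans (≡⇒≈ (trans (σ-⊛ u (mono (s ^ n) (k * geo n)) X) (cong (_⊛ σ u X) (σ-mono u (s ^ n) (k * geo n)))))
            (≈-trans (⊛-cong (≈-refl {mono (s ^ n) (u * (k * geo n))}) e)
            (≈-trans (⊛-mono-assoc (s ^ n) (u * (k * geo n)) s k X)
              (≡⇒≈ (cong₂ (λ x y → mono x y ⊛ X) (ℤₚ.*-comm (s ^ n) s) (eq₁ u k (geo n))))))))
          v∣ : + v ∣ 0ℤ - k * geo (suc r)
          v∣ = proj₂ (mono-injective (^-square s (suc r) ss) refl
            (mono-cancel (≈-trans (≈-sym (σⁿ (suc r))) (≈-trans (σ-order gal X) (≈-sym (⊛-identityˡ X))))))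
          w∣v : + w ∣ + v
          w∣v = divides (+ (p ℕ.* p ℕ.^ b)) (trans (cong +_ (sym (ℕₚ.*-assoc p (p ℕ.^ b) w))) (ℤₚ.pos-* (p ℕ.* p ℕ.^ b) w))
          w∣kgeo : + w ∣ k * geo (suc r)
          w∣kgeo = subst (+ w ∣_) (eq₅ (k * geo (suc r))) (∣m⇒∣-m (∣-trans w∣v v∣))
            where
            eq₅ : ∀ x → - (0ℤ - x) ≡ x
            eq₅ = solve-∀

  -- Translating X so that multipliers only change its sign

  module Symmetry (p b w : ℕ) (pr : Prime p) (2<p : 2 ℕ.< p) (p⊥w : Coprime p w) (w⊥p-1 : Coprime w (p ∸ 1)) {{w≢0 : ℕ.NonZero w}} where
    open Cyclotomic p b w pr p⊥w
    open Multipliers p b w pr 2<p p⊥w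

    totient : ℕ
    totient = p ℕ.^ b ℕ.* (p ∸ 1)

    R : ℕ
    R = ℕ.pred totient

    p-1≢0 : ℕ.NonZero (p ∸ 1)
    p-1≢0 = ℕ.>-nonZero (ℕₚ.m<n⇒0<n∸m (ℕₚ.<-trans (ℕₚ.n<1+n 1) 2<p))

    sucR : suc R ≡ totient
    sucR = ℕₚ.suc-pred totient {{ℕₚ.m*n≢0 (p ℕ.^ b) (p ∸ 1) {{q≢0}} {{p-1≢0}}}}

    p^n⊥w : ∀ n → Coprime (p ℕ.^ n) w
    p^n⊥w zero    (d∣1 , _)  = ℕ∣.∣1⇒≡1 d∣1
    p^n⊥w (suc n) {d} (d∣p*pⁿ , d∣w) = p^n⊥w n (coprime-divisor (λ (e , f) → p⊥w (f , ℕ∣.∣-trans e d∣w)) d∣p*pⁿ , d∣w)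

    -- The exponent p^b (p - 1) is prime to w, by gcd(p - 1 , w) = 1. This is what forces the shift
    -- of each multiplier to be a multiple of w.
    w⊥R : Coprime w (suc R)
    w⊥R {d} (d∣w , d∣R) = w⊥p-1 (d∣w , coprime-divisor (λ (e , f) → p^n⊥w b (f , ℕ∣.∣-trans e d∣w)) (subst (d ℕ∣.∣_) sucR d∣R))

    p∤2 : ¬ + p ∣ + 2
    p∤2 d = ℕ∣.>⇒∤ 2<p (∣⇒∣ᵤ d)

    pᵇw : + v ≡ + (p ℕ.^ suc b) * + w
    pᵇw = trans (cong +_ (sym (ℕₚ.*-assoc p (p ℕ.^ b) w))) (ℤₚ.pos-* (p ℕ.^ suc b) w)

    -- Euler's theorem gives the order condition modulo p^(b+1), u ≡ 1 gives it modulo w, and these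
    -- moduli are coprime.
    galois : ∀ {u} → + w ∣ u - 1ℤ → ¬ + p ∣ u → Galois u R
    galois {u} w∣ p∤u = record { u≡1 = w∣ ; order = subst (_∣ u ^ suc R - 1ℤ) (sym pᵇw)
        (coprime-*∣ (p^n⊥w (suc b)) (subst (λ n → + (p ℕ.^ suc b) ∣ u ^ n - 1ℤ) (sym sucR) (∤⇒euler pr b p∤u)) (powers (suc R))) }
      where
      eq : ∀ u x → u * x - 1ℤ ≡ u * (x - 1ℤ) + (u - 1ℤ)
      eq = solve-∀
      powers : ∀ n → + w ∣ u ^ n - 1ℤ
      powers zero    = divides 0ℤ refl
      powers (suc n) = subst (+ w ∣_) (sym (eq u (u ^ n))) (∣m∣n⇒∣m+n (∣n⇒∣m*n u (powers n)) w∣)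

    module _ (n : ℕ) (X : Laurent) (weight : X ⊛ bar X ≈ const ((+ p) ^ n)) where

      translate-weight : ∀ k → (y^ k ⊛ X) ⊛ bar (y^ k ⊛ X) ≈ const ((+ p) ^ n)
      translate-weight k = ≈-trans (⊛-cong (≈-refl {y^ k ⊛ X}) (≡⇒≈ (trans (σ-⊛ -1ℤ (y^ k) X) (cong (_⊛ bar X) (σ-mono -1ℤ 1ℤ k)))))
        (≈-trans (⊛-interchange (y^ k) X (y^ (-1ℤ * k)) (bar X)) (≈-trans (⊛-cong (≡⇒≈ (trans (mono-⊛ 1ℤ k 1ℤ (-1ℤ * k))
          (cong y^ (eq k)))) weight) (⊛-identityˡ _)))
        where
        eq : ∀ k → k + -1ℤ * k ≡ 0ℤ
        eq = solve-∀

      -- u₀ - 1 = η w is invertible modulo p, so translating X kills the shift of the multiplier u₀; all others commute with u₀.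
      module _ (η : ℤ) (ηη : η * η ≡ 1ℤ) (p∤u₀ : ¬ + p ∣ 1ℤ + η * + w) where
        private
          u₀ : ℤ
          u₀ = 1ℤ + η * + w

          w∣u₀-1 : + w ∣ u₀ - 1ℤ
          w∣u₀-1 = divides η (eq (η * + w))
            where
            eq : ∀ x → 1ℤ + x - 1ℤ ≡ x
            eq = solve-∀

          gal₀ : Galois u₀ R
          gal₀ = galois w∣u₀-1 p∤u₀

        centre : ∃₂ λ k s → s * s ≡ 1ℤ × σ u₀ (y^ k ⊛ X) ≈ const s ⊛ (y^ k ⊛ X)
        centre = go (multiplier n gal₀ X weight)
          where
          go : (∃₂ λ s k → s * s ≡ 1ℤ × σ u₀ X ≈ mono s k ⊛ X) → ∃₂ λ k s → s * s ≡ 1ℤ × σ u₀ (y^ k ⊛ X) ≈ const s ⊛ (y^ k ⊛ X)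
          go (s , k , ss , e) = go′ (w∣shift n gal₀ X weight w⊥R ss e)
            where
            go′ : + w ∣ k → ∃₂ λ k s → s * s ≡ 1ℤ × σ u₀ (y^ k ⊛ X) ≈ const s ⊛ (y^ k ⊛ X)
            go′ (divides j k≡) = l , s , ss , ≈-trans (≡⇒≈ (trans (σ-⊛ u₀ (y^ l) X) (cong (_⊛ σ u₀ X) (σ-mono u₀ 1ℤ l))))
                (≈-trans (⊛-cong (≈-refl {mono 1ℤ (u₀ * l)}) e) (≈-trans (⊛-mono-assoc 1ℤ (u₀ * l) s k X)
                (≈-trans (≡⇒≈ (cong₂ (λ x y → mono x y ⊛ X) (trans (ℤₚ.*-identityˡ s) (sym (ℤₚ.*-identityʳ s))) shift))
                  (≈-sym (⊛-mono-assoc s 0ℤ 1ℤ l X)))))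
              where
              -- The translation must satisfy (u₀ - 1) l = -k, that is, η w l = -j w; since η² = 1,
              -- the solution is l = -η j.
              l = - η * j
              eq₁ : ∀ η w j → (1ℤ + η * w) * (- η * j) + j * w ≡ 0ℤ + - η * j + j * w * (1ℤ - η * η)
              eq₁ = solve-∀
              eq₂ : ∀ x → x * (1ℤ - 1ℤ) ≡ 0ℤ
              eq₂ = solve-∀
              shift : u₀ * l + k ≡ 0ℤ + l
              shift = trans (ℤ-+-congˡ (u₀ * l) k≡) (trans (eq₁ η (+ w) j) (trans (ℤ-+-congˡ (0ℤ + l) (trans (cong (λ x → j * + w * (1ℤ - x)) ηη)
                (eq₂ (j * + w)))) (ℤₚ.+-identityʳ (0ℤ + l))))

        module _ (k s : ℤ) (ss : s * s ≡ 1ℤ) (fixed₀ : σ u₀ (y^ k ⊛ X) ≈ const s ⊛ (y^ k ⊛ X)) where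
          private
            Y : Laurent
            Y = y^ k ⊛ X

            weightY : Y ⊛ bar Y ≈ const ((+ p) ^ n)
            weightY = translate-weight k

          -- Computing σ_u σ_(u₀) Y in both orders gives (u₀ - 1) l ≡ 0 modulo v. As u₀ - 1 = η w
          -- with w prime to p, p^(b+1) divides l; `w∣shift` supplies the factor w, so y^l = 1.
          signed : ∀ {u} → + w ∣ u - 1ℤ → ¬ + p ∣ u → ∃ λ t → t * t ≡ 1ℤ × σ u Y ≈ const t ⊛ Y
          signed {u} w∣ p∤u = go (multiplier n gal Y weightY)
            where
            gal : Galois u R
            gal = galois w∣ p∤u
            go : (∃₂ λ t l → t * t ≡ 1ℤ × σ u Y ≈ mono t l ⊛ Y) → ∃ λ t → t * t ≡ 1ℤ × σ u Y ≈ const t ⊛ Y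
            go (t , l , tt′ , e) = t , tt′ , ≈-trans e (⊛-cong mono≈const (≈-refl {Y}))
              where
              st : (s * t) * (s * t) ≡ 1ℤ
              st = trans (eq s t) (cong₂ _*_ ss tt′)
                where
                eq : ∀ s t → (s * t) * (s * t) ≡ (s * s) * (t * t)
                eq = solve-∀
              one : σ u₀ (σ u Y) ≈ mono (t * s) (u₀ * l + 0ℤ) ⊛ Y
              one = ≈-trans (σ-cong gal₀ e) (≈-trans (≡⇒≈ (trans (σ-⊛ u₀ (mono t l) Y) (cong (_⊛ σ u₀ Y) (σ-mono u₀ t l))))
                (≈-trans (⊛-cong (≈-refl {mono t (u₀ * l)}) fixed₀) (⊛-mono-assoc t (u₀ * l) s 0ℤ Y)))
              two : σ u (σ u₀ Y) ≈ mono (s * t) (0ℤ + l) ⊛ Y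
              two = ≈-trans (σ-cong gal fixed₀) (≈-trans (≡⇒≈ (trans (σ-⊛ u (const s) Y) (cong (_⊛ σ u Y) (σ-const u s))))
                (≈-trans (⊛-cong (≈-refl {const s}) e) (⊛-mono-assoc s 0ℤ t l Y)))
              v∣ : + v ∣ u₀ * l + 0ℤ - (0ℤ + l)
              v∣ = proj₂ (mono-injective st (trans (cong₂ _*_ (ℤₚ.*-comm t s) (ℤₚ.*-comm t s)) st)
                (mono-cancel n gal Y weightY (≈-trans (≈-sym two) (≈-trans (≡⇒≈ (trans (σ-∘ u u₀ Y) (trans (cong (λ x → σ x Y) (ℤₚ.*-comm u u₀))
                  (sym (σ-∘ u₀ u Y))))) one))))
              p∣l : + (p ℕ.^ suc b) ∣ l
              p∣l = coprime-∣ (p^n⊥w (suc b)) (subst (+ (p ℕ.^ suc b) ∣_) (trans (eq₁ η (+ w) l) (trans (cong (_* (+ w * l)) ηη) (ℤₚ.*-identityˡ (+ w * l))))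
                  (∣n⇒∣m*n η (∣-trans (divides (+ w) (trans pᵇw (ℤₚ.*-comm (+ (p ℕ.^ suc b)) (+ w)))) v∣)))
                where
                eq₁ : ∀ η w l → η * ((1ℤ + η * w) * l + 0ℤ - (0ℤ + l)) ≡ η * η * (w * l)
                eq₁ = solve-∀
              v∣l : + v ∣ l
              v∣l = subst (_∣ l) (sym pᵇw) (coprime-*∣ (p^n⊥w (suc b)) p∣l (w∣shift n gal Y weightY w⊥R tt′ e))
              mono≈const : mono t l ≈ const t
              mono≈const = coeff⇒≈ λ g → trans (act-mono t l (δ (+ v)) g) (trans (cong (t *_) (δ-cong (g - l) g
                (subst (+ v ∣_) (eq g l) (∣m⇒∣-m v∣l)))) (sym (act-const t (δ (+ v)) g)))
                where
                eq : ∀ g l → - l ≡ g - l - g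
                eq = solve-∀

      -- 1 + w and 1 - w add up to 2, so the odd prime p fails to divide one of them, and that one
      -- serves as u₀.
      translate-signed : ∃ λ k → ∀ {u} → + w ∣ u - 1ℤ → ¬ + p ∣ u → ∃ λ t → t * t ≡ 1ℤ × σ u (y^ k ⊛ X) ≈ const t ⊛ (y^ k ⊛ X)
      translate-signed = choose (+ p ∣? (1ℤ + 1ℤ * + w)) (+ p ∣? (1ℤ + -1ℤ * + w))
        where
        Goal : Set
        Goal = ∃ λ k → ∀ {u} → + w ∣ u - 1ℤ → ¬ + p ∣ u → ∃ λ t → t * t ≡ 1ℤ × σ u (y^ k ⊛ X) ≈ const t ⊛ (y^ k ⊛ X)
        finish : ∀ η → η * η ≡ 1ℤ → ¬ + p ∣ 1ℤ + η * + w → Goal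
        finish η ηη p∤ = go (centre η ηη p∤)
          where
          go : (∃₂ λ k s → s * s ≡ 1ℤ × σ (1ℤ + η * + w) (y^ k ⊛ X) ≈ const s ⊛ (y^ k ⊛ X)) → Goal
          go (k , s , ss , e) = k , signed η ηη p∤ k s ss e
        eq : ∀ w → 1ℤ + 1ℤ * w + (1ℤ + -1ℤ * w) ≡ + 2
        eq = solve-∀
        choose : Dec (+ p ∣ 1ℤ + 1ℤ * + w) → Dec (+ p ∣ 1ℤ + -1ℤ * + w) → Goal
        choose (no p∤)  _        = finish 1ℤ refl p∤
        choose (yes _)  (no p∤)  = finish -1ℤ refl p∤
        choose (yes d₁) (yes d₂) = contradiction (subst (+ p ∣_) (eq (+ w)) (∣m∣n⇒∣m+n d₁ d₂)) p∤2

  -- The signs of the multipliers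

  module Signs (p b w : ℕ) (pr : Prime p) (2<p : 2 ℕ.< p) (p⊥w : Coprime p w) (w⊥p-1 : Coprime w (p ∸ 1)) {{w≢0 : ℕ.NonZero w}} where
    module S = Cyclotomic p b w pr p⊥w
    open Symmetry p b w pr 2<p p⊥w w⊥p-1 using (p∤2; galois; R)

    p⊥1 : Coprime p 1
    p⊥1 (_ , d∣1) = ℕ∣.∣1⇒≡1 d∣1

    -- The trivial character of C_w maps S onto T = ℤ[ζ].
    module T = Cyclotomic p b 1 pr p⊥1

    -- The gap in ℤ[C_(p^(b+1))] is a fibre sum of the gap in ℤ[C_v], so it inherits the period p^b
    -- w. It also has period p^(b+1), and by Bézout the greatest common divisor p^b of the two is
    -- the period that equality in T demands.
    project : ∀ {L M} → L S.≈ M → L T.≈ M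
    project {L} {M} e = T.periodic⇒≈ λ g → per (bézout p⊥w) g
      where
      w*v : w ℕ.* T.v ≡ S.v
      w*v = trans (cong (λ x → w ℕ.* (p ℕ.* x)) (ℕₚ.*-identityʳ (p ℕ.^ b))) (trans (ℕₚ.*-comm w (p ℕ.* p ℕ.^ b)) (ℕₚ.*-assoc p (p ℕ.^ b) w))
      coeff≡∑ : ∀ K g → T.coeff K g ≡ ∑ w (λ j → S.coeff K (g - + j * + T.v))
      coeff≡∑ K g = trans (act-δ-fold w T.v {{w≢0}} {{T.v≢0}} K g) (∑-cong w λ j → cong (λ x → act K (δ (+ x)) (g - + j * + T.v)) w*v)
      gap≡∑ : ∀ g → T.gap L M g ≡ ∑ w (λ j → S.gap L M (g - + j * + T.v))
      gap≡∑ g = trans (cong₂ _-_ (coeff≡∑ L g) (coeff≡∑ M g))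
        (sym (∑-- w (λ j → S.coeff L (g - + j * + T.v)) (λ j → S.coeff M (g - + j * + T.v))))
      per-z : Periodic (+ S.z) (T.gap L M)
      per-z g = trans (gap≡∑ (g + + S.z)) (trans (∑-cong w λ j → trans (cong (S.gap L M) (eq g (+ S.z) (+ j * + T.v)))
          (S.≈⇒periodic e (g - + j * + T.v))) (sym (gap≡∑ g)))
        where
        eq : ∀ g z x → g + z - x ≡ g - x + z
        eq = solve-∀
      per-v : Periodic (+ T.v) (T.gap L M)
      per-v g = cong₂ _-_ (act-periodic L (δ-self-periodic (+ T.v)) g) (act-periodic M (δ-self-periodic (+ T.v)) g)
      per : (∃₂ λ x y → x * + p + y * + w ≡ 1ℤ) → Periodic (+ T.z) (T.gap L M)
      per (x , y , xy) g = trans (cong (λ t → T.gap L M (g + t)) split) (trans (cong (T.gap L M) (sym (ℤₚ.+-assoc g (y * + S.z) (x * + T.v))))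
        (trans (periodic-* {T.gap L M} per-v x (g + y * + S.z)) (periodic-* {T.gap L M} per-z y g)))
        where
        eq : ∀ x y p w q → q * (x * p + y * w) ≡ y * (q * w) + x * (p * q)
        eq = solve-∀
        Q = p ℕ.^ b
        split : + T.z ≡ y * + S.z + x * + T.v
        split = trans (cong +_ (ℕₚ.*-identityʳ Q)) (trans (sym (ℤₚ.*-identityʳ (+ Q))) (trans (cong (+ Q *_) (sym xy))
          (trans (eq x y (+ p) (+ w) (+ Q)) (cong₂ (λ s t → y * s + x * t) (sym (ℤₚ.pos-* Q w))
            (trans (sym (ℤₚ.pos-* p Q)) (cong (λ t → + (p ℕ.* t)) (sym (ℕₚ.*-identityʳ Q))))))))

    1∣ : ∀ x → 1ℤ ∣ x
    1∣ x = divides x (sym (ℤₚ.*-identityʳ x))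

    -- With w = 1 every u is congruent to 1, so complex conjugation qualifies, with order 2. This
    -- makes Y Ȳ a norm in T.
    conjugation : T.Galois -1ℤ 1
    conjugation = record { u≡1 = 1∣ _ ; order = divides 0ℤ refl }

    augmentation : Laurent → ℤ
    augmentation L = act L (δ 1ℤ) 0ℤ

    augmentation-const : ∀ t → augmentation (const t) ≡ t
    augmentation-const t = trans (act-const t (δ 1ℤ) 0ℤ) (ℤₚ.*-identityʳ t)

    module _ (e : ℕ) (Y : Laurent) (weight : Y ⊛ bar Y S.≈ const ((+ p) ^ (e ℕ.* 2))) where
      private
        m : ℤ
        m = (+ p) ^ e

        instance
          m≢0 : ℤ.NonZero m
          m≢0 = ^≢0 (+ p) e

        m² : (+ p) ^ (e ℕ.* 2) ≡ m ^ 2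
        m² = sym (ℤₚ.^-*-assoc (+ p) e 2)

        weightT : Y ⊛ bar Y T.≈ const (m ^ 2)
        weightT = T.≈-trans (project weight) (T.≡⇒≈ (cong const m²))

        -- The weight is the square of m = p^e, hence the norm of m under conjugation. So
        -- `norm-pⁿ∣⇒pⁿ∣` applies and Y is m times some η in T.
        normY : norm -1ℤ 2 Y T.≈ const (m ^ 2) ⊛ const 1ℤ
        normY = T.≈-trans (T.⊛-cong (T.≈-refl {Y}) (T.≈-trans (T.≡⇒≈ (trans (σ-⊛ -1ℤ Y (bar (const 1ℤ))) (cong (bar Y ⊛_) (bar-bar (const 1ℤ)))))
            (T.≈-trans (T.⊛-comm (bar Y) (const 1ℤ)) (T.⊛-identityˡ (bar Y)))))
          (T.≈-trans weightT (T.≈-trans (T.≈-sym (T.⊛-identityˡ _)) (T.⊛-comm (const 1ℤ) (const (m ^ 2)))))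

        module _ (η : Laurent) (Y≈ : Y T.≈ const m ⊛ η) where
          bar-η : bar Y T.≈ const m ⊛ bar η
          bar-η = T.≈-trans (T.σ-cong conjugation Y≈) (T.≡⇒≈ (trans (σ-⊛ -1ℤ (const m) η) (cong (_⊛ bar η) (σ-const -1ℤ m))))

          η-unit : η ⊛ bar η T.≈ const 1ℤ
          η-unit = T.const-cancel m (T.const-cancel m (T.≈-trans (T.≈-sym (T.⊛-assoc (const m) (const m) (η ⊛ bar η)))
            (T.≈-trans (T.⊛-interchange (const m) (const m) η (bar η)) (T.≈-trans (T.⊛-cong (T.≈-sym Y≈) (T.≈-sym bar-η))
            (T.≈-trans weightT (T.≈-trans (T.const-* m (m ^ 1)) (T.⊛-cong (T.≈-refl {const m}) (T.const-* m 1ℤ))))))))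

          module _ {u t : ℤ} (w∣ : + w ∣ u - 1ℤ) (p∤u : ¬ + p ∣ u) (σY≈ : σ u Y S.≈ const t ⊛ Y) where
            galT : T.Galois u R
            galT = record { u≡1 = 1∣ _ ; order = ∣-trans (divides (+ w) vT) (S.Galois.order (galois w∣ p∤u)) }
              where
              vT : + S.v ≡ + w * + T.v
              vT = trans (cong +_ (trans (sym (ℕₚ.*-assoc p (p ℕ.^ b) w)) (trans (ℕₚ.*-comm (p ℕ.* p ℕ.^ b) w)
                (cong (λ x → w ℕ.* (p ℕ.* x)) (sym (ℕₚ.*-identityʳ (p ℕ.^ b))))))) (ℤₚ.pos-* w T.v)

            ση≈ : σ u η T.≈ const t ⊛ η
            ση≈ = T.const-cancel m (T.≈-trans (T.≡⇒≈ (sym (trans (σ-⊛ u (const m) η) (cong (_⊛ σ u η) (σ-const u m)))))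
              (T.≈-trans (T.σ-cong galT (T.≈-sym Y≈)) (T.≈-trans (project σY≈)
              (T.≈-trans (T.⊛-cong (T.≈-refl {const t}) Y≈) (T.⊛-swap (const t) (const m) η)))))

            twisted : σ u η ⊛ bar η T.≈ const t
            twisted = T.≈-trans (T.⊛-cong ση≈ (T.≈-refl {bar η})) (T.≈-trans (T.⊛-assoc (const t) η (bar η))
              (T.≈-trans (T.⊛-cong (T.≈-refl {const t}) η-unit) (T.≈-trans (T.⊛-comm (const t) (const 1ℤ)) (T.⊛-identityˡ (const t)))))

            -- η η̄ = 1 and σ(η) η̄ = t in T. Setting ζ = 1 makes the left sides equal, and equality
            -- in T survives this modulo p.
            p∣t-1 : + p ∣ t - 1ℤ
            p∣t-1 = subst (+ p ∣_) (trans (cong₂ (λ x y → A - x - (A′ - y)) (augmentation-const 1ℤ) (augmentation-const t))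
                (trans (cong (λ x → A - 1ℤ - (x - t)) A′≡A) (eq A t)))
              (∣m∣n⇒∣m-n (T.≈⇒p∣diff η-unit 0ℤ) (T.≈⇒p∣diff twisted 0ℤ))
              where
              A = augmentation (η ⊛ bar η)
              A′ = augmentation (σ u η ⊛ bar η)
              A′≡A : A′ ≡ A
              A′≡A = T.W.at (T.W.⊛-cong (T.σ-W galT η) (T.W.≈-refl {bar η})) tt 0ℤ
              eq : ∀ a t → a - 1ℤ - (a - t) ≡ t - 1ℤ
              eq = solve-∀

      sign : ∀ {u t} → + w ∣ u - 1ℤ → ¬ + p ∣ u → t * t ≡ 1ℤ → σ u Y S.≈ const t ⊛ Y → t ≡ 1ℤ
      sign {u} {t} w∣ p∤u tt′ σY≈ = go (T.norm-pⁿ∣⇒pⁿ∣ conjugation e normY)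
        where
        decide : + p ∣ t - 1ℤ → t ≡ 1ℤ ⊎ t ≡ -1ℤ → t ≡ 1ℤ
        decide d (inj₁ t≡1)    = t≡1
        decide d (inj₂ refl) = contradiction (∣m⇒∣-m d) p∤2
        go : (∃ λ η → Y T.≈ const m ⊛ η) → t ≡ 1ℤ
        go (η , Y≈) = decide (p∣t-1 η Y≈ w∣ p∤u σY≈) (square≡1 t tt′)

      invariant : (∀ {u} → + w ∣ u - 1ℤ → ¬ + p ∣ u → ∃ λ t → t * t ≡ 1ℤ × σ u Y S.≈ const t ⊛ Y) →
        ∀ {u} → + w ∣ u - 1ℤ → ¬ + p ∣ u → σ u Y S.≈ Y
      invariant signed {u} w∣ p∤u = go (signed w∣ p∤u)
        where
        go : (∃ λ t → t * t ≡ 1ℤ × σ u Y S.≈ const t ⊛ Y) → σ u Y S.≈ Y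
        go (t , tt′ , h) = S.≈-trans h (S.≈-trans (S.≡⇒≈ (cong (λ x → const x ⊛ Y) (sign w∣ p∤u tt′ h))) (S.⊛-identityˡ Y))

  -- Decomposition of the invariant element

  module Structure (p b w : ℕ) (pr : Prime p) (2<p : 2 ℕ.< p) (p⊥w : Coprime p w) (w⊥p-1 : Coprime w (p ∸ 1)) {{w≢0 : ℕ.NonZero w}} where
    open Cyclotomic p b w pr p⊥w
    open Multipliers p b w pr 2<p p⊥w
    open Symmetry p b w pr 2<p p⊥w w⊥p-1

    -- y^n lies in the subgroup of order w exactly when P ∣ n.
    P : ℕ
    P = p ℕ.^ suc b

    +P : + P ≡ + p * + (p ℕ.^ b)
    +P = ℤₚ.pos-* p (p ℕ.^ b)

    P∣v : + P ∣ + v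
    P∣v = divides (+ w) (trans pᵇw (ℤₚ.*-comm (+ P) (+ w)))

    +z : + z ≡ + (p ℕ.^ b) * + w
    +z = ℤₚ.pos-* (p ℕ.^ b) w

    p*z : + p * + z ≡ + v
    p*z = sym (ℤₚ.pos-* p z)

    P∣*z⇒p∣ : ∀ j → + P ∣ j * + z → + p ∣ j
    P∣*z⇒p∣ j d = coprime-∣ p⊥w (*-cancelˡ-∣ (+ (p ℕ.^ b)) {+ p} {+ w * j}
      (subst₂ _∣_ (trans +P (ℤₚ.*-comm (+ p) (+ (p ℕ.^ b)))) (trans (cong (j *_) +z) (eq j (+ (p ℕ.^ b)) (+ w))) d))
      where
      eq : ∀ j q w → j * (q * w) ≡ q * (w * j)
      eq = solve-∀

    p∤1 : ¬ + p ∣ 1ℤ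
    p∤1 d = ℕ∣.>⇒∤ (ℕₚ.<-trans (ℕₚ.n<1+n 1) 2<p) (∣⇒∣ᵤ d)

    P∤z : ¬ + P ∣ + z
    P∤z d = p∤1 (P∣*z⇒p∣ 1ℤ (subst (+ P ∣_) (sym (ℤₚ.*-identityˡ (+ z))) d))

    -- If p does not divide g, Euler's theorem inverts g; otherwise g and the modulus are divided by
    -- p. The hypothesis stops the descent before the modulus is used up.
    reach-pᵇ : ∀ b g → ¬ + (p ℕ.^ suc b) ∣ g → ∃ λ k → + (p ℕ.^ suc b) ∣ k * g - + (p ℕ.^ b)
    reach-pᵇ b g ¬d with + p ∣? g
    ... | no p∤g = + (p ℕ.^ b) * g ^ ℕ.pred t , subst (+ (p ℕ.^ suc b) ∣_) (trans (cong (λ n → + (p ℕ.^ b) * (g ^ n - 1ℤ)) (sym suct))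
          (eq (+ (p ℕ.^ b)) g (g ^ ℕ.pred t))) (∣n⇒∣m*n (+ (p ℕ.^ b)) (∤⇒euler pr b p∤g))
      where
      t = p ℕ.^ b ℕ.* (p ∸ 1)
      suct : suc (ℕ.pred t) ≡ t
      suct = ℕₚ.suc-pred t {{ℕₚ.m*n≢0 (p ℕ.^ b) (p ∸ 1) {{ℕₚ.m^n≢0 p b}} {{p-1≢0}}}}
      eq : ∀ q g x → q * (g * x - 1ℤ) ≡ q * x * g - q
      eq = solve-∀
    reach-pᵇ zero    g ¬d | yes p∣g = contradiction (subst (λ n → + n ∣ g) (sym (ℕₚ.^-identityʳ p)) p∣g) ¬d
    reach-pᵇ (suc b) g ¬d | yes (divides h eq) = go (reach-pᵇ b h λ d → ¬d (subst₂ _∣_ (sym (ℤₚ.pos-* p (p ℕ.^ suc b))) (trans (ℤₚ.*-comm (+ p) h) (sym eq)) (*-monoʳ-∣ (+ p) d)))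
      where
      eq′ : ∀ p k h q → p * (k * h - q) ≡ k * (h * p) - p * q
      eq′ = solve-∀
      go : (∃ λ k → + (p ℕ.^ suc b) ∣ k * h - + (p ℕ.^ b)) → ∃ λ k → + (p ℕ.^ suc (suc b)) ∣ k * g - + (p ℕ.^ suc b)
      go (k , d) = k , subst₂ _∣_ (sym (ℤₚ.pos-* p (p ℕ.^ suc b))) (trans (eq′ (+ p) k h (+ (p ℕ.^ b)))
        (cong₂ (λ x y → k * x - y) (sym eq) (sym (ℤₚ.pos-* p (p ℕ.^ b))))) (*-monoʳ-∣ (+ p) d)

    -- Take u = 1 + k w with k from `reach-pᵇ`: then (u - 1) g = w k g ≡ w p^b = z modulo v. So the
    -- allowed automorphisms move g to g + z whenever both lie outside C_w.
    transport : ∀ g → ¬ + P ∣ g → ¬ + P ∣ g + + z → ∃ λ u → + w ∣ u - 1ℤ × ¬ + p ∣ u × + v ∣ u * g - (g + + z)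
    transport g ¬g ¬gz = go (reach-pᵇ b g ¬g)
      where
      go : (∃ λ k → + P ∣ k * g - + (p ℕ.^ b)) → ∃ λ u → + w ∣ u - 1ℤ × ¬ + p ∣ u × + v ∣ u * g - (g + + z)
      go (k , d) = u , divides k (eq₁ k (+ w)) , p∤u , v∣
        where
        u = 1ℤ + k * + w
        eq₁ : ∀ k w → 1ℤ + k * w - 1ℤ ≡ k * w
        eq₁ = solve-∀
        eq₂ : ∀ k w g q → w * (k * g - q) ≡ (1ℤ + k * w) * g - (g + q * w)
        eq₂ = solve-∀
        v∣ : + v ∣ u * g - (g + + z)
        v∣ = subst₂ _∣_ (trans (ℤₚ.*-comm (+ w) (+ P)) (sym pᵇw)) (trans (eq₂ k (+ w) g (+ (p ℕ.^ b))) (cong (λ x → u * g - (g + x)) (sym +z)))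
          (*-monoʳ-∣ (+ w) d)
        -- If p divided u = 1 + k w, then k would be prime to p, so k g ≡ p^b would give p^b ∣ g.
        -- Then P would divide u g, hence g + z, which is excluded.
        p∤u : ¬ + p ∣ u
        p∤u p∣u = ¬gz (∣-resp (g + + z) (u * g) (∣-flip (u * g) (g + + z) (∣-trans P∣v v∣)) (P∣ug (∤⇒euler pr b p∤k)))
          where
          eq₃ : ∀ k w → 1ℤ + k * w - w * k ≡ 1ℤ
          eq₃ = solve-∀
          p∤k : ¬ + p ∣ k
          p∤k p∣k = p∤1 (subst (+ p ∣_) (eq₃ k (+ w)) (∣m∣n⇒∣m-n p∣u (∣n⇒∣m*n (+ w) p∣k)))
          pᵇ∣P : + (p ℕ.^ b) ∣ + P
          pᵇ∣P = divides (+ p) +P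
          eq₄ : ∀ k x g q → x * (k * g - q) + x * q - (k * x - 1ℤ) * g ≡ g
          eq₄ = solve-∀
          P∣ug : + P ∣ k ^ totient - 1ℤ → + P ∣ u * g
          P∣ug d′ = subst₂ _∣_ (sym +P) (ℤₚ.*-comm g u) (prod p∣u pᵇ∣g)
            where
            K = k ^ R
            kK : k ^ totient ≡ k * K
            kK = cong (k ^_) (sym sucR)
            pᵇ∣g : + (p ℕ.^ b) ∣ g
            pᵇ∣g = subst (+ (p ℕ.^ b) ∣_) (eq₄ k K g (+ (p ℕ.^ b))) (∣m∣n⇒∣m-n
              (∣m∣n⇒∣m+n (∣n⇒∣m*n K (∣-trans pᵇ∣P d)) (∣n⇒∣m*n K ∣-refl))
              (∣m⇒∣m*n g (∣-trans pᵇ∣P (subst (λ x → + P ∣ x - 1ℤ) kK d′))))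
            prod : ∀ {a c x y} → a ∣ x → c ∣ y → a * c ∣ y * x
            prod {a} {c} (divides q refl) (divides r refl) = divides (r * q) (eq₅ r c q a)
              where
              eq₅ : ∀ r c q a → r * c * (q * a) ≡ r * q * (a * c)
              eq₅ = solve-∀

    module _ (Y : Laurent) (inv : ∀ {u} → + w ∣ u - 1ℤ → ¬ + p ∣ u → σ u Y ≈ Y) where
      private
        F : ℤ → ℤ
        F = coeff Y

      F-periodic : Periodic (+ v) F
      F-periodic = coeff-periodic Y

      -- Summing F(uⁱg) - F(uⁱ⁺¹g), which is independent of i, over a full cycle of u shows that it vanishes.
      invariant-step : ∀ g u → + w ∣ u - 1ℤ → ¬ + p ∣ u → + v ∣ u * g - (g + + z) → F g ≡ F (g + + z)
      invariant-step g u w∣ p∤u v∣ = trans (ℤₚ.i-j≡0⇒i≡j (F g) (F (u * g)) (trans step₀ E≡0)) (periodic-∣ {F} F-periodic (u * g) (g + + z) v∣)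
        where
        gal : Galois u R
        gal = galois w∣ p∤u
        open Galois gal
        E : ℤ → ℤ
        E = gap (σ u Y) Y
        E-per : Periodic (+ z) E
        E-per = ≈⇒periodic (inv w∣ p∤u)
        E-u : ∀ h → E (u * h) ≡ F h - F (u * h)
        E-u h = cong (λ x → x - F (u * h)) (trans (coeff-σ gal Y (u * h)) (periodic-∣ {F} F-periodic (u ^ R * (u * h)) h
          (subst (+ v ∣_) (eq u (u ^ R) h) (∣n⇒∣m*n h order))))
          where
          eq : ∀ u x h → h * (u * x - 1ℤ) ≡ x * (u * h) - h
          eq = solve-∀
        z∣v : + z ∣ + v
        z∣v = divides (+ p) (sym p*z)
        z∣ : ∀ n → + z ∣ u ^ n * g - g
        z∣ zero    = divides 0ℤ (trans (eq g) (sym (ℤₚ.*-zeroˡ (+ z))))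
          where
          eq : ∀ g → 1ℤ * g - g ≡ 0ℤ
          eq = solve-∀
        z∣ (suc n) = subst (+ z ∣_) (eq u (u ^ n) g (+ z)) (∣m∣n⇒∣m+n (∣n⇒∣m*n u (z∣ n)) (∣m∣n⇒∣m+n (∣-trans z∣v v∣) ∣-refl))
          where
          eq : ∀ u x g z → u * (x * g - g) + (u * g - (g + z) + z) ≡ u * x * g - g
          eq = solve-∀
        step : ∀ n → F (u ^ n * g) - F (u ^ suc n * g) ≡ E g
        step n = trans (cong (λ x → F (u ^ n * g) - F x) (ℤₚ.*-assoc u (u ^ n) g)) (trans (sym (E-u (u ^ n * g)))
          (periodic-∣ {E} E-per (u * (u ^ n * g)) g (subst (λ x → + z ∣ x - g) (ℤₚ.*-assoc u (u ^ n) g) (z∣ (suc n)))))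
        step₀ : F g - F (u * g) ≡ E g
        step₀ = trans (cong₂ (λ x y → F x - F (y * g)) (sym (ℤₚ.*-identityˡ g)) (sym (ℤₚ.*-identityʳ u))) (step 0)
        total : ∀ n → F g - F (u ^ n * g) ≡ + n * E g
        total zero    = trans (ℤₚ.i≡j⇒i-j≡0 (cong F (sym (ℤₚ.*-identityˡ g)))) (sym (ℤₚ.*-zeroˡ (E g)))
        total (suc n) = trans (eq (F g) (F (u ^ n * g)) (F (u ^ suc n * g))) (trans (cong₂ _+_ (step n) (total n)) (sym (ℤₚ.suc-* (+ n) (E g))))
          where
          eq : ∀ a b c → a - c ≡ b - c + (a - b)
          eq = solve-∀
        E≡0 : E g ≡ 0ℤ
        E≡0 = ℤₚ.*-cancelˡ-≡ (+ suc R) (E g) 0ℤ (trans (sym (total (suc R))) (trans (ℤₚ.i≡j⇒i-j≡0 (sym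
          (periodic-∣ {F} F-periodic (u ^ suc R * g) g (subst (+ v ∣_) (eq (u ^ suc R) g) (∣n⇒∣m*n g order))))) (sym (ℤₚ.*-zeroʳ (+ suc R)))))
          where
          eq : ∀ x g → g * (x - 1ℤ) ≡ x * g - g
          eq = solve-∀

      constant : ∀ g → ¬ + P ∣ g → ¬ + P ∣ g + + z → F g ≡ F (g + + z)
      constant g ¬g ¬gz = go (transport g ¬g ¬gz)
        where
        go : (∃ λ u → + w ∣ u - 1ℤ × ¬ + p ∣ u × + v ∣ u * g - (g + + z)) → F g ≡ F (g + + z)
        go (u , w∣ , p∤u , v∣) = invariant-step g u w∣ p∤u v∣

      -- Of the points h + j z with 0 ≤ j < p only h lies in C_w. So `constant` leads from h + z
      -- step by step to h + (p - 1) z, which is h - z modulo v.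
      around : ∀ h → + P ∣ h → F (h + + z) ≡ F (h - + z)
      -- The chain is indexed by `suc j`, so j = p - 2 stands for the last point j = p - 1.
      around h P∣h = trans (sym (chain (p ∸ 2) (ℕₚ.≤-reflexive (ℕₚ.m+[n∸m]≡n (ℕₚ.<⇒≤ 2<p)))))
          (trans (cong F (trans (cong (λ x → h + x * + z) p-1≡) (trans (eq₁ h (+ p) (+ z)) (ℤ-+-congˡ (h - + z) p*z)))) (F-periodic (h - + z)))
        where
        eq₁ : ∀ h p z → h + (p - 1ℤ) * z ≡ h - z + p * z
        eq₁ = solve-∀
        eq₂ : ∀ h j z → h + j * z + z ≡ h + (1ℤ + j) * z
        eq₂ = solve-∀
        p-1≡ : + suc (p ∸ 2) ≡ + p - 1ℤ
        p-1≡ = trans (cong +_ (sym (ℕₚ.+-∸-assoc 1 (ℕₚ.<⇒≤ 2<p)))) (sym (trans (ℤₚ.m-n≡m⊖n p 1) (ℤₚ.⊖-≥ (ℕₚ.≤-trans (ℕₚ.n≤1+n 1) (ℕₚ.<⇒≤ 2<p)))))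
        off : ∀ j → suc j ℕ.< p → ¬ + P ∣ h + + suc j * + z
        off j j<p d = ∤-small j<p (P∣*z⇒p∣ (+ suc j) (∣m+n∣m⇒∣n d P∣h))
        chain : ∀ j → suc j ℕ.< p → F (h + + suc j * + z) ≡ F (h + + z)
        chain zero    _   = cong (λ x → F (h + x)) (ℤₚ.*-identityˡ (+ z))
        chain (suc j) j<p = trans (cong F (sym (eq₂ h (+ suc j) (+ z)))) (trans (sym (constant (h + + suc j * + z) (off j (ℕₚ.<-trans (ℕₚ.n<1+n (suc j)) j<p))
          λ d → off (suc j) j<p (subst (+ P ∣_) (eq₂ h (+ suc j) (+ z)) d))) (chain j (ℕₚ.<-trans (ℕₚ.n<1+n (suc j)) j<p)))

      -- A coset of the subgroup of order p meets C_w in at most one point n, and F is constant on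
      -- the rest of it, with value F(n + z). A is the excess of F at n over this value, so B
      -- becomes constant on the coset. As a difference of two coefficients, A is bounded by 2a.
      A B : ℤ → ℤ
      A n = δ (+ P) n * (F n - F (n + + z))
      B n = F n - A n

      A-on : ∀ n → + P ∣ n → A n ≡ F n - F (n + + z)
      A-on n d = trans (cong (_* (F n - F (n + + z))) (δ-yes d)) (ℤₚ.*-identityˡ _)

      A-off : ∀ n → ¬ + P ∣ n → A n ≡ 0ℤ
      A-off n ¬d = trans (cong (_* (F n - F (n + + z))) (δ-no ¬d)) (ℤₚ.*-zeroˡ (F n - F (n + + z)))

      ∣⇒∤+z : ∀ g → + P ∣ g → ¬ + P ∣ g + + z
      ∣⇒∤+z g d d′ = P∤z (∣m+n∣m⇒∣n d′ d)

      A-periodic : Periodic (+ v) A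
      A-periodic n = cong₂ _*_ (δ-cong (n + + v) n (subst (+ P ∣_) (eq n (+ v)) P∣v))
        (cong₂ _-_ (F-periodic n) (trans (cong F (eq₁ n (+ v) (+ z))) (F-periodic (n + + z))))
        where
        eq : ∀ n v → v ≡ n + v - n
        eq = solve-∀
        eq₁ : ∀ n v z → n + v + z ≡ n + z + v
        eq₁ = solve-∀

      B-periodic : Periodic (+ z) B
      B-periodic g = cases (+ P ∣? g) (+ P ∣? (g + + z))
        where
        eq₁ : ∀ x y → x - (x - y) ≡ y
        eq₁ = solve-∀
        eq₂ : ∀ x → x - 0ℤ ≡ x
        eq₂ = solve-∀
        eq₃ : ∀ g z → g + z - z ≡ g
        eq₃ = solve-∀
        B-off : ∀ n → ¬ + P ∣ n → B n ≡ F n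
        B-off n ¬d = trans (cong (λ x → F n - x) (A-off n ¬d)) (eq₂ (F n))
        B-on : ∀ n → + P ∣ n → B n ≡ F (n + + z)
        B-on n d = trans (cong (λ x → F n - x) (A-on n d)) (eq₁ (F n) (F (n + + z)))
        cases : Dec (+ P ∣ g) → Dec (+ P ∣ g + + z) → B (g + + z) ≡ B g
        cases (yes d) _        = trans (B-off (g + + z) (∣⇒∤+z g d)) (sym (B-on g d))
        cases (no ¬d) (yes d)  = trans (B-on (g + + z) d) (trans (trans (around (g + + z) d) (cong F (eq₃ g (+ z)))) (sym (B-off g ¬d)))
        cases (no ¬d) (no ¬d′) = trans (B-off (g + + z) ¬d′) (trans (sym (constant g ¬d ¬d′)) (sym (B-off g ¬d)))

  i≤∣i∣ : ∀ i → i ℤ.≤ + ℤ.∣ i ∣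
  i≤∣i∣ (+ n)      = ℤₚ.≤-refl
  i≤∣i∣ ℤ.-[1+ n ] = ℤ.-≤+

  ∣i∣²≡i² : ∀ i → + (ℤ.∣ i ∣ ℕ.* ℤ.∣ i ∣) ≡ i * i
  ∣i∣²≡i² (+ n)      = ℤₚ.pos-* n n
  ∣i∣²≡i² ℤ.-[1+ n ] = refl

  ∣i∣≤∣i∣² : ∀ i → ℤ.∣ i ∣ ℕ.≤ ℤ.∣ i ∣ ℕ.* ℤ.∣ i ∣
  ∣i∣≤∣i∣² i with ℤ.∣ i ∣
  ... | zero  = ℕ.z≤n
  ... | suc n = ℕₚ.m≤m*n (suc n) (suc n)

  -- Integrality enters through |j| ≤ j².
  ∣i∣≤c⇒-2ij≤2cj² : ∀ c i j → ℤ.∣ i ∣ ℕ.≤ c → - (+ 2 * (i * j)) ℤ.≤ + (2 ℕ.* c) * (j * j)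
  ∣i∣≤c⇒-2ij≤2cj² c i j h = ℤₚ.≤-trans (i≤∣i∣ _) (ℤₚ.≤-trans (ℤ.+≤+ bound) (ℤₚ.≤-reflexive (trans (ℤₚ.pos-* (2 ℕ.* c) _) (cong (+ (2 ℕ.* c) *_) (∣i∣²≡i² j)))))
    where
    bound : ℤ.∣ - (+ 2 * (i * j)) ∣ ℕ.≤ 2 ℕ.* c ℕ.* (ℤ.∣ j ∣ ℕ.* ℤ.∣ j ∣)
    bound = ℕₚ.≤-trans (ℕₚ.≤-reflexive (trans (ℤₚ.∣-i∣≡∣i∣ (+ 2 * (i * j))) (trans (ℤₚ.abs-* (+ 2) (i * j)) (trans (cong (2 ℕ.*_) (ℤₚ.abs-* i j))
        (sym (ℕₚ.*-assoc 2 ℤ.∣ i ∣ ℤ.∣ j ∣))))))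
      (ℕₚ.*-mono-≤ (ℕₚ.*-monoʳ-≤ 2 h) (∣i∣≤∣i∣² j))

  -- The weight of A and the bound on p

  module Conclusion (p b w : ℕ) (pr : Prime p) (2<p : 2 ℕ.< p) (p⊥w : Coprime p w) (w⊥p-1 : Coprime w (p ∸ 1)) {{w≢0 : ℕ.NonZero w}}
    (Y : Laurent) (inv : ∀ {u} → + w ∣ u - 1ℤ → ¬ + p ∣ u → Cyclotomic._≈_ p b w pr p⊥w (σ u Y) Y)
    (m : ℤ) (weight : ∀ g → correlation (Cyclotomic.v p b w pr p⊥w) (Cyclotomic.coeff p b w pr p⊥w Y) (Cyclotomic.coeff p b w pr p⊥w Y) g
                            ≡ m * δ (+ (Cyclotomic.v p b w pr p⊥w)) g) where
    open Cyclotomic p b w pr p⊥w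
    open Structure p b w pr 2<p p⊥w w⊥p-1

    private
      F A₀ B₀ : ℤ → ℤ
      F = coeff Y
      A₀ = A Y inv
      B₀ = B Y inv

      B-v : Periodic (+ v) B₀
      B-v n = cong₂ _-_ (F-periodic Y inv n) (A-periodic Y inv n)

    -- Besides A Ā, the product F F̄ contains only terms with a factor B, and these form a
    -- z-periodic `rest`. At g + z, which is outside C_w, both F F̄ and A Ā vanish, so `rest`
    -- vanishes at g + z and hence at g.
    correlation-A : ∀ g → + P ∣ g → correlation v A₀ A₀ g ≡ m * δ (+ v) g
    correlation-A g P∣g = begin
      correlation v A₀ A₀ g                                     ≡⟨ eq₁ (correlation v A₀ A₀ g) (rest g) ⟩
      correlation v A₀ A₀ g + rest g - rest g                   ≡⟨ cong (_- rest g) (sym (split g)) ⟩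
      correlation v F F g - rest g                              ≡⟨ cong₂ _-_ (weight g) (sym rest-z) ⟩
      m * δ (+ v) g - rest (g + + z)                            ≡⟨ cong (λ x → m * δ (+ v) g - x) rest≡0 ⟩
      m * δ (+ v) g - 0ℤ                                        ≡⟨ ℤₚ.+-identityʳ _ ⟩
      m * δ (+ v) g                                             ∎
      where
      open ≡-Reasoning
      eq₁ : ∀ a r → a ≡ a + r - r
      eq₁ = solve-∀
      eq₂ : ∀ n g z → n + z + g ≡ n + (g + z)
      eq₂ = solve-∀
      rest : ℤ → ℤ
      rest g = correlation v A₀ B₀ g + correlation v B₀ F g
      split : ∀ g → correlation v F F g ≡ correlation v A₀ A₀ g + rest g
      split g = trans (∑-cong v λ n → eq (F (+ n + g)) (A₀ (+ n + g)) (F (+ n)) (A₀ (+ n)))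
        (trans (∑-+ v (λ n → A₀ (+ n + g) * A₀ (+ n)) (λ n → A₀ (+ n + g) * B₀ (+ n) + B₀ (+ n + g) * F (+ n)))
          (ℤ-+-congˡ (correlation v A₀ A₀ g) (∑-+ v (λ n → A₀ (+ n + g) * B₀ (+ n)) (λ n → B₀ (+ n + g) * F (+ n)))))
        where
        eq : ∀ f′ a′ f a → f′ * f ≡ a′ * a + (a′ * (f - a) + (f′ - a′) * f)
        eq = solve-∀
      rest-z : rest (g + + z) ≡ rest g
      rest-z = cong₂ _+_
        (trans (∑-cong v λ n → cong₂ _*_ (cong A₀ (sym (eq₂ (+ n) g (+ z)))) (sym (B-periodic Y inv (+ n))))
          (∑-translate v {λ n → A₀ (n + g) * B₀ n} (λ n → cong₂ _*_ (trans (cong A₀ (eq₃ n (+ v) g)) (A-periodic Y inv (n + g))) (B-v n)) (+ z)))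
        (∑-cong v λ n → cong (_* F (+ n)) (trans (cong B₀ (eq₄ (+ n) g (+ z))) (B-periodic Y inv (+ n + g))))
        where
        eq₃ : ∀ n v g → n + v + g ≡ n + g + v
        eq₃ = solve-∀
        eq₄ : ∀ n g z → n + (g + z) ≡ n + g + z
        eq₄ = solve-∀
      off : ∀ n → A₀ (n + (g + + z)) * A₀ n ≡ 0ℤ
      off n = cases (+ P ∣? n)
        where
        eq : ∀ n g z → n + (g + z) ≡ n + g + z
        eq = solve-∀
        cases : Dec (+ P ∣ n) → A₀ (n + (g + + z)) * A₀ n ≡ 0ℤ
        cases (no ¬d) = trans (cong (A₀ (n + (g + + z)) *_) (A-off Y inv n ¬d)) (ℤₚ.*-zeroʳ (A₀ (n + (g + + z))))
        cases (yes d) = trans (cong (_* A₀ n) (A-off Y inv (n + (g + + z)) λ d′ →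
          ∣⇒∤+z Y inv (n + g) (∣m∣n⇒∣m+n d P∣g) (subst (+ P ∣_) (eq n g (+ z)) d′))) (ℤₚ.*-zeroˡ (A₀ n))
      rest≡0 : rest (g + + z) ≡ 0ℤ
      rest≡0 = trans (eq₅ (correlation v A₀ A₀ (g + + z)) (rest (g + + z))) (cong₂ _-_ (trans (sym (split (g + + z))) (trans (weight (g + + z))
        (trans (cong (m *_) (δ-no λ d → ∣⇒∤+z Y inv g P∣g (∣-trans P∣v d))) (ℤₚ.*-zeroʳ m)))) (trans (∑-cong v λ n → off (+ n)) (∑-0 v)))
        where
        eq₅ : ∀ a r → r ≡ a + r - a
        eq₅ = solve-∀

    module _ (a : ℕ) (F≤a : ∀ g → ℤ.∣ F g ∣ ℕ.≤ a) where

      A≤2a : ∀ g → ℤ.∣ A₀ g ∣ ℕ.≤ 2 ℕ.* a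
      A≤2a g = cases (+ P ∣? g)
        where
        cases : Dec (+ P ∣ g) → ℤ.∣ A₀ g ∣ ℕ.≤ 2 ℕ.* a
        cases (no ¬d) = ℕₚ.≤-trans (ℕₚ.≤-reflexive (cong ℤ.∣_∣ (A-off Y inv g ¬d))) ℕ.z≤n
        cases (yes d) = ℕₚ.≤-trans (ℕₚ.≤-reflexive (cong ℤ.∣_∣ (A-on Y inv g d))) (ℕₚ.≤-trans (ℤₚ.∣i-j∣≤∣i∣+∣j∣ (F g) (F (g + + z)))
          (ℕₚ.≤-trans (ℕₚ.+-mono-≤ (F≤a g) (F≤a (g + + z))) (ℕₚ.≤-reflexive (cong (a ℕ.+_) (sym (ℕₚ.+-identityʳ a))))))

      ∑B² : ℤ
      ∑B² = ∑ v (λ n → B₀ (+ n) * B₀ (+ n))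

      -- The square of the restriction B' of B to C_w.
      on : ℤ → ℤ
      on n = δ (+ P) n * (B₀ n * B₀ n)

      ∑B²≤ : ∑B² ℤ.≤ + (4 ℕ.* a) * ∑ v (λ n → on (+ n))
      ∑B²≤ = ℤₚ.≤-trans (ℤₚ.≤-reflexive ∑B²≡) (ℤₚ.≤-trans (∑-mono v λ n → pointwise (+ n)) (ℤₚ.≤-reflexive (∑-* v (+ (4 ℕ.* a)) (λ n → on (+ n)))))
        where
        square-sum : ∀ (f : ℤ → ℤ) → ∑ v (λ n → f (+ n) * f (+ n)) ≡ correlation v f f 0ℤ
        square-sum f = ∑-cong v λ n → cong (λ x → f x * f (+ n)) (sym (ℤₚ.+-identityʳ (+ n)))
        ∑F²≡∑A² : ∑ v (λ n → F (+ n) * F (+ n)) ≡ ∑ v (λ n → A₀ (+ n) * A₀ (+ n))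
        ∑F²≡∑A² = trans (square-sum F) (trans (weight 0ℤ) (trans (sym (correlation-A 0ℤ (divides 0ℤ refl))) (sym (square-sum A₀))))
        eq : ∀ f a → (f - a) * (f - a) ≡ - (+ 2 * (a * (f - a))) + (f * f - a * a)
        eq = solve-∀
        ∑B²≡ : ∑B² ≡ ∑ v (λ n → - (+ 2 * (A₀ (+ n) * B₀ (+ n))))
        ∑B²≡ = trans (∑-cong v λ n → eq (F (+ n)) (A₀ (+ n)))
          (trans (∑-+ v (λ n → - (+ 2 * (A₀ (+ n) * B₀ (+ n)))) (λ n → F (+ n) * F (+ n) - A₀ (+ n) * A₀ (+ n)))
          (trans (ℤ-+-congˡ (∑ v (λ n → - (+ 2 * (A₀ (+ n) * B₀ (+ n))))) (trans (∑-- v (λ n → F (+ n) * F (+ n)) (λ n → A₀ (+ n) * A₀ (+ n))) (ℤₚ.i≡j⇒i-j≡0 ∑F²≡∑A²)))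
            (ℤₚ.+-identityʳ _)))
        pointwise : ∀ n → - (+ 2 * (A₀ n * B₀ n)) ℤ.≤ + (4 ℕ.* a) * on n
        pointwise n = cases (+ P ∣? n)
          where
          eq₁ : ∀ b x y → - (+ 2 * (0ℤ * b)) ≡ x * (0ℤ * y)
          eq₁ = solve-∀
          cases : Dec (+ P ∣ n) → - (+ 2 * (A₀ n * B₀ n)) ℤ.≤ + (4 ℕ.* a) * on n
          cases (no ¬d) = ℤₚ.≤-reflexive (trans (cong (λ x → - (+ 2 * (x * B₀ n))) (A-off Y inv n ¬d)) (trans (eq₁ (B₀ n) (+ (4 ℕ.* a)) (B₀ n * B₀ n))
            (cong (λ x → + (4 ℕ.* a) * (x * (B₀ n * B₀ n))) (sym (δ-no ¬d)))))
          cases (yes d) = ℤₚ.≤-trans (∣i∣≤c⇒-2ij≤2cj² (2 ℕ.* a) (A₀ n) (B₀ n) (A≤2a n)) (ℤₚ.≤-reflexive (cong₂ (λ x y → + x * y)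
            (sym (ℕₚ.*-assoc 2 2 a)) (trans (sym (ℤₚ.*-identityˡ (B₀ n * B₀ n))) (cong (_* (B₀ n * B₀ n)) (sym (δ-yes d))))))

      -- The subgroup of order p meets C_w trivially, so each of its cosets has at most one point in
      -- C_w.
      ∑-classes : ∀ n → ∑ p (λ j → δ (+ P) (n + + j * + z)) ℤ.≤ 1ℤ
      ∑-classes n = cases (+ (p ℕ.^ b) ∣? n) (bézout p⊥w)
        where
        pᵇ∣ : ∀ {n} → + P ∣ n → + (p ℕ.^ b) ∣ n
        pᵇ∣ d = ∣-trans (divides (+ p) +P) d
        pᵇ∣z : ∀ j → + (p ℕ.^ b) ∣ + j * + z
        pᵇ∣z j = ∣n⇒∣m*n (+ j) (divides (+ w) (trans +z (ℤₚ.*-comm (+ (p ℕ.^ b)) (+ w))))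
        cases : Dec (+ (p ℕ.^ b) ∣ n) → (∃₂ λ x y → x * + p + y * + w ≡ 1ℤ) → ∑ p (λ j → δ (+ P) (n + + j * + z)) ℤ.≤ 1ℤ
        cases (no ¬d) _ = ℤₚ.≤-trans (ℤₚ.≤-reflexive (trans (∑-cong p λ j → δ-no λ d → ¬d (∣m+n∣n⇒∣m (pᵇ∣ d) (pᵇ∣z j))) (∑-0 p))) (ℤ.+≤+ ℕ.z≤n)
        -- With n = p^b q one has n + j z = p^b (q + j w). As y inverts w modulo p, P divides this
        -- exactly for j ≡ -y q modulo p.
        cases (yes (divides q n≡)) (x , y , xy) = ℤₚ.≤-reflexive (trans (∑-cong p λ j → trans (δ-iff (to j) (from j)) (sym (ℤₚ.*-identityˡ (δ (+ p) (+ j - - (y * q))))))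
            (∑-δ p {λ _ → 1ℤ} (λ _ → refl) (- (y * q))))
          where
          Q = + (p ℕ.^ b)
          instance
            Q≢0 : ℤ.NonZero Q
            Q≢0 = q≢0
          eq₁ : ∀ q Q j w → q * Q + j * (Q * w) ≡ Q * (q + j * w)
          eq₁ = solve-∀
          eq₂ : ∀ x p y w q j → y * (q + j * w) + j * (x * p) + j * (1ℤ - (x * p + y * w)) ≡ j - - (y * q)
          eq₂ = solve-∀
          eq₃ : ∀ x p y w q j → w * (j - - (y * q)) + q * (x * p) + q * (1ℤ - (x * p + y * w)) ≡ q + j * w
          eq₃ = solve-∀
          form : ∀ j → n + + j * + z ≡ Q * (q + + j * + w)
          form j = trans (cong₂ (λ s t → s + + j * t) n≡ +z) (eq₁ q Q (+ j) (+ w))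
          PQ : + P ≡ Q * + p
          PQ = trans +P (ℤₚ.*-comm (+ p) Q)
          vanish : ∀ t → + p ∣ t * (1ℤ - (x * + p + y * + w))
          vanish t = divides 0ℤ (trans (cong (λ s → t * (1ℤ - s)) xy) (trans (ℤₚ.*-zeroʳ t) (sym (ℤₚ.*-zeroˡ (+ p)))))
          to : ∀ j → + P ∣ n + + j * + z → + p ∣ + j - - (y * q)
          to j d = subst (+ p ∣_) (eq₂ x (+ p) y (+ w) q (+ j)) (∣m∣n⇒∣m+n (∣m∣n⇒∣m+n
            (∣n⇒∣m*n y (*-cancelˡ-∣ Q (subst₂ _∣_ PQ (form j) d))) (∣n⇒∣m*n (+ j) (∣n⇒∣m*n x ∣-refl))) (vanish (+ j)))
          from : ∀ j → + p ∣ + j - - (y * q) → + P ∣ n + + j * + z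
          from j d = subst₂ _∣_ (sym PQ) (sym (form j)) (*-monoʳ-∣ Q (subst (+ p ∣_) (eq₃ x (+ p) y (+ w) q (+ j))
            (∣m∣n⇒∣m+n (∣m∣n⇒∣m+n (∣n⇒∣m*n (+ w) d) (∣n⇒∣m*n q (∣n⇒∣m*n x ∣-refl))) (vanish q))))

      -- The p translates of `on` by multiples of z have equal sums. At each n they add up to at
      -- most B(n)², because B is z-periodic and `∑-classes` allows at most one nonzero term.
      p∑on≤ : + p * ∑ v (λ n → on (+ n)) ℤ.≤ ∑B²
      p∑on≤ = ℤₚ.≤-trans (ℤₚ.≤-reflexive (trans (sym (∑-const p (∑ v (λ n → on (+ n))))) (trans (∑-cong p shift)
          (∑-swap p v (λ j n → on (+ n + + j * + z)))))) (∑-mono v λ n → column (+ n))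
        where
        on-per : Periodic (+ v) on
        on-per n = cong₂ _*_ (δ-cong (n + + v) n (subst (+ P ∣_) (eq n (+ v)) P∣v)) (cong (λ x → x * x) (cong₂ _-_ (F-periodic Y inv n) (A-periodic Y inv n)))
          where
          eq : ∀ n v → v ≡ n + v - n
          eq = solve-∀
        shift : ∀ j → ∑ v (λ n → on (+ n)) ≡ ∑ v (λ n → on (+ n + + j * + z))
        shift j = sym (∑-translate v on-per (+ j * + z))
        column : ∀ n → ∑ p (λ j → on (n + + j * + z)) ℤ.≤ B₀ n * B₀ n
        column n = ℤₚ.≤-trans (ℤₚ.≤-reflexive (trans (∑-cong p λ j → trans (cong (λ x → δ (+ P) (n + + j * + z) * (x * x)) (periodic-* {B₀} (B-periodic Y inv) (+ j) n))
            (ℤₚ.*-comm (δ (+ P) (n + + j * + z)) (B₀ n * B₀ n))) (∑-* p (B₀ n * B₀ n) (λ j → δ (+ P) (n + + j * + z)))))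
          (ℤₚ.≤-trans (ℤₚ.*-monoˡ-≤-nonNeg (B₀ n * B₀ n) {{ℤ.nonNegative (square≥0 (B₀ n))}} (∑-classes n)) (ℤₚ.≤-reflexive (ℤₚ.*-identityʳ (B₀ n * B₀ n))))

      -- If T = Σ B'² is positive, it cancels from p T ≤ Σ B² ≤ 4a T; otherwise Σ B² ≤ 0 and B
      -- vanishes.
      p≤4a⊎B≡0 : p ℕ.≤ 4 ℕ.* a ⊎ (∀ n → B₀ n ≡ 0ℤ)
      p≤4a⊎B≡0 = cases (0ℤ ℤ.<? T)
        where
        T : ℤ
        T = ∑ v (λ n → on (+ n))
        cases : Dec (0ℤ ℤ.< T) → p ℕ.≤ 4 ℕ.* a ⊎ (∀ n → B₀ n ≡ 0ℤ)
        cases (yes T>0) = inj₁ (ℤₚ.drop‿+≤+ (ℤₚ.*-cancelʳ-≤-pos (+ p) (+ (4 ℕ.* a)) T {{ℤ.positive T>0}} (ℤₚ.≤-trans p∑on≤ ∑B²≤)))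
        cases (no T≯0)  = inj₂ (periodic-∀ v B-v λ i i<v → square≡0 (B₀ (+ i)) (∑-nonneg-≤0 v (λ i → square≥0 (B₀ (+ i))) ∑B²≤0 i i<v))
          where
          ∑B²≤0 : ∑B² ℤ.≤ 0ℤ
          ∑B²≤0 = ℤₚ.≤-trans ∑B²≤ (ℤₚ.≤-trans (ℤₚ.*-monoˡ-≤-nonNeg (+ (4 ℕ.* a)) (ℤₚ.≮⇒≥ T≯0)) (ℤₚ.≤-reflexive (ℤₚ.*-zeroʳ (+ (4 ℕ.* a)))))

open import Defs
open import Data.Nat using (ℕ; _*_; _^_; _∸_; _<_; _≤_)
open import Data.Nat.Divisibility using (_∣_)
open import Data.Nat.Primality using (Prime)
open import Data.Nat.GCD using (gcd)
open import Data.Nat.Coprimality using (Coprime)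
open import Data.Product using (_×_)
open import Data.Sum using (_⊎_)
open import Relation.Nullary using (¬_)
open import Relation.Binary.PropositionalEquality using (_≡_)

-- Passage between functions on `Fin v` and Laurent polynomials

module Assembly where
  open Cyclotomy
  open import Data.Nat as ℕ using (zero; suc)
  import Data.Nat.Properties as ℕₚ
  import Data.Nat.Divisibility as ℕ∣
  import Data.Nat.GCD as GCD
  import Data.Nat.Coprimality as Coprimality
  open import Data.Nat.DivMod using (m%n<n)
  open import Data.Nat.Primality.Factorisation using (factorise; PrimeFactorisation)
  open import Data.Nat.ListAction using (product)
  open import Data.Nat.Primality using (prime⇒nonTrivial)
  open import Data.Integer as ℤ using (ℤ; +_; -_; _-_; 0ℤ; 1ℤ) renaming (_+_ to _+ᶻ_; _*_ to _*ᶻ_; _^_ to _^ᶻ_)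
  import Data.Integer.Properties as ℤₚ
  open import Data.Integer.DivMod using (_%ℕ_; _/ℕ_; n%ℕd<d; a≡a%ℕn+[a/ℕn]*n)
  open import Data.Integer.Divisibility.Signed as ℤ∣ using (divides; _∣?_; ∣⇒∣ᵤ; ∣m∣n⇒∣m+n; ∣m∣n⇒∣m-n; ∣-trans; *-cancelˡ-∣) renaming (_∣_ to _∣ᶻ_)
  open import Data.Integer.Tactic.RingSolver using (solve-∀)
  open import Data.Fin as Fin using (Fin; toℕ; fromℕ<)
  import Data.Fin.Properties as Finₚ
  open import Data.List using ([]; _∷_; map; allFin; tabulate)
  import Data.List.Properties as Listₚ
  open import Data.List.Relation.Unary.All using ([]; _∷_)
  open import Data.Product using (Σ; ∃; _,_; proj₁; proj₂)
  open import Data.Sum using (inj₁; inj₂)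
  open import Function using (_∘_)
  open import Relation.Nullary using (yes; no; Dec; contradiction)
  open import Relation.Binary.PropositionalEquality
    using (refl; sym; trans; cong; cong₂; subst; _≢_)

  sum-tabulate : ∀ n (f : Fin n → ℤ) (g : ℕ → ℤ) → (∀ i → f i ≡ g (toℕ i)) → sumℤ (tabulate f) ≡ ∑ n g
  sum-tabulate zero    f g h = refl
  sum-tabulate (suc n) f g h = trans (cong₂ _+ᶻ_ (h Fin.zero) (sum-tabulate n (f ∘ Fin.suc) (g ∘ suc) (h ∘ Fin.suc))) (sym (∑-shift n g))

  sum-allFin : ∀ n (f : Fin n → ℤ) (g : ℕ → ℤ) → (∀ i → f i ≡ g (toℕ i)) → sumℤ (map f (allFin n)) ≡ ∑ n g
  sum-allFin n f g h = trans (cong sumℤ (Listₚ.map-tabulate (λ i → i) f)) (sum-tabulate n f g h)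

  %ℕ-unique : ∀ {v r} .{{_ : ℕ.NonZero v}} n → r ℕ.< v → + v ∣ᶻ n - + r → n %ℕ v ≡ r
  %ℕ-unique {v} {r} n r<v d with n %ℕ v ℕ.≟ r
  ... | yes e = e
  ... | no ≢r = contradiction (subst (+ v ∣ᶻ_) (eq n (+ r) (+ (n %ℕ v)) ((n /ℕ v) *ᶻ + v) (a≡a%ℕn+[a/ℕn]*n n v)) (∣m∣n⇒∣m-n d (divides (n /ℕ v) refl)))
      (∤-difference (n%ℕd<d n v) r<v ≢r)
    where
    eq₁ : ∀ x r q → x +ᶻ q - r - q ≡ x - r
    eq₁ = solve-∀
    eq : ∀ n r x q → n ≡ x +ᶻ q → n - r - q ≡ x - r
    eq n r x q e = trans (cong (λ t → t - r - q) e) (eq₁ x r q)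

  lift : ∀ {v} .{{_ : ℕ.NonZero v}} → GroupRingElt v → ℤ → ℤ
  lift {v} D n = D (fromℕ< (n%ℕd<d n v))

  lift≡ : ∀ {v} .{{_ : ℕ.NonZero v}} (D : GroupRingElt v) n i → + v ∣ᶻ n - + toℕ i → lift D n ≡ D i
  lift≡ {v} D n i d = cong D (trans (Finₚ.fromℕ<-cong (n %ℕ v) (toℕ i) (%ℕ-unique n (Finₚ.toℕ<n i) d) (n%ℕd<d n v) (Finₚ.toℕ<n i)) (Finₚ.fromℕ<-toℕ i (Finₚ.toℕ<n i)))

  lift-toℕ : ∀ {v} .{{_ : ℕ.NonZero v}} (D : GroupRingElt v) i → lift D (+ toℕ i) ≡ D i
  lift-toℕ {v} D i = lift≡ D (+ toℕ i) i (divides 0ℤ (ℤₚ.+-inverseʳ (+ toℕ i)))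

  lift-periodic : ∀ {v} .{{_ : ℕ.NonZero v}} (D : GroupRingElt v) → Periodic (+ v) (lift D)
  lift-periodic {v} D n = lift≡ D (n +ᶻ + v) (fromℕ< (n%ℕd<d n v)) (subst (λ r → + v ∣ᶻ n +ᶻ + v - + r) (sym (Finₚ.toℕ-fromℕ< (n%ℕd<d n v)))
      (subst (+ v ∣ᶻ_) (eq n (+ v) (+ (n %ℕ v))) (∣m∣n⇒∣m+n (∣-%ℕ v n) ℤ∣.∣-refl)))
    where
    eq : ∀ n v r → n - r +ᶻ v ≡ n +ᶻ v - r
    eq = solve-∀

  lift-⊕ : ∀ {v} .{{_ : ℕ.NonZero v}} (D : GroupRingElt v) (h k : Fin v) → lift D (+ toℕ h +ᶻ + toℕ k) ≡ D (h ⊕ k)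
  lift-⊕ {suc v} D h k = lift≡ D (+ toℕ h +ᶻ + toℕ k) (h ⊕ k)
    (subst (λ r → + suc v ∣ᶻ + toℕ h +ᶻ + toℕ k - + r) (sym (Finₚ.toℕ-fromℕ< (m%n<n (toℕ h ℕ.+ toℕ k) (suc v)))) (∣-%ℕ (suc v) (+ toℕ h +ᶻ + toℕ k)))

  corr≡correlation : ∀ {v} .{{_ : ℕ.NonZero v}} (D : GroupRingElt v) k → corr D k ≡ correlation v (lift D) (lift D) (+ toℕ k)
  corr≡correlation {v} D k = sum-allFin v (λ h → D (h ⊕ k) *ᶻ D h) _ λ h → sym (cong₂ _*ᶻ_ (lift-⊕ D h k) (lift-toℕ D h))

  correlation-periodic : ∀ {v} (F G : ℤ → ℤ) → Periodic (+ v) F → Periodic (+ v) (correlation v F G)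
  correlation-periodic {v} F G per g = ∑-cong v λ n → cong (_*ᶻ G (+ n)) (trans (cong F (eq (+ n) g (+ v))) (per (+ n +ᶻ g)))
    where
    eq : ∀ n g v → n +ᶻ (g +ᶻ v) ≡ n +ᶻ g +ᶻ v
    eq = solve-∀

  icw⇒correlation : ∀ {a v n} .{{_ : ℕ.NonZero v}} (D : GroupRingElt v) → IsICW a v n D → ∀ g → correlation v (lift D) (lift D) g ≡ + n *ᶻ δ (+ v) g
  icw⇒correlation {a} {v} {n} D (_ , h) g = trans (periodic-∣ {correlation v (lift D) (lift D)} (correlation-periodic (lift D) (lift D) (lift-periodic D)) g (+ toℕ k)
      (subst (λ r → + v ∣ᶻ g - + r) (sym k≡) (∣-%ℕ v g))) (trans (sym (corr≡correlation D k)) (cases (toℕ k ℕ.≟ 0)))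
    where
    k : Fin v
    k = fromℕ< (n%ℕd<d g v)
    k≡ : toℕ k ≡ g %ℕ v
    k≡ = Finₚ.toℕ-fromℕ< (n%ℕd<d g v)
    eq : ∀ g → g - 0ℤ ≡ g
    eq = solve-∀
    cases : Dec (toℕ k ≡ 0) → corr D k ≡ + n *ᶻ δ (+ v) g
    cases (yes e) = trans (proj₁ (h k) e) (sym (trans (cong (+ n *ᶻ_) (δ-yes (subst (+ v ∣ᶻ_) (eq g)
      (subst (λ r → + v ∣ᶻ g - + r) (trans (sym k≡) e) (∣-%ℕ v g))))) (ℤₚ.*-identityʳ (+ n))))
    cases (no ¬e) = trans (proj₂ (h k) ¬e) (sym (trans (cong (+ n *ᶻ_) (δ-no λ d → ¬e (trans k≡ (%ℕ-unique {v} {0} g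
      (ℕ.>-nonZero⁻¹ v) (subst (+ v ∣ᶻ_) (sym (eq g)) d))))) (ℤₚ.*-zeroʳ (+ n))))

  ∑-multiples : ∀ m q .{{_ : ℕ.NonZero q}} (f : ℤ → ℤ) → (∀ n → ¬ + q ∣ᶻ n → f n ≡ 0ℤ) → ∑ (m ℕ.* q) (λ n → f (+ n)) ≡ ∑ m (λ j → f (+ q *ᶻ + j))
  ∑-multiples m (suc q) f h = trans (∑-blocks m (suc q) (λ n → f (+ n))) (∑-cong m λ j → trans
    (∑-first q (λ i → f (+ (i ℕ.+ j ℕ.* suc q))) (λ i i<q → h (+ (suc i ℕ.+ j ℕ.* suc q)) λ d →
      ∤-small i<q (ℤ∣.∣m+n∣n⇒∣m {m = + suc i} (subst (+ suc q ∣ᶻ_) (ℤₚ.pos-+ (suc i) (j ℕ.* suc q)) d) (divides (+ j) (ℤₚ.pos-* j (suc q))))))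
    (cong f (trans (ℤₚ.pos-* j (suc q)) (ℤₚ.*-comm (+ j) (+ suc q)))))

  pos-^ : ∀ m n → + (m ^ n) ≡ (+ m) ^ᶻ n
  pos-^ m zero    = refl
  pos-^ m (suc n) = trans (ℤₚ.pos-* m (m ^ n)) (cong (+ m *ᶻ_) (pos-^ m n))

  act-poly : ∀ n f D g → act (poly n f) D g ≡ ∑ n (λ i → f (+ i) *ᶻ D (g - + i))
  act-poly zero    f D g = act-[] D g
  act-poly (suc n) f D g = trans (act-⊞ (mono (f (+ n)) (+ n)) (poly n f) D g) (cong₂ _+ᶻ_ (act-mono (f (+ n)) (+ n) D g) (act-poly n f D g))

  module Proof (a b e w p : ℕ) (pr : Prime p) (2<p : 2 < p) (p⊥w : Coprime p w) (w⊥p-1 : Coprime w (p ∸ 1)) {{w≢0 : ℕ.NonZero w}} where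
    open Cyclotomic p b w pr p⊥w
    open Multipliers p b w pr 2<p p⊥w using (coeff-⊛-bar)
    open Symmetry p b w pr 2<p p⊥w w⊥p-1 using (translate-signed; translate-weight)
    open Signs p b w pr 2<p p⊥w w⊥p-1 using (invariant)
    open Structure p b w pr 2<p p⊥w w⊥p-1

    module _ (D : GroupRingElt v) (icw : IsICW a v (p ^ (2 * e)) D) (proper : IsProper v D) where

      X : Laurent
      X = poly v (lift D)

      coeff-X : ∀ g → coeff X g ≡ lift D g
      coeff-X g = trans (act-poly v (lift D) (δ (+ v)) g) (trans (∑-cong v λ n → cong (lift D (+ n) *ᶻ_)
        (δ-iff (∣-flip g (+ n)) (∣-flip (+ n) g))) (∑-δ v (lift-periodic D) g))

      correlation-cong : ∀ {F G : ℤ → ℤ} → (∀ g → F g ≡ G g) → ∀ g → correlation v F F g ≡ correlation v G G g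
      correlation-cong h g = ∑-cong v λ n → cong₂ _*ᶻ_ (h (+ n +ᶻ g)) (h (+ n))

      p^2e : + (p ^ (2 * e)) ≡ (+ p) ^ᶻ (e * 2)
      p^2e = trans (pos-^ p (2 * e)) (cong ((+ p) ^ᶻ_) (ℕₚ.*-comm 2 e))

      weight-X : X ⊛ bar X ≈ const ((+ p) ^ᶻ (e * 2))
      weight-X = coeff⇒≈ λ g → trans (coeff-⊛-bar X X g) (trans (correlation-cong coeff-X g) (trans (icw⇒correlation D icw g)
        (trans (cong (_*ᶻ δ (+ v) g) p^2e) (sym (act-const ((+ p) ^ᶻ (e * 2)) (δ (+ v)) g)))))

      module _ (k : ℤ) (inv : ∀ {u} → + w ∣ᶻ u - 1ℤ → ¬ + p ∣ᶻ u → σ u (y^ k ⊛ X) ≈ y^ k ⊛ X) where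

        Y : Laurent
        Y = y^ k ⊛ X

        coeff-Y : ∀ g → coeff Y g ≡ lift D (g - k)
        coeff-Y g = trans (act-⊛ (y^ k) X (δ (+ v)) g) (trans (act-y^ k (coeff X) g) (coeff-X (g - k)))

        weight-Y : ∀ g → correlation v (coeff Y) (coeff Y) g ≡ + (p ^ (2 * e)) *ᶻ δ (+ v) g
        weight-Y g = trans (correlation-cong coeff-Y g) (trans (∑-cong v λ n → cong (λ x → lift D x *ᶻ lift D (+ n - k)) (eq (+ n) g k))
          (trans (∑-translate v {λ n → lift D (n +ᶻ g) *ᶻ lift D n} (λ n → cong₂ _*ᶻ_ (trans (cong (lift D) (eq₁ n (+ v) g)) (lift-periodic D (n +ᶻ g))) (lift-periodic D n)) (- k))
            (icw⇒correlation D icw g)))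
          where
          eq : ∀ n g k → n +ᶻ g - k ≡ n - k +ᶻ g
          eq = solve-∀
          eq₁ : ∀ n v g → n +ᶻ v +ᶻ g ≡ n +ᶻ g +ᶻ v
          eq₁ = solve-∀

        open Conclusion p b w pr 2<p p⊥w w⊥p-1 Y inv (+ (p ^ (2 * e))) weight-Y

        Y≤a : ∀ g → ℤ.∣ coeff Y g ∣ ≤ a
        Y≤a g = subst (λ x → ℤ.∣ x ∣ ≤ a) (sym (coeff-Y g)) (proj₁ icw (fromℕ< (n%ℕd<d (g - k) v)))

        instance
          P≢0 : ℕ.NonZero P
          P≢0 = ℕₚ.m^n≢0 p (suc b)

        -- y^P generates the subgroup of order w, so n ↦ P n identifies C_w with the support of A.
        α : ℤ → ℤ
        α n = A Y inv (+ P *ᶻ n)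

        α-periodic : Periodic (+ w) α
        α-periodic n = trans (cong (A Y inv) (trans (ℤₚ.*-distribˡ-+ (+ P) n (+ w)) (ℤ-+-congˡ (+ P *ᶻ n) (sym (pᵇw))))) (A-periodic Y inv (+ P *ᶻ n))
          where open Symmetry p b w pr 2<p p⊥w w⊥p-1 using (pᵇw)

        D′ : GroupRingElt w
        D′ h = α (+ toℕ h)

        lift-D′ : ∀ n → lift D′ n ≡ α n
        lift-D′ n = trans (cong (λ r → α (+ r)) (Finₚ.toℕ-fromℕ< (n%ℕd<d n w)))
          (sym (periodic-∣ {α} α-periodic n (+ (n %ℕ w)) (∣-%ℕ w n)))

        w*P : w ℕ.* P ≡ v
        w*P = trans (ℕₚ.*-comm w P) (ℕₚ.*-assoc p (p ^ b) w)

        corr-D′ : ∀ k → corr D′ k ≡ + (p ^ (2 * e)) *ᶻ δ (+ v) (+ P *ᶻ + toℕ k)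
        corr-D′ k = trans (corr≡correlation D′ k) (trans (∑-cong w λ n → cong₂ _*ᶻ_ (trans (lift-D′ (+ n +ᶻ + toℕ k))
            (cong (A Y inv) (ℤₚ.*-distribˡ-+ (+ P) (+ n) (+ toℕ k)))) (lift-D′ (+ n)))
          (trans (sym (∑-multiples w P (λ n → A Y inv (n +ᶻ + P *ᶻ + toℕ k) *ᶻ A Y inv n) λ n ¬d →
              trans (cong (A Y inv (n +ᶻ + P *ᶻ + toℕ k) *ᶻ_) (A-off Y inv n ¬d)) (ℤₚ.*-zeroʳ (A Y inv (n +ᶻ + P *ᶻ + toℕ k)))))
          (trans (cong (λ x → ∑ x (λ n → A Y inv (+ n +ᶻ + P *ᶻ + toℕ k) *ᶻ A Y inv (+ n))) w*P)
            (correlation-A (+ P *ᶻ + toℕ k) (divides (+ toℕ k) (ℤₚ.*-comm (+ P) (+ toℕ k)))))))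

        icw′ : IsICW (2 * a) w (p ^ (2 * e)) D′
        icw′ = (λ g → A≤2a a Y≤a (+ P *ᶻ + toℕ g)) , λ k →
            (λ k≡0 → trans (corr-D′ k) (trans (cong (+ (p ^ (2 * e)) *ᶻ_) (δ-yes (subst (λ x → + v ∣ᶻ + P *ᶻ + x) (sym k≡0) (divides 0ℤ (ℤₚ.*-zeroʳ (+ P)))))) (ℤₚ.*-identityʳ (+ (p ^ (2 * e))))))
          , (λ k≢0 → trans (corr-D′ k) (trans (cong (+ (p ^ (2 * e)) *ᶻ_) (δ-no (off k k≢0))) (ℤₚ.*-zeroʳ (+ (p ^ (2 * e))))))
          where
          open Symmetry p b w pr 2<p p⊥w w⊥p-1 using (pᵇw)
          off : ∀ k → toℕ k ≢ 0 → ¬ + v ∣ᶻ + P *ᶻ + toℕ k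
          off k k≢0 d = ℕ∣.>⇒∤ {{ℕ.≢-nonZero k≢0}} (Finₚ.toℕ<n k) (∣⇒∣ᵤ (*-cancelˡ-∣ (+ P) {+ w} {+ toℕ k} (subst (_∣ᶻ + P *ᶻ + toℕ k) pᵇw d)))

        -- If B = 0, then y^k X is supported on the multiples of P ≠ 1, so D translated by k modulo
        -- v lies in ℤ[H] for a proper subgroup H.
        B≢0 : ¬ (∀ n → B Y inv n ≡ 0ℤ)
        B≢0 B≡0 = contradicted (proper P (ℕ∣.divides w (sym w*P)) P≢1 (fromℕ< (n%ℕd<d k v)))
          where
          P≢1 : P ≢ 1
          P≢1 e = ℕₚ.<⇒≢ (ℕ.nonTrivial⇒n>1 p {{prime⇒nonTrivial pr}}) (sym (ℕₚ.m*n≡1⇒m≡1 p (p ^ b) e))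
          eq : ∀ i k r → i +ᶻ k - (k - r) ≡ i +ᶻ r
          eq = solve-∀
          eq₁ : ∀ i k → i +ᶻ k - k ≡ i
          eq₁ = solve-∀
          contradicted : ¬ Σ (Fin v) λ i → (D i ≢ 0ℤ) × ¬ (P ∣ (toℕ i ℕ.+ toℕ (fromℕ< (n%ℕd<d k v))))
          contradicted (i , D≢0 , ¬d) = cases (+ P ∣? (+ toℕ i +ᶻ k))
            where
            F≡D : coeff Y (+ toℕ i +ᶻ k) ≡ D i
            F≡D = trans (coeff-Y (+ toℕ i +ᶻ k)) (trans (cong (lift D) (eq₁ (+ toℕ i) k)) (lift-toℕ D i))
            cases : ¬ Dec (+ P ∣ᶻ + toℕ i +ᶻ k)
            cases (yes d) = ¬d (∣⇒∣ᵤ (subst (λ r → + P ∣ᶻ + toℕ i +ᶻ + r) (sym (Finₚ.toℕ-fromℕ< (n%ℕd<d k v)))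
              (subst (+ P ∣ᶻ_) (eq (+ toℕ i) k (+ (k %ℕ v))) (∣m∣n⇒∣m-n d (∣-trans P∣v (∣-%ℕ v k))))))
            cases (no ¬d′) = D≢0 (trans (sym F≡D) (trans (ℤₚ.i-j≡0⇒i≡j _ _ (B≡0 (+ toℕ i +ᶻ k))) (A-off Y inv (+ toℕ i +ᶻ k) ¬d′)))

        conclusion : p ≤ 4 * a × ICWExists (2 * a) w (p ^ (2 * e))
        conclusion = bound (p≤4a⊎B≡0 a Y≤a) , D′ , icw′
          where
          bound : p ≤ 4 * a ⊎ (∀ n → B Y inv n ≡ 0ℤ) → p ≤ 4 * a
          bound (inj₁ h)   = h
          bound (inj₂ B≡0) = contradiction B≡0 B≢0

      main : p ≤ 4 * a × ICWExists (2 * a) w (p ^ (2 * e))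
      main = go (translate-signed (e * 2) X weight-X)
        where
        go : (∃ λ k → ∀ {u} → + w ∣ᶻ u - 1ℤ → ¬ + p ∣ᶻ u → ∃ λ t → t *ᶻ t ≡ 1ℤ × σ u (y^ k ⊛ X) ≈ const t ⊛ (y^ k ⊛ X)) →
          p ≤ 4 * a × ICWExists (2 * a) w (p ^ (2 * e))
        go (k , signed) = conclusion k (invariant e (y^ k ⊛ X) (translate-weight (e * 2) X weight-X k) signed)

  prime-divisor : ∀ n .{{_ : ℕ.NonZero n}} → n ≢ 1 → ∃ λ s → Prime s × s ∣ n
  prime-divisor n n≢1 = go (factorise n)
    where
    go : PrimeFactorisation n → ∃ λ s → Prime s × s ∣ n
    go record { factors = []     ; isFactorisation = eq }                          = contradiction eq n≢1
    go record { factors = s ∷ ss ; isFactorisation = eq ; factorsPrime = ps ∷ _ } =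
      s , ps , ℕ∣.divides (product ss) (trans eq (ℕₚ.*-comm s _))

  -- A prime s dividing p - 1 has ord_s(p) = 1, so the second alternative also forces gcd(p - 1 , w) = 1.
  orders⇒gcd≡1 : ∀ {p w} .{{_ : ℕ.NonZero w}} → (∀ s → Prime s → s ∣ gcd (p ∸ 1) w → OrdEven s p) → gcd (p ∸ 1) w ≡ 1
  orders⇒gcd≡1 {p} {w} even with gcd (p ∸ 1) w ℕ.≟ 1
  ... | yes e = e
  ... | no ≢1 = go (prime-divisor (gcd (p ∸ 1) w) {{ℕ.≢-nonZero (GCD.gcd[m,n]≢0 (p ∸ 1) w (inj₂ (ℕ.≢-nonZero⁻¹ w)))}} ≢1)
    where
    go : (∃ λ s → Prime s × s ∣ gcd (p ∸ 1) w) → gcd (p ∸ 1) w ≡ 1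
    go (s , ps , s∣g) = contradiction (even s ps s∣g 1 (ℕ.s≤s ℕ.z≤n , s∣p¹-1 , λ j 0<j _ → 0<j)) (ℕ∣.>⇒∤ (ℕ.s≤s (ℕ.s≤s ℕ.z≤n)))
      where
      s∣p¹-1 : s ∣ (p ^ 1 ∸ 1)
      s∣p¹-1 = subst (λ x → s ∣ (x ∸ 1)) (sym (ℕₚ.*-identityʳ p)) (ℕ∣.∣-trans s∣g (GCD.gcd[m,n]∣m (p ∸ 1) w))

  theorem : ∀ a b e w p → 0 < b → 0 < w → Prime p → ¬ (p ≡ 2) → Coprime p w →
    (gcd (p ∸ 1) w ≡ 1 ⊎ (∀ s → Prime s → s ∣ gcd (p ∸ 1) w → OrdEven s p)) →
    ProperICWExists a (p ^ b * w) (p ^ (2 * e)) → p ≤ 4 * a × ICWExists (2 * a) w (p ^ (2 * e))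
  theorem a (suc b) e w p _ 0<w pr p≢2 p⊥w h exists = go (subst (λ v → ProperICWExists a v (p ^ (2 * e))) (ℕₚ.*-assoc p (p ^ b) w) exists)
    where
    instance
      w≢0 : ℕ.NonZero w
      w≢0 = ℕ.>-nonZero 0<w
    gcd≡1 : (gcd (p ∸ 1) w ≡ 1 ⊎ (∀ s → Prime s → s ∣ gcd (p ∸ 1) w → OrdEven s p)) → gcd (p ∸ 1) w ≡ 1
    gcd≡1 (inj₁ e)    = e
    gcd≡1 (inj₂ even) = orders⇒gcd≡1 even
    go : ProperICWExists a (p * (p ^ b * w)) (p ^ (2 * e)) → p ≤ 4 * a × ICWExists (2 * a) w (p ^ (2 * e))
    go (D , icw , proper) = Proof.main a b e w p pr (ℕₚ.≤∧≢⇒< (ℕ.nonTrivial⇒n>1 p {{prime⇒nonTrivial pr}}) (λ e → p≢2 (sym e))) p⊥w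
      (Coprimality.sym (Coprimality.gcd≡1⇒coprime (gcd≡1 h))) D icw proper

mainTheorem7 : (a b e w p : ℕ) → 0 < a → 0 < b → 0 < e → 0 < w → ¬ (2 ∣ w) →
    Prime p → ¬ (p ≡ 2) → Coprime p w →
    (gcd (p ∸ 1) w ≡ 1 ⊎ (∀ s → Prime s → s ∣ gcd (p ∸ 1) w → OrdEven s p)) →
    ProperICWExists a (p ^ b * w) (p ^ (2 * e)) →
    p ≤ 4 * a × ICWExists (2 * a) w (p ^ (2 * e))
mainTheorem7 a b e w p _ 0<b _ 0<w _ pr p≢2 p⊥w h exists = Assembly.theorem a b e w p 0<b 0<w pr p≢2 p⊥w h exists
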